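{- Let $n\ge0$ and let $\sigma,\tau\in\mathrm{Typ}(n)$ be types of $n$. (1) The coefficient of $P_\tau$ in the expansion of $H_\sigma$ in the basis $\{P_\rho:\rho\in\mathrm{Typ}(n)\}$ is $|\mathcal{PT}^{\mathrm{osimp}}(\sigma,\tau)|/z^\otimes_\tau$. (2) The coefficient of $P_\tau$ in the expansion of $E_\sigma$ in the basis $\{P_\rho:\rho\in\mathrm{Typ}(n)\}$ is $(-1)^{\ell(\tau)}|\mathcal{PT}^{\mathrm{osimp}}(\sigma,\tau)|/z^\otimes_\tau$.
   Context: A type of $n$ is a sequence $\tau=(\tau|^1,\tau|^2,\dots)$ of (possibly empty) integer partitions with $\sum_{i\ge1} i\,|\tau|^i|=n$, where $|\tau|^i|$ is the size of the partition $\tau|^i$; $\mathrm{Typ}(n)$ is the set of types of $n$. Its length is $\ell(\tau)=\sum_i\ell(\tau|^i)$. Each part $d$ of $\tau|^r$ gives a block $d^r$ of $\tau$ (degree $d$, multiplicity $r$; not exponentiation). We list the blocks as $\tau=d_1^{r_1}d_2^{r_2}\cdots d_s^{r_s}$ with $r_1\le\cdots\le r_s$, blocks of equal multiplicity $r$ being listed in the (weakly decreasing) order of the parts of $\tau|^r$. For a partition $\lambda$, $z_\lambda=\prod_{i\ge1} i^{m_i(\lambda)}m_i(\lambda)!$, where $m_i(\lambda)$ is the number of parts of $\lambda$ equal to $i$. For a type $\tau$, $z_\tau^\otimes=\prod_{i\ge1} z_{\tau|^i}$. Let $x_{i,j}$ ($i,j\ge 1$) be indeterminates with $\deg x_{i,j}=i$;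 all series have rational coefficients. A monomial is square-free if every exponent is at most $1$. $H_d$ is the sum of all monomials of degree $d$; $E_d$ is the sum over square-free monomials $f$ of degree $d$ of $(-1)^{m(f)}f$, where $m(f)$ is the number of indeterminates in $f$; for $d\ge1$, $P_d=\sum_{k\mid d}\sum_{j\ge1}k\,x_{k,j}^{d/k}$. For $F\in\{H,E,P\}$, $F_{d^r}$ is obtained from $F_d$ by replacing each $x_{i,j}$ by $x_{i,j}^r$, and $F_\tau=\prod F_{d^r}$ over all blocks $d^r$ of $\tau$ (counted with repetition; empty product $=1$). It is known that $\{F_\tau\}_{\tau\in\mathrm{Typ}(n)}$ is, for each such $F$, a $\mathbb{Q}$-basis of the space $\mathrm{PSym}(n)$ of polysymmetric functions of degree $n$ (power series homogeneous of degree $n$ that are symmetric separately in each variable set $\{x_{i,j}\}_{j\ge1}$). The diagram of a partition $\lambda$ has left-justified rows of $\lambda_1,\lambda_2,\dots$ cells; the tensor diagram of $\sigma$ is the sequence of diagrams of $\sigma|^1,\sigma|^2,\dots$, the $i$th one being called the $i$th tensor factor. A brick is a nonempty set of consecutive cells in one row; its length is its number of cells. An ordered simple polybrick tabloid of shape $\sigma$ and content $\tau=d_1^{r_1}\cdots d_s^{r_s}$ is a decomposition of the tensor diagram of $\sigma$ into $s$ disjoint bricks labeled bijectively by $1,\dots,s$ such that, for each $1\le l\le s$, the brick labeled $l$ has length $d_l$ and lies in the $r_l$th tensor factor, and the labels increase from left to right in each row of each tensor factor. $\mathcal{PT}^{\mathrm{osimp}}(\sigma,\tau)$ is the set of these.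 -}

module Defs where

open import Data.Bool.Base using (if_then_else_)
open import Data.Fin.Base as Fin using (Fin; zero; suc; toℕ)
import Data.Fin.Properties as Fin
open import Data.Integer.Base as ℤ using (ℤ; +_; -1ℤ)
open import Data.List.Base as List using
  (List; []; _∷_; _++_; map; concatMap; cartesianProductWith; filter; foldr;
   length; upTo; applyUpTo; allFin)
import Data.List.Properties as List
import Data.List.Membership.DecPropositional as DecMembership
open import Data.List.Membership.Propositional using (_∈_; lose)
open import Data.List.Membership.Propositional.Properties using
  (∈-cartesianProductWith⁺; ∈-concatMap⁺; ∈-upTo⁺; ∈-map⁺; ∈-map⁻;
   ∈-allFin)
open import Data.List.Relation.Binary.Disjoint.Propositional using (Disjoint)
open import Data.List.Relation.Unary.All as All using (All; []; _∷_)
import Data.List.Relation.Unary.All.Properties as All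
open import Data.List.Relation.Unary.AllPairs as AllPairs using ([]; _∷_)
import Data.List.Relation.Unary.AllPairs.Properties as AllPairs
open import Data.List.Relation.Unary.Any using (here; there)
open import Data.List.Relation.Unary.Linked as Linked using (Linked)
open import Data.List.Relation.Unary.Unique.Propositional using (Unique)
import Data.List.Relation.Unary.Unique.Propositional.Properties as Unique
open import Data.Nat.Base using
  (ℕ; zero; suc; _+_; _*_; _∸_; _^_; _!; _≤_; _≥_; _<_; z≤n; s≤s; NonZero; >-nonZero⁻¹)
open import Data.Nat.Divisibility using (_∣_; _∣?_)
open import Data.Nat.DivMod using (_/_)
open import Data.Nat.ListAction using (sum; product)
open import Data.Nat.ListAction.Properties using (product≢0)
open import Data.Nat.Properties using
  (_≟_; _≤?_; _≥?_; _<?_; nonZero?; ≤-irrelevant; ≡-irrelevant; ≤-trans;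
   ≤-reflexive; m≤m+n; m≤n+m; m≤n*m; +-mono-≤; _!≢0; m^n≢0; m*n≢0; suc-injective)
open import Data.Product.Base using (Σ-syntax; ∃; _×_; _,_; proj₁; proj₂)
open import Data.Product.Properties using (≡-dec)
open import Data.Rational.Base as ℚ using (ℚ; 0ℚ; 1ℚ)
open import Data.Vec.Base as Vec using (Vec; []; _∷_; lookup)
import Data.Vec.Properties as Vec
open import Function.Base using (_∘_)
open import Relation.Binary.Definitions using (DecidableEquality)
open import Relation.Binary.PropositionalEquality using
  (_≡_; _≢_; refl; sym; trans; cong; cong₂; subst)
open import Relation.Nullary.Decidable using
  (Dec; yes; no; does; ¬?; _×-dec_; _→-dec_)
open import Relation.Nullary.Negation using (¬_; contradiction)
open import Relation.Unary using (Decidable; Irrelevant)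

tuples : ∀ {A : Set} → List A → ∀ k → List (Vec A k)
tuples xs zero    = [] ∷ []
tuples xs (suc k) = cartesianProductWith _∷_ xs (tuples xs k)

refine : ∀ {A : Set} {P : A → Set} → Decidable P → List A → List (∃ P)
refine P? []       = []
refine P? (x ∷ xs) with P? x
... | yes p = (x , p) ∷ refine P? xs
... | no  _ = refine P? xs

IsPartition : List ℕ → Set
IsPartition ps = All NonZero ps × Linked _≥_ ps

isPartition? : Decidable IsPartition
isPartition? ps = All.all? nonZero? ps ×-dec Linked.linked? _≥?_ ps

Partition : Set
Partition = ∃ IsPartition

parts : Partition → List ℕ
parts = proj₁

size : Partition → ℕ
size = sum ∘ parts

-- m_i(λ)
multiplicity : ℕ → Partition → ℕ
multiplicity i p = length (filter (_≟ i) (parts p))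

-- Parts exceeding |λ| do not occur, so their factors in the product are 1.
z : Partition → ℕ
z p = product
  (map (λ i → suc i ^ multiplicity (suc i) p * multiplicity (suc i) p !)
       (upTo (size p)))

-- The tensor factors of a type of n are indexed by Fin n: position i
-- stands for the (suc i)-th factor.
index : ∀ {n} → Fin n → ℕ
index i = suc (toℕ i)

weight : ∀ {n} → Vec Partition n → ℕ
weight {n} v = sum (map (λ i → index i * size (lookup v i)) (allFin n))

-- A type of n is given by its first n partitions: all later ones are
-- empty, because i |τ|ⁱ| ≤ n.
Typ : ℕ → Set
Typ n = Σ[ v ∈ Vec Partition n ] weight v ≡ n

infix 9 _∣^_

_∣^_ : ∀ {n} → Typ n → Fin n → Partition
τ ∣^ i = lookup (proj₁ τ) i

ℓ : ∀ {n} → Typ n → ℕ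
ℓ {n} τ = sum (map (λ i → length (parts (τ ∣^ i))) (allFin n))

z⊗ : ∀ {n} → Typ n → ℕ
z⊗ {n} τ = product (map (λ i → z (τ ∣^ i)) (allFin n))

z≢0 : ∀ p → NonZero (z p)
z≢0 p = product≢0 (All.map⁺ (All.universal factor≢0 (upTo (size p))))
  where
  factor≢0 : ∀ i → NonZero (suc i ^ multiplicity (suc i) p * multiplicity (suc i) p !)
  factor≢0 i = m*n≢0 _ _ {{m^n≢0 (suc i) m}} {{m !≢0}}
    where
    m : ℕ
    m = multiplicity (suc i) p

z⊗≢0 : ∀ {n} (τ : Typ n) → NonZero (z⊗ τ)
z⊗≢0 {n} τ = product≢0 (All.map⁺ (All.universal (λ i → z≢0 (τ ∣^ i)) (allFin n)))

infixl 7 _/z⊗_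

_/z⊗_ : ∀ {n} → ℤ → Typ n → ℚ
a /z⊗ τ = (a ℚ./ z⊗ τ) {{z⊗≢0 τ}}

-- The block d^r is (d , i) with index i = r.
Block : ℕ → Set
Block n = ℕ × Fin n

blocks : ∀ {n} → Typ n → List (Block n)
blocks {n} τ = concatMap (λ i → map (_, i) (parts (τ ∣^ i))) (allFin n)

positiveLists : ℕ → ℕ → List (List ℕ)
positiveLists n k = map Vec.toList (tuples (map suc (upTo n)) k)

-- The partitions with at most n parts, none of which exceeds n; among
-- them are all partitions of size at most n.
boundedPartitions : ℕ → List Partition
boundedPartitions n = refine isPartition? (concatMap (positiveLists n) (upTo (suc n)))

types : ∀ n → List (Typ n)
types n = refine (λ v → weight v ≟ n) (tuples (boundedPartitions n) n)

∈-tuples : ∀ {A : Set} {xs : List A} {k} (v : Vec A k) →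
           (∀ i → lookup v i ∈ xs) → v ∈ tuples xs k
∈-tuples []      _    = here refl
∈-tuples (x ∷ v) v∈xs =
  ∈-cartesianProductWith⁺ _∷_ (v∈xs zero) (∈-tuples v (v∈xs ∘ suc))

tuples-unique : ∀ {A : Set} {xs : List A} → Unique xs → ∀ k → Unique (tuples xs k)
tuples-unique u zero    = [] ∷ []
tuples-unique u (suc k) =
  Unique.cartesianProductWith⁺ _∷_ Vec.∷-injective u (tuples-unique u k)

module _ {A : Set} {P : A → Set} (P? : Decidable P) (irr : Irrelevant P) where

  ∈-refine : ∀ {x xs} (p : P x) → x ∈ xs → (x , p) ∈ refine P? xs
  ∈-refine {xs = y ∷ _} p x∈ with P? y | x∈
  ... | yes q | here refl = here (cong (_ ,_) (irr p q))
  ... | yes _ | there x∈′ = there (∈-refine p x∈′)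
  ... | no ¬q | here refl = contradiction p ¬q
  ... | no  _ | there x∈′ = ∈-refine p x∈′

  refine-all : ∀ {Q : A → Set} {xs} → All Q xs → All (Q ∘ proj₁) (refine P? xs)
  refine-all {xs = []}    []       = []
  refine-all {xs = x ∷ _} (q ∷ qs) with P? x
  ... | yes _ = q ∷ refine-all qs
  ... | no  _ = refine-all qs

  refine-unique : ∀ {xs} → Unique xs → Unique (refine P? xs)
  refine-unique {[]}    []       = []
  refine-unique {x ∷ _} (x∉ ∷ u) with P? x
  ... | yes _ = All.map (λ x≢ eq → x≢ (cong proj₁ eq)) (refine-all x∉) ∷ refine-unique u
  ... | no  _ = refine-unique u

isPartition-irrelevant : Irrelevant IsPartition
isPartition-irrelevant (a , b) (c , d) =
  cong₂ _,_ (All.irrelevant (λ { {suc _} _ _ → refl }) a c)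
            (Linked.irrelevant ≤-irrelevant b d)

private
  member≤sum : ∀ {x xs} → x ∈ xs → x ≤ sum xs
  member≤sum (here refl)      = m≤m+n _ _
  member≤sum {xs = y ∷ _} (there x∈) = ≤-trans (member≤sum x∈) (m≤n+m _ y)

  length≤sum : ∀ {xs} → All NonZero xs → length xs ≤ sum xs
  length≤sum []           = z≤n
  length≤sum {x ∷ _} (nz ∷ nzs) = +-mono-≤ (>-nonZero⁻¹ x {{nz}}) (length≤sum nzs)

  lookup-fromList-∈ : ∀ (xs : List ℕ) i → lookup (Vec.fromList xs) i ∈ xs
  lookup-fromList-∈ (x ∷ xs) zero    = here refl
  lookup-fromList-∈ (x ∷ xs) (suc i) = there (lookup-fromList-∈ xs i)

  ∈-positives : ∀ {x n} → NonZero x → x ≤ n → x ∈ map suc (upTo n)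
  ∈-positives {suc x} _ x<n = ∈-map⁺ suc (∈-upTo⁺ x<n)

  toList-injective′ : ∀ {A : Set} {k} {v w : Vec A k} → Vec.toList v ≡ Vec.toList w → v ≡ w
  toList-injective′ {v = []}    {[]}    _  = refl
  toList-injective′ {v = _ ∷ _} {_ ∷ _} eq =
    cong₂ _∷_ (List.∷-injectiveˡ eq) (toList-injective′ (List.∷-injectiveʳ eq))

∈-positiveLists : ∀ {n} {ps} → All NonZero ps → sum ps ≤ n → ps ∈ positiveLists n (length ps)
∈-positiveLists {n} {ps} nz ps≤n =
  subst (_∈ positiveLists n (length ps)) (Vec.toList∘fromList ps)
    (∈-map⁺ Vec.toList (∈-tuples (Vec.fromList ps) λ i →
      let x∈ = lookup-fromList-∈ ps i in
      ∈-positives (All.lookup nz x∈) (≤-trans (member≤sum x∈) ps≤n)))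

∈-boundedPartitions : ∀ {n} (p : Partition) → size p ≤ n → p ∈ boundedPartitions n
∈-boundedPartitions {n} (ps , nz , dec) ps≤n =
  ∈-refine isPartition? isPartition-irrelevant {xs = lists} (nz , dec) ps∈lists
  where
  lists : List (List ℕ)
  lists = concatMap (positiveLists n) (upTo (suc n))

  ps∈lists : ps ∈ lists
  ps∈lists = ∈-concatMap⁺ (positiveLists n)
    (lose (∈-upTo⁺ (s≤s (≤-trans (length≤sum nz) ps≤n))) (∈-positiveLists nz ps≤n))

boundedPartitions-unique : ∀ n → Unique (boundedPartitions n)
boundedPartitions-unique n =
  refine-unique isPartition? isPartition-irrelevant
    {xs = concatMap (positiveLists n) (upTo (suc n))}
    (Unique.concat⁺
      (All.map⁺ (All.universal positiveLists-unique (upTo (suc n))))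
      (AllPairs.map⁺ (AllPairs.map disjoint (Unique.upTo⁺ (suc n)))))
  where
  positiveLists-unique : ∀ k → Unique (positiveLists n k)
  positiveLists-unique k = Unique.map⁺ toList-injective′
    (tuples-unique (Unique.map⁺ suc-injective (Unique.upTo⁺ n)) k)

  disjoint : ∀ {j k} → j ≢ k → Disjoint (positiveLists n j) (positiveLists n k)
  disjoint j≢k (p , q) with ∈-map⁻ Vec.toList p | ∈-map⁻ Vec.toList q
  ... | v , _ , refl | w , _ , eq =
    j≢k (trans (sym (Vec.length-toList v)) (trans (cong length eq) (Vec.length-toList w)))

∈-types : ∀ {n} (τ : Typ n) → τ ∈ types n
∈-types {n} (v , w≡n) =
  ∈-refine (λ v → weight v ≟ n) ≡-irrelevant w≡n
    (∈-tuples v λ i → ∈-boundedPartitions (lookup v i)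
      (≤-trans (m≤n*m _ (index i))
        (≤-trans (member≤sum (∈-map⁺ (λ j → index j * size (lookup v j)) (∈-allFin i)))
          (≤-reflexive w≡n))))

types-unique : ∀ n → Unique (types n)
types-unique n = refine-unique (λ v → weight v ≟ n) ≡-irrelevant
  (tuples-unique (boundedPartitions-unique n) n)

-- The entry in row i and column j (counted from 1) is the exponent of
-- x_{i,j}; entries outside the ragged array are 0.  A monomial has many
-- representatives, differing by trailing zeros and trailing empty rows;
-- the series below take the same value on all of them.
Monomial : Set
Monomial = List (List ℕ)

Series : Set
Series = Monomial → ℚ

infix 4 _≈_

_≈_ : Series → Series → Set
F ≈ G = ∀ f → F f ≡ G f

-- A power x_{i,j}^e is recorded as (i , j , e).
Power : Set
Power = ℕ × ℕ × ℕ

exponent : Power → ℕ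
exponent (_ , _ , e) = e

powerDegree : Power → ℕ
powerDegree (i , _ , e) = i * e

rowPowers : ℕ → ℕ → List ℕ → List Power
rowPowers i j []       = []
rowPowers i j (e ∷ es) = (i , j , e) ∷ rowPowers i (suc j) es

powersFrom : ℕ → Monomial → List Power
powersFrom i []         = []
powersFrom i (row ∷ f)  = rowPowers i 1 row ++ powersFrom (suc i) f

-- The powers with nonzero exponent whose product is the monomial.
powers : Monomial → List Power
powers f = filter (nonZero? ∘ exponent) (powersFrom 1 f)

degree : Monomial → ℕ
degree f = sum (map powerDegree (powers f))

-- m(f)
variables : Monomial → ℕ
variables f = length (powers f)

SquareFree : Monomial → Set
SquareFree f = All (λ x → exponent x ≤ 1) (powers f)

squareFree? : Decidable SquareFree
squareFree? f = All.all? (λ x → exponent x ≤? 1) (powers f)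

fromℤ : ℤ → ℚ
fromℤ a = a ℚ./ 1

sign : ℕ → ℤ
sign k = -1ℤ ℤ.^ k

∑ℚ : List ℚ → ℚ
∑ℚ = foldr ℚ._+_ 0ℚ

𝟙 : Series
𝟙 f = if does (degree f ≟ 0) then 1ℚ else 0ℚ

infixr 7 _•_

_•_ : ℚ → Series → Series
(c • F) f = c ℚ.* F f

-- All pairs (g , h) of monomials with g h = f.
splitsList : ∀ {A : Set} → (A → List (A × A)) → List A → List (List A × List A)
splitsList s []       = ([] , []) ∷ []
splitsList s (x ∷ xs) =
  cartesianProductWith (λ (a , b) (as , bs) → a ∷ as , b ∷ bs) (s x) (splitsList s xs)

splitsℕ : ℕ → List (ℕ × ℕ)
splitsℕ e = map (λ k → k , e ∸ k) (upTo (suc e))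

splits : Monomial → List (Monomial × Monomial)
splits = splitsList (splitsList splitsℕ)

infixr 7 _⊛_

_⊛_ : Series → Series → Series
(F ⊛ G) f = ∑ℚ (map (λ (g , h) → F g ℚ.* G h) (splits f))

-- The substitution x_{i,j} ↦ x_{i,j}^r: only r-th powers of monomials occur.
substPower : ∀ r .{{_ : NonZero r}} → Series → Series
substPower r F f =
  if does (All.all? (All.all? (r ∣?_)) f)
  then F (map (map (_/ r)) f)
  else 0ℚ

hSeries : ℕ → Series
hSeries d f = if does (degree f ≟ d) then 1ℚ else 0ℚ

eSeries : ℕ → Series
eSeries d f =
  if does ((degree f ≟ d) ×-dec squareFree? f)
  then fromℤ (sign (variables f))
  else 0ℚ

-- The monomials occurring in P_d (d ≥ 1) are the x_{k,j}^e with k e = d,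
-- each with coefficient k.
pCoefficient : ℕ → List Power → ℚ
pCoefficient d ((k , j , e) ∷ []) = if does (k * e ≟ d) then fromℤ (+ k) else 0ℚ
pCoefficient d _                  = 0ℚ

pSeries : ℕ → Series
pSeries d f = pCoefficient d (powers f)

blockProduct : (ℕ → Series) → ∀ {n} → Typ n → Series
blockProduct F τ = foldr _⊛_ 𝟙 (map (λ (d , i) → substPower (index i) (F d)) (blocks τ))

H E P : ∀ {n} → Typ n → Series
H = blockProduct hSeries
E = blockProduct eSeries
P = blockProduct pSeries

∑-types : ∀ {n} → (Typ n → Series) → Series
∑-types {n} F f = ∑ℚ (map (λ τ → F τ f) (types n))

infix 6 ∑-types
syntax ∑-types (λ τ → F) = ∑[ τ ] F

-- (i , j , c): column c of row j (counted from 0) of tensor factor i.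
Cell : ℕ → Set
Cell n = Fin n × ℕ × ℕ

_≟ᶜ_ : ∀ {n} → DecidableEquality (Cell n)
_≟ᶜ_ = ≡-dec Fin._≟_ (≡-dec _≟_ _≟_)

rowCells : ℕ → List ℕ → List (ℕ × ℕ)
rowCells j []       = []
rowCells j (p ∷ ps) = map (j ,_) (upTo p) ++ rowCells (suc j) ps

tensorDiagram : ∀ {n} → Typ n → List (Cell n)
tensorDiagram {n} σ = concatMap (λ i → map (i ,_) (rowCells 0 (parts (σ ∣^ i)))) (allFin n)

-- The brick of length d whose leftmost cell is given.
brick : ∀ {n} → ℕ → Cell n → List (Cell n)
brick d (i , j , c) = applyUpTo (λ k → i , j , c + k) d

module _ {n} (σ τ : Typ n) where

  Label : Set
  Label = Fin (length (blocks τ))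

  blockAt : Label → Block n
  blockAt l = List.lookup (blocks τ) l

  -- The brick labelled l has length d_l, so it is determined by its
  -- leftmost cell.
  Placement : Set
  Placement = Vec (Cell n) (length (blocks τ))

  module _ (b : Placement) where

    open DecMembership (_≟ᶜ_ {n}) using (_∈?_)

    brickAt : Label → List (Cell n)
    brickAt l = brick (proj₁ (blockAt l)) (lookup b l)

    BricksInDiagram : Set
    BricksInDiagram = ∀ l → All (_∈ tensorDiagram σ) (brickAt l)

    BricksCover : Set
    BricksCover = All (λ x → ∃ λ l → x ∈ brickAt l) (tensorDiagram σ)

    BricksDisjoint : Set
    BricksDisjoint = ∀ l l′ → l ≢ l′ → All (λ x → ¬ x ∈ brickAt l′) (brickAt l)

    RespectsMultiplicity : Set
    RespectsMultiplicity = ∀ l → proj₁ (lookup b l) ≡ proj₂ (blockAt l)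

    LeftInRowOf : Cell n → Cell n → Set
    LeftInRowOf (i , j , c) (i′ , j′ , c′) = i ≡ i′ × j ≡ j′ × c < c′

    LabelsIncrease : Set
    LabelsIncrease = ∀ l l′ → LeftInRowOf (lookup b l) (lookup b l′) → l Fin.< l′

    IsOrderedSimple : Set
    IsOrderedSimple =
      BricksInDiagram × BricksCover × BricksDisjoint × RespectsMultiplicity × LabelsIncrease

    leftInRowOf? : ∀ x y → Dec (LeftInRowOf x y)
    leftInRowOf? (i , j , c) (i′ , j′ , c′) = (i Fin.≟ i′) ×-dec (j ≟ j′) ×-dec (c <? c′)

    isOrderedSimple? : Dec IsOrderedSimple
    isOrderedSimple? =
      Fin.all? (λ l → All.all? (_∈? tensorDiagram σ) (brickAt l))
      ×-dec All.all? (λ x → Fin.any? λ l → x ∈? brickAt l) (tensorDiagram σ)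
      ×-dec Fin.all? (λ l → Fin.all? λ l′ →
              ¬? (l Fin.≟ l′) →-dec All.all? (λ x → ¬? (x ∈? brickAt l′)) (brickAt l))
      ×-dec Fin.all? (λ l → proj₁ (lookup b l) Fin.≟ proj₂ (blockAt l))
      ×-dec Fin.all? (λ l → Fin.all? λ l′ →
              leftInRowOf? (lookup b l) (lookup b l′) →-dec (l Fin.<? l′))

  -- A brick is nonempty, so its leftmost cell is a cell of the diagram.
  PT : List Placement
  PT = filter isOrderedSimple? (tuples (tensorDiagram σ) (length (blocks τ)))

∣PT∣ : ∀ {n} → Typ n → Typ n → ℕ
∣PT∣ σ τ = length (PT σ τ)

{-# OPTIONS --safe #-}

-- As functions of the list of rows of σ, both sides satisfy the same
-- recursion, which shortens the first row.  For H and E it is Newton's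
-- identity d H_d = Σ_k P_k H_{d-k}, respectively d E_d = - Σ_k P_k E_{d-k},
-- which reduces to a single indeterminate.  On the right-hand side, the
-- labels of an ordered simple tabloid fix the order of the bricks in each
-- row, so |PT(σ,τ)| is the number of ways to assign the bricks to rows of
-- the same tensor factor with matching lengths.  Counting the pairs of an
-- assignment and a cell of the first row by the brick through that cell gives
-- d |PT(σ,τ)| = Σ k |PT(σ′,τ ∖ k^r)| over the bricks k^r of τ, where d is the
-- length of the first row and σ′ is σ with k cells of that row removed.
-- Since z_τ = k m z_{τ ∖ k^r} with m the number of blocks k^r of τ, this is
-- the recursion for the coefficients.

module Submission where

open import Defs
open import Algebra.Bundles using (CommutativeMonoid)
import Algebra.Properties.CommutativeSemigroup as CommutativeSemigroup
open import Data.Bool.Base using (Bool; true; false; _∧_; not; if_then_else_)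
open import Data.Bool.ListAction using (all)
import Data.Bool.Properties as Bool
open import Data.Fin.Base as Fin using (Fin; zero; suc)
import Data.Fin.Properties as Fin
open import Data.Integer.Base as ℤ using (+_; -1ℤ; _*_)
import Data.Integer.Properties as ℤ
open import Data.List.Base as List using
  (List; []; _∷_; _++_; map; concat; concatMap; cartesianProductWith; filter;
   foldr; length; upTo; applyUpTo; allFin)
import Data.List.Properties as List
import Data.List.Membership.DecPropositional as DecMembership
open import Data.List.Membership.Propositional using (_∈_; _∉_; find; lose)
open import Data.List.Membership.Propositional.Properties using
  (∈-∃++; ∈-++⁺ˡ; ∈-++⁺ʳ; ∈-++⁻; ∈-map⁺; ∈-map⁻; ∈-filter⁺; ∈-filter⁻;
   ∈-concatMap⁺; ∈-concatMap⁻; ∈-applyUpTo⁺; ∈-applyUpTo⁻; ∈-upTo⁺; ∈-allFin;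
   ∈-lookup)
open import Data.List.Membership.Propositional.Properties.WithK using (unique∧set⇒bag)
open import Data.List.Relation.Binary.BagAndSetEquality using (∼bag⇒↭)
open import Data.List.Relation.Binary.Disjoint.Propositional using (Disjoint)
open import Data.List.Relation.Binary.Permutation.Propositional as ↭ using (_↭_; ↭-sym; ↭-trans; ↭⇒↭ₛ)
import Data.List.Relation.Binary.Permutation.Propositional.Properties as ↭
import Data.List.Relation.Binary.Permutation.Setoid.Properties as Permutationₛ
import Data.List.Relation.Binary.Pointwise as Pointwise
open import Data.List.Relation.Unary.All as All using (All; []; _∷_)
import Data.List.Relation.Unary.All.Properties as All
open import Data.List.Relation.Unary.AllPairs as AllPairs using (AllPairs; []; _∷_)
import Data.List.Relation.Unary.AllPairs.Properties as AllPairs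
open import Data.List.Relation.Unary.Any using (here; there)
import Data.List.Relation.Unary.Linked as Linked
import Data.List.Relation.Unary.Sorted.TotalOrder.Properties as Sorted
open import Data.List.Relation.Unary.Unique.Propositional using (Unique)
import Data.List.Relation.Unary.Unique.Propositional.Properties as Unique
open import Data.Nat.Base as ℕ using (ℕ; zero; suc; NonZero)
import Data.Nat.Properties as ℕ
open import Data.Nat.Divisibility using
  (_∣_; _∣?_; divides; n∣m*n; ∣⇒≤; _∣0; ∣m+n∣m⇒∣n; ∣m∣n⇒∣m+n; ∣-refl)
open import Data.Nat.DivMod using (_/_; m/n≡1+[m∸n]/n; m*n/n≡m; m/n*n≡m; m<n⇒m/n≡0)
open import Data.Nat.Induction using (<-rec)
open import Data.Nat.ListAction using (sum; product)
open import Data.Nat.ListAction.Properties using (sum-++; sum-↭; product-++; product-↭; product≢0)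
open import Data.Nat.Tactic.RingSolver using (solve-∀)
open import Data.Product.Base using (∃; ∃-syntax; _×_; _,_; proj₁; proj₂; map₁; map₂)
open import Data.Product.Properties using (≡-dec)
open import Data.Rational.Base as ℚ using (ℚ; 0ℚ; 1ℚ)
import Data.Rational.Properties as ℚ
open import Data.Rational.Solver using (module +-*-Solver)
import Data.Rational.Unnormalised.Base as ℚᵘ
import Data.Rational.Unnormalised.Properties as ℚᵘ
open import Data.Sum.Base using (_⊎_; inj₁; inj₂)
open import Data.Vec.Base as Vec using (Vec; []; _∷_; lookup; replicate; updateAt)
import Data.Vec.Properties as Vec
import Data.Vec.Relation.Binary.Pointwise.Extensional as Extensional
open import Function.Base using (_∘_; flip)
open import Function.Bundles using (_⇔_; mk⇔)
open import Relation.Binary.Bundles using (DecTotalOrder)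
open import Relation.Binary.Definitions using (DecidableEquality)
open import Relation.Binary.Properties.DecTotalOrder ℕ.≤-decTotalOrder using (≥-decTotalOrder)
open import Relation.Binary.PropositionalEquality using
  (_≡_; _≢_; refl; sym; trans; cong; cong₂; subst; subst₂; setoid; module ≡-Reasoning)
open import Relation.Nullary.Decidable using (Dec; yes; no; does; _×-dec_; dec-true; dec-false)
open import Relation.Nullary.Negation using (¬_; contradiction)
open import Relation.Unary using (Decidable)
open import Data.List.Sort ≥-decTotalOrder using (sort; sort-↭; sort-↗)

open CommutativeSemigroup ℕ.+-commutativeSemigroup
  using () renaming (interchange to ℕ-interchange)
open CommutativeSemigroup (CommutativeMonoid.commutativeSemigroup Bool.∧-commutativeMonoid)
  using () renaming (interchange to ∧-interchange)
open CommutativeSemigroup (CommutativeMonoid.commutativeSemigroup ℚ.+-0-commutativeMonoid)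
  using () renaming (interchange to +-interchange; x∙yz≈y∙xz to +-swapˡ)
open CommutativeSemigroup (CommutativeMonoid.commutativeSemigroup ℚ.*-1-commutativeMonoid)
  using () renaming (interchange to *-interchange; x∙yz≈y∙xz to *-swapˡ)
open +-*-Solver using (solve; _:=_; _:+_; _:*_; con)
open ≡-Reasoning

-- Finite sums and decompositions

-- Shortening a row leads out of the types: rows need no longer be sorted, one may become empty, and
-- the weight drops while the number `n` of tensor factors stays. So the recursion runs over
-- arbitrary lists of blocks in place of σ, and over vectors of `n` partitions of any weight up to
-- `n` in place of τ. The recursion concerns the blocks `F_(d^r)`, Newton's identity the series
-- `F_d`. The passage between them is that replacing every variable by its r-th power is a ring
-- homomorphism, which comes down to decompositions of single exponents. The sign is carried by the
-- power sums: with `c P_d` in place of `P_d`, where `c` is 1 for H and -1 for E, both identities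
-- have the same form, and the product over the blocks of τ yields the power of `c` with exponent
-- ℓ(τ). Inserting a block re-sorts a partition, so all quantities must be invariant under permuting
-- the content. For tabloids the labels obscure this; for assignments it can be proved by exchanging
-- two bricks.

private variable
  I J K : Set

-- Iverson bracket: as factors, the conditions in the definitions of the series obey the laws of
-- finite sums.
⟦_⟧ : Bool → ℚ
⟦ b ⟧ = if b then 1ℚ else 0ℚ

⟦∧⟧ : ∀ b c → ⟦ b ∧ c ⟧ ≡ ⟦ b ⟧ ℚ.* ⟦ c ⟧
⟦∧⟧ true  c = sym (ℚ.*-identityˡ ⟦ c ⟧)
⟦∧⟧ false c = sym (ℚ.*-zeroˡ ⟦ c ⟧)

if≡⟦⟧* : ∀ b x → (if b then x else 0ℚ) ≡ ⟦ b ⟧ ℚ.* x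
if≡⟦⟧* true  x = sym (ℚ.*-identityˡ x)
if≡⟦⟧* false x = sym (ℚ.*-zeroˡ x)

-- Opaque, so that unification does not unfold sums.
opaque
  ∑ : List I → (I → ℚ) → ℚ
  ∑ xs F = ∑ℚ (map F xs)

  ∑-def : ∀ (xs : List I) (F : I → ℚ) → ∑ xs F ≡ ∑ℚ (map F xs)
  ∑-def xs F = refl

  ∑-[] : ∀ (F : I → ℚ) → ∑ [] F ≡ 0ℚ
  ∑-[] F = refl

  ∑-∷ : ∀ x (xs : List I) (F : I → ℚ) → ∑ (x ∷ xs) F ≡ F x ℚ.+ ∑ xs F
  ∑-∷ x xs F = refl

  ∑-singleton : ∀ x (F : I → ℚ) → ∑ (x ∷ []) F ≡ F x
  ∑-singleton x F = ℚ.+-identityʳ (F x)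

  ∑-cong : ∀ (xs : List I) {F G : I → ℚ} → (∀ x → F x ≡ G x) → ∑ xs F ≡ ∑ xs G
  ∑-cong []       eq = refl
  ∑-cong (x ∷ xs) eq = cong₂ ℚ._+_ (eq x) (∑-cong xs eq)

  ∑-0 : ∀ (xs : List I) → ∑ xs (λ _ → 0ℚ) ≡ 0ℚ
  ∑-0 []       = refl
  ∑-0 (x ∷ xs) = trans (ℚ.+-identityˡ _) (∑-0 xs)

  ∑-+ : ∀ (xs : List I) (F G : I → ℚ) → ∑ xs (λ x → F x ℚ.+ G x) ≡ ∑ xs F ℚ.+ ∑ xs G
  ∑-+ []       F G = refl
  ∑-+ (x ∷ xs) F G =
    trans (cong (F x ℚ.+ G x ℚ.+_) (∑-+ xs F G)) (+-interchange (F x) (G x) _ _)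

  *-∑ : ∀ (xs : List I) c (F : I → ℚ) → c ℚ.* ∑ xs F ≡ ∑ xs (λ x → c ℚ.* F x)
  *-∑ []       c F = ℚ.*-zeroʳ c
  *-∑ (x ∷ xs) c F =
    trans (ℚ.*-distribˡ-+ c (F x) _) (cong (c ℚ.* F x ℚ.+_) (*-∑ xs c F))

  ∑-* : ∀ (xs : List I) (F : I → ℚ) c → ∑ xs F ℚ.* c ≡ ∑ xs (λ x → F x ℚ.* c)
  ∑-* xs F c = trans (ℚ.*-comm _ c) (trans (*-∑ xs c F) (∑-cong xs λ x → ℚ.*-comm c (F x)))

  ∑-++ : ∀ (xs ys : List I) (F : I → ℚ) → ∑ (xs ++ ys) F ≡ ∑ xs F ℚ.+ ∑ ys F
  ∑-++ []       ys F = sym (ℚ.+-identityˡ _)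
  ∑-++ (x ∷ xs) ys F = trans (cong (F x ℚ.+_) (∑-++ xs ys F)) (sym (ℚ.+-assoc (F x) _ _))

  ∑-map : ∀ (f : I → J) xs (F : J → ℚ) → ∑ (map f xs) F ≡ ∑ xs (F ∘ f)
  ∑-map f xs F = cong ∑ℚ (sym (List.map-∘ xs))

  ∑-concatMap : ∀ (f : I → List J) xs (F : J → ℚ) → ∑ (concatMap f xs) F ≡ ∑ xs (λ x → ∑ (f x) F)
  ∑-concatMap f []       F = refl
  ∑-concatMap f (x ∷ xs) F =
    trans (∑-++ (f x) _ F) (cong (∑ (f x) F ℚ.+_) (∑-concatMap f xs F))

  ∑-swap : ∀ (xs : List I) (ys : List J) (F : I → J → ℚ) →
           ∑ xs (λ x → ∑ ys (λ y → F x y)) ≡ ∑ ys (λ y → ∑ xs (λ x → F x y))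
  ∑-swap []       ys F = sym (∑-0 ys)
  ∑-swap (x ∷ xs) ys F =
    trans (cong (∑ ys (F x) ℚ.+_) (∑-swap xs ys F)) (sym (∑-+ ys (F x) _))

  ∑-cartesianProductWith : ∀ (f : I → J → K) xs ys (F : K → ℚ) →
    ∑ (cartesianProductWith f xs ys) F ≡ ∑ xs (λ x → ∑ ys (λ y → F (f x y)))
  ∑-cartesianProductWith f []       ys F = refl
  ∑-cartesianProductWith f (x ∷ xs) ys F =
    trans (∑-++ (map (f x) ys) _ F)
          (cong₂ ℚ._+_ (∑-map (f x) ys F) (∑-cartesianProductWith f xs ys F))

  ∑-↭ : ∀ {xs ys : List I} (F : I → ℚ) → xs ↭ ys → ∑ xs F ≡ ∑ ys F
  ∑-↭ F ↭.refl         = refl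
  ∑-↭ F (↭.prep x p)   = cong (F x ℚ.+_) (∑-↭ F p)
  ∑-↭ F (↭.swap x y p) =
    trans (cong (λ t → F x ℚ.+ (F y ℚ.+ t)) (∑-↭ F p)) (+-swapˡ (F x) (F y) _)
  ∑-↭ F (↭.trans p q)  = trans (∑-↭ F p) (∑-↭ F q)

  ∑-filter : ∀ {P : I → Set} (P? : Decidable P) xs (F : I → ℚ) →
             ∑ (filter P? xs) F ≡ ∑ xs (λ x → ⟦ does (P? x) ⟧ ℚ.* F x)
  ∑-filter P? []       F = refl
  ∑-filter P? (x ∷ xs) F with P? x
  ... | yes _ = cong₂ ℚ._+_ (sym (ℚ.*-identityˡ (F x))) (∑-filter P? xs F)
  ... | no  _ = trans (∑-filter P? xs F)
    (sym (trans (cong (ℚ._+ _) (ℚ.*-zeroˡ (F x))) (ℚ.+-identityˡ _)))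

∑² : List (I × J) → (I → J → ℚ) → ℚ
∑² xs W = ∑ xs (λ (a , b) → W a b)

∑²-cong : ∀ (xs : List (I × J)) {V W : I → J → ℚ} → (∀ a b → V a b ≡ W a b) → ∑² xs V ≡ ∑² xs W
∑²-cong xs eq = ∑-cong xs (λ (a , b) → eq a b)

-- Convolution identities are stated as identities of sums over all
-- decompositions against an arbitrary weight W, so that they lift from
-- exponents to lists of exponents and from there to monomials.
Split : Set → Set
Split I = I → List (I × I)

-- Regarding `s` as a comultiplication, these are the laws that make the dual convolution product
-- commutative and associative.
Cocommutative Coassociative : Split I → Set
Cocommutative {I} s = ∀ x (W : I → I → ℚ) → ∑² (s x) W ≡ ∑² (s x) (flip W)
Coassociative {I} s = ∀ x (W : I → I → I → ℚ) →
  ∑² (s x) (λ a b → ∑² (s a) (λ c d → W c d b)) ≡ ∑² (s x) (λ a b → ∑² (s b) (λ c d → W a c d))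

Counit : Split I → (I → ℚ) → Set
Counit {I} s η = ∀ x (W : I → ℚ) → ∑² (s x) (λ a b → η a ℚ.* W b) ≡ W x

-- Amounts to `φ a + φ b = φ x` for all decompositions `(a , b)` of `x`, in a form that rewrites
-- under the summation sign.
Additive : Split I → (I → ℕ) → Set
Additive {I} s φ = ∀ x (W : ℕ → I → I → ℚ) →
  ∑² (s x) (λ a b → W (φ a ℕ.+ φ b) a b) ≡ ∑² (s x) (W (φ x))

-- Used with `δ` divisibility by `r` and `q` division by `r`: decompositions into two divisible
-- parts exist only for divisible `x`, and `q` matches them with the decompositions of `q x`.
Multiplicative : Split I → (I → Bool) → (I → I) → Set
Multiplicative {I} s δ q = ∀ x (W : I → I → ℚ) →
  ∑² (s x) (λ a b → ⟦ δ a ⟧ ℚ.* ⟦ δ b ⟧ ℚ.* W (q a) (q b)) ≡ ⟦ δ x ⟧ ℚ.* ∑² (s (q x)) W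

module _ (s : Split I) where

  ∑²-splitsList : ∀ x xs (W : List I → List I → ℚ) → ∑² (splitsList s (x ∷ xs)) W ≡
    ∑² (s x) (λ a b → ∑² (splitsList s xs) (λ as bs → W (a ∷ as) (b ∷ bs)))
  ∑²-splitsList x xs W =
    ∑-cartesianProductWith (λ (a , b) (as , bs) → a ∷ as , b ∷ bs) (s x) (splitsList s xs)
      (λ (a , b) → W a b)

  splitsList-cocommutative : Cocommutative s → Cocommutative (splitsList s)
  splitsList-cocommutative comm []       W = trans (∑-singleton _ _) (sym (∑-singleton _ _))
  splitsList-cocommutative comm (x ∷ xs) W = begin
    ∑² (splitsList s (x ∷ xs)) W
      ≡⟨ ∑²-splitsList x xs W ⟩
    ∑² (s x) (λ a b → ∑² (splitsList s xs) (λ as bs → W (a ∷ as) (b ∷ bs)))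
      ≡⟨ comm x _ ⟩
    ∑² (s x) (λ a b → ∑² (splitsList s xs) (λ as bs → W (b ∷ as) (a ∷ bs)))
      ≡⟨ ∑²-cong (s x) (λ a b → splitsList-cocommutative comm xs _) ⟩
    ∑² (s x) (λ a b → ∑² (splitsList s xs) (λ as bs → W (b ∷ bs) (a ∷ as)))
      ≡⟨ ∑²-splitsList x xs (flip W) ⟨
    ∑² (splitsList s (x ∷ xs)) (flip W) ∎

  -- `∑-swap` moves both sums over the head in front of both sums over the tail; then induction
  -- reassociates the tail and `assoc` the head.
  splitsList-coassociative : Coassociative s → Coassociative (splitsList s)
  splitsList-coassociative assoc []       W = trans
    (trans (∑-singleton _ _) (∑-singleton _ _))
    (sym (trans (∑-singleton _ _) (∑-singleton _ _)))
  splitsList-coassociative assoc (x ∷ xs) W = begin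
    ∑² (S (x ∷ xs)) (λ a b → ∑² (S a) (λ c d → W c d b))
      ≡⟨ ∑²-splitsList x xs _ ⟩
    ∑² (s x) (λ a b → ∑² (S xs) (λ as bs → ∑² (S (a ∷ as)) (λ c d → W c d (b ∷ bs))))
      ≡⟨ ∑²-cong (s x) (λ a b → trans
           (∑²-cong (S xs) λ as bs → ∑²-splitsList a as _)
           (∑-swap (S xs) (s a) _)) ⟩
    ∑² (s x) (λ a b → ∑² (s a) (λ c d → ∑² (S xs) (λ as bs → ∑² (S as) (λ cs ds →
      W (c ∷ cs) (d ∷ ds) (b ∷ bs)))))
      ≡⟨ ∑²-cong (s x) (λ a b → ∑²-cong (s a) λ c d → splitsList-coassociative assoc xs _) ⟩
    ∑² (s x) (λ a b → ∑² (s a) (λ c d → ∑² (S xs) (λ as bs → ∑² (S bs) (λ cs ds →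
      W (c ∷ as) (d ∷ cs) (b ∷ ds)))))
      ≡⟨ assoc x _ ⟩
    ∑² (s x) (λ a b → ∑² (s b) (λ c d → ∑² (S xs) (λ as bs → ∑² (S bs) (λ cs ds →
      W (a ∷ as) (c ∷ cs) (d ∷ ds)))))
      ≡⟨ ∑²-cong (s x) (λ a b → trans
           (∑²-cong (S xs) λ as bs → ∑²-splitsList b bs _)
           (∑-swap (S xs) (s b) _)) ⟨
    ∑² (s x) (λ a b → ∑² (S xs) (λ as bs → ∑² (S (b ∷ bs)) (λ c d → W (a ∷ as) c d)))
      ≡⟨ ∑²-splitsList x xs _ ⟨
    ∑² (S (x ∷ xs)) (λ a b → ∑² (S b) (λ c d → W a c d)) ∎
    where
    S : Split (List I)
    S = splitsList s

  splitsList-counit : ∀ (η : I → ℚ) (η* : List I → ℚ) → η* [] ≡ 1ℚ →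
    (∀ x xs → η* (x ∷ xs) ≡ η x ℚ.* η* xs) → Counit s η → Counit (splitsList s) η*
  splitsList-counit η η* η[] η∷ counit [] W =
    trans (∑-singleton _ _) (trans (cong (ℚ._* W []) η[]) (ℚ.*-identityˡ _))
  splitsList-counit η η* η[] η∷ counit (x ∷ xs) W = begin
    ∑² (splitsList s (x ∷ xs)) (λ a b → η* a ℚ.* W b)
      ≡⟨ ∑²-splitsList x xs _ ⟩
    ∑² (s x) (λ a b → ∑² (splitsList s xs) (λ as bs → η* (a ∷ as) ℚ.* W (b ∷ bs)))
      ≡⟨ ∑²-cong (s x) (λ a b → trans
           (∑²-cong (splitsList s xs) λ as bs →
             trans (cong (ℚ._* _) (η∷ a as)) (ℚ.*-assoc (η a) _ _))
           (sym (*-∑ (splitsList s xs) (η a) _))) ⟩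
    ∑² (s x) (λ a b → η a ℚ.* ∑² (splitsList s xs) (λ as bs → η* as ℚ.* W (b ∷ bs)))
      ≡⟨ ∑²-cong (s x) (λ a b →
           cong (η a ℚ.*_) (splitsList-counit η η* η[] η∷ counit xs (λ bs → W (b ∷ bs)))) ⟩
    ∑² (s x) (λ a b → η a ℚ.* W (b ∷ xs))
      ≡⟨ counit x (λ b → W (b ∷ xs)) ⟩
    W (x ∷ xs) ∎

  splitsList-additive : ∀ (φ : I → ℕ) (φ* : List I → ℕ) → φ* [] ≡ 0 →
    (∀ x xs → φ* (x ∷ xs) ≡ φ x ℕ.+ φ* xs) → Additive s φ → Additive (splitsList s) φ*
  splitsList-additive φ φ* φ[] φ∷ add [] W =
    trans (∑-singleton _ _)
      (trans (cong (λ k → W k [] []) (trans (cong₂ ℕ._+_ φ[] φ[]) (sym φ[])))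
             (sym (∑-singleton _ _)))
  splitsList-additive φ φ* φ[] φ∷ add (x ∷ xs) W = begin
    ∑² (S (x ∷ xs)) (λ a b → W (φ* a ℕ.+ φ* b) a b)
      ≡⟨ ∑²-splitsList x xs _ ⟩
    ∑² (s x) (λ a b → ∑² (S xs) (λ as bs →
      W (φ* (a ∷ as) ℕ.+ φ* (b ∷ bs)) (a ∷ as) (b ∷ bs)))
      ≡⟨ ∑²-cong (s x) (λ a b → ∑²-cong (S xs) λ as bs →
           cong (λ k → W k (a ∷ as) (b ∷ bs))
             (trans (cong₂ ℕ._+_ (φ∷ a as) (φ∷ b bs)) (ℕ-interchange (φ a) (φ* as) (φ b) (φ* bs)))) ⟩
    ∑² (s x) (λ a b → ∑² (S xs) (λ as bs →
      W ((φ a ℕ.+ φ b) ℕ.+ (φ* as ℕ.+ φ* bs)) (a ∷ as) (b ∷ bs)))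
      ≡⟨ ∑²-cong (s x) (λ a b → splitsList-additive φ φ* φ[] φ∷ add xs
           (λ k as bs → W ((φ a ℕ.+ φ b) ℕ.+ k) (a ∷ as) (b ∷ bs))) ⟩
    ∑² (s x) (λ a b → ∑² (S xs) (λ as bs → W ((φ a ℕ.+ φ b) ℕ.+ φ* xs) (a ∷ as) (b ∷ bs)))
      ≡⟨ add x (λ k a b → ∑² (S xs) (λ as bs → W (k ℕ.+ φ* xs) (a ∷ as) (b ∷ bs))) ⟩
    ∑² (s x) (λ a b → ∑² (S xs) (λ as bs → W (φ x ℕ.+ φ* xs) (a ∷ as) (b ∷ bs)))
      ≡⟨ ∑²-splitsList x xs _ ⟨
    ∑² (S (x ∷ xs)) (W (φ x ℕ.+ φ* xs))
      ≡⟨ cong (λ k → ∑² (S (x ∷ xs)) (W k)) (φ∷ x xs) ⟨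
    ∑² (S (x ∷ xs)) (W (φ* (x ∷ xs))) ∎
    where
    S : Split (List I)
    S = splitsList s

  splitsList-multiplicative : ∀ (δ : I → Bool) (δ* : List I → Bool) (q : I → I) → δ* [] ≡ true →
    (∀ x xs → δ* (x ∷ xs) ≡ δ x ∧ δ* xs) → Multiplicative s δ q →
    Multiplicative (splitsList s) δ* (map q)
  splitsList-multiplicative δ δ* q δ[] δ∷ mult [] W =
    trans (∑-singleton _ _)
      (trans (cong (λ b → ⟦ b ⟧ ℚ.* ⟦ b ⟧ ℚ.* W [] []) δ[])
             (cong₂ (λ b x → ⟦ b ⟧ ℚ.* x) (sym δ[]) (sym (∑-singleton _ _))))
  splitsList-multiplicative δ δ* q δ[] δ∷ mult (x ∷ xs) W = begin
    ∑² (S (x ∷ xs)) (λ a b → ⟦ δ* a ⟧ ℚ.* ⟦ δ* b ⟧ ℚ.* W (map q a) (map q b))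
      ≡⟨ ∑²-splitsList x xs _ ⟩
    ∑² (s x) (λ a b → ∑² (S xs) (λ as bs →
      ⟦ δ* (a ∷ as) ⟧ ℚ.* ⟦ δ* (b ∷ bs) ⟧ ℚ.* W′ (q a) (q b) (map q as) (map q bs)))
      ≡⟨ ∑²-cong (s x) (λ a b → trans
           (∑²-cong (S xs) λ as bs → regroup a b as bs _)
           (sym (*-∑ (S xs) (⟦ δ a ⟧ ℚ.* ⟦ δ b ⟧) _))) ⟩
    ∑² (s x) (λ a b → ⟦ δ a ⟧ ℚ.* ⟦ δ b ⟧ ℚ.* ∑² (S xs) (λ as bs →
      ⟦ δ* as ⟧ ℚ.* ⟦ δ* bs ⟧ ℚ.* W′ (q a) (q b) (map q as) (map q bs)))
      ≡⟨ ∑²-cong (s x) (λ a b → cong (⟦ δ a ⟧ ℚ.* ⟦ δ b ⟧ ℚ.*_)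
           (splitsList-multiplicative δ δ* q δ[] δ∷ mult xs (W′ (q a) (q b)))) ⟩
    ∑² (s x) (λ a b → ⟦ δ a ⟧ ℚ.* ⟦ δ b ⟧ ℚ.*
      (⟦ δ* xs ⟧ ℚ.* ∑² (S (map q xs)) (W′ (q a) (q b))))
      ≡⟨ mult x (λ a b → ⟦ δ* xs ⟧ ℚ.* ∑² (S (map q xs)) (W′ a b)) ⟩
    ⟦ δ x ⟧ ℚ.* ∑² (s (q x)) (λ a b → ⟦ δ* xs ⟧ ℚ.* ∑² (S (map q xs)) (W′ a b))
      ≡⟨ cong (⟦ δ x ⟧ ℚ.*_) (*-∑ (s (q x)) ⟦ δ* xs ⟧ _) ⟨
    ⟦ δ x ⟧ ℚ.* (⟦ δ* xs ⟧ ℚ.* ∑² (s (q x)) (λ a b → ∑² (S (map q xs)) (W′ a b)))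
      ≡⟨ ℚ.*-assoc ⟦ δ x ⟧ _ _ ⟨
    ⟦ δ x ⟧ ℚ.* ⟦ δ* xs ⟧ ℚ.* ∑² (s (q x)) (λ a b → ∑² (S (map q xs)) (W′ a b))
      ≡⟨ cong₂ ℚ._*_ (trans (cong ⟦_⟧ (δ∷ x xs)) (⟦∧⟧ (δ x) _)) (∑²-splitsList (q x) (map q xs) W) ⟨
    ⟦ δ* (x ∷ xs) ⟧ ℚ.* ∑² (S (map q (x ∷ xs))) W ∎
    where
    S : Split (List I)
    S = splitsList s

    W′ : I → I → List I → List I → ℚ
    W′ a b as bs = W (a ∷ as) (b ∷ bs)

    regroup : ∀ a b as bs w →
      ⟦ δ* (a ∷ as) ⟧ ℚ.* ⟦ δ* (b ∷ bs) ⟧ ℚ.* w ≡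
      ⟦ δ a ⟧ ℚ.* ⟦ δ b ⟧ ℚ.* (⟦ δ* as ⟧ ℚ.* ⟦ δ* bs ⟧ ℚ.* w)
    regroup a b as bs w
      rewrite δ∷ a as | δ∷ b bs | ⟦∧⟧ (δ a) (δ* as) | ⟦∧⟧ (δ b) (δ* bs) =
      solve 5 (λ x y z t u → x :* y :* (z :* t) :* u := x :* z :* (y :* t :* u)) refl
        (⟦ δ a ⟧) (⟦ δ* as ⟧) (⟦ δ b ⟧) (⟦ δ* bs ⟧) w

-- Decompositions of a single exponent

splitsℕ-suc : ∀ e → splitsℕ (suc e) ≡ (0 , suc e) ∷ map (map₁ suc) (splitsℕ e)
splitsℕ-suc e = cong ((0 , suc e) ∷_) (begin
  map (λ k → k , suc e ℕ.∸ k) (applyUpTo suc (suc e))   ≡⟨ List.map-applyUpTo suc (λ k → k , suc e ℕ.∸ k) (suc e) ⟩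
  applyUpTo (λ k → suc k , e ℕ.∸ k) (suc e)             ≡⟨ List.map-upTo _ (suc e) ⟨
  map (λ k → suc k , e ℕ.∸ k) (upTo (suc e))            ≡⟨ List.map-∘ (upTo (suc e)) ⟩
  map (map₁ suc) (splitsℕ e)                            ∎)

∑²-splitsℕ-suc : ∀ e (W : ℕ → ℕ → ℚ) →
  ∑² (splitsℕ (suc e)) W ≡ W 0 (suc e) ℚ.+ ∑² (splitsℕ e) (λ a b → W (suc a) b)
∑²-splitsℕ-suc e W = trans (cong (λ xs → ∑² xs W) (splitsℕ-suc e))
  (trans (∑-∷ _ _ _) (cong (W 0 (suc e) ℚ.+_) (∑-map (map₁ suc) (splitsℕ e) _)))

∑²-splitsℕ-0 : ∀ (W : ℕ → ℕ → ℚ) → ∑² (splitsℕ 0) W ≡ W 0 0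
∑²-splitsℕ-0 W = ∑-singleton (0 , 0) _

∑²-splitsℕ-sucʳ : ∀ e (W : ℕ → ℕ → ℚ) →
  ∑² (splitsℕ (suc e)) W ≡ ∑² (splitsℕ e) (λ a b → W a (suc b)) ℚ.+ W (suc e) 0
∑²-splitsℕ-sucʳ zero    W =
  trans (∑²-splitsℕ-suc 0 W) (trans
    (cong (W 0 1 ℚ.+_) (∑²-splitsℕ-0 (λ a b → W (suc a) b)))
    (cong (ℚ._+ W 1 0) (sym (∑²-splitsℕ-0 (λ a b → W a (suc b))))))
∑²-splitsℕ-sucʳ (suc e) W = begin
  ∑² (splitsℕ (suc (suc e))) W
    ≡⟨ ∑²-splitsℕ-suc (suc e) W ⟩
  W 0 (suc (suc e)) ℚ.+ ∑² (splitsℕ (suc e)) (λ a b → W (suc a) b)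
    ≡⟨ cong (W 0 (suc (suc e)) ℚ.+_) (∑²-splitsℕ-sucʳ e _) ⟩
  W 0 (suc (suc e)) ℚ.+ (∑² (splitsℕ e) (λ a b → W (suc a) (suc b)) ℚ.+ W (suc (suc e)) 0)
    ≡⟨ ℚ.+-assoc (W 0 (suc (suc e))) _ _ ⟨
  W 0 (suc (suc e)) ℚ.+ ∑² (splitsℕ e) (λ a b → W (suc a) (suc b)) ℚ.+ W (suc (suc e)) 0
    ≡⟨ cong (ℚ._+ W (suc (suc e)) 0) (∑²-splitsℕ-suc e (λ a b → W a (suc b))) ⟨
  ∑² (splitsℕ (suc e)) (λ a b → W a (suc b)) ℚ.+ W (suc (suc e)) 0 ∎

splitsℕ-cocommutative : Cocommutative splitsℕ
splitsℕ-cocommutative zero    W = trans (∑²-splitsℕ-0 _) (sym (∑²-splitsℕ-0 _))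
splitsℕ-cocommutative (suc e) W = begin
  ∑² (splitsℕ (suc e)) W
    ≡⟨ ∑²-splitsℕ-suc e W ⟩
  W 0 (suc e) ℚ.+ ∑² (splitsℕ e) (λ a b → W (suc a) b)
    ≡⟨ cong (W 0 (suc e) ℚ.+_) (splitsℕ-cocommutative e (λ a b → W (suc a) b)) ⟩
  W 0 (suc e) ℚ.+ ∑² (splitsℕ e) (λ a b → W (suc b) a)
    ≡⟨ ℚ.+-comm (W 0 (suc e)) _ ⟩
  ∑² (splitsℕ e) (λ a b → W (suc b) a) ℚ.+ W 0 (suc e)
    ≡⟨ ∑²-splitsℕ-sucʳ e (flip W) ⟨
  ∑² (splitsℕ (suc e)) (flip W) ∎

splitsℕ-coassociative : Coassociative splitsℕ
splitsℕ-coassociative zero    W =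
  trans (trans (∑²-splitsℕ-0 _) (∑²-splitsℕ-0 _)) (sym (trans (∑²-splitsℕ-0 _) (∑²-splitsℕ-0 _)))
splitsℕ-coassociative (suc e) W = begin
  ∑² (splitsℕ (suc e)) (λ a b → ∑² (splitsℕ a) (λ c d → W c d b))
    ≡⟨ ∑²-splitsℕ-suc e _ ⟩
  ∑² (splitsℕ 0) (λ c d → W c d (suc e)) ℚ.+ ∑² (splitsℕ e) (λ a b → ∑² (splitsℕ (suc a)) (λ c d → W c d b))
    ≡⟨ cong₂ ℚ._+_ (∑²-splitsℕ-0 _) (trans
         (∑²-cong (splitsℕ e) λ a b → ∑²-splitsℕ-suc a (λ c d → W c d b))
         (∑-+ (splitsℕ e) _ _)) ⟩
  W 0 0 (suc e) ℚ.+ (∑² (splitsℕ e) (λ a b → W 0 (suc a) b) ℚ.+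
    ∑² (splitsℕ e) (λ a b → ∑² (splitsℕ a) (λ c d → W (suc c) d b)))
    ≡⟨ ℚ.+-assoc (W 0 0 (suc e)) _ _ ⟨
  W 0 0 (suc e) ℚ.+ ∑² (splitsℕ e) (λ a b → W 0 (suc a) b) ℚ.+
    ∑² (splitsℕ e) (λ a b → ∑² (splitsℕ a) (λ c d → W (suc c) d b))
    ≡⟨ cong₂ ℚ._+_ (sym (∑²-splitsℕ-suc e (W 0))) (splitsℕ-coassociative e (λ c d b → W (suc c) d b)) ⟩
  ∑² (splitsℕ (suc e)) (W 0) ℚ.+
    ∑² (splitsℕ e) (λ a b → ∑² (splitsℕ b) (λ c d → W (suc a) c d))
    ≡⟨ ∑²-splitsℕ-suc e _ ⟨
  ∑² (splitsℕ (suc e)) (λ a b → ∑² (splitsℕ b) (λ c d → W a c d)) ∎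

isZero : ℕ → Bool
isZero zero    = true
isZero (suc _) = false

splitsℕ-counit : Counit splitsℕ (λ e → ⟦ isZero e ⟧)
splitsℕ-counit zero    W = trans (∑²-splitsℕ-0 _) (ℚ.*-identityˡ _)
splitsℕ-counit (suc e) W = begin
  ∑² (splitsℕ (suc e)) (λ a b → ⟦ isZero a ⟧ ℚ.* W b)
    ≡⟨ ∑²-splitsℕ-suc e _ ⟩
  1ℚ ℚ.* W (suc e) ℚ.+ ∑² (splitsℕ e) (λ a b → 0ℚ ℚ.* W b)
    ≡⟨ cong₂ ℚ._+_ (ℚ.*-identityˡ (W (suc e)))
         (trans (∑²-cong (splitsℕ e) λ a b → ℚ.*-zeroˡ (W b)) (∑-0 (splitsℕ e))) ⟩
  W (suc e) ℚ.+ 0ℚ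
    ≡⟨ ℚ.+-identityʳ _ ⟩
  W (suc e) ∎

-- Cuts the sum after its first `suc r` terms, those with `a ≤ r`. Applied with `suc r` as the
-- divisor, it peels one period off a multiple.
∑²-splitsℕ-+ : ∀ r e (W : ℕ → ℕ → ℚ) → ∑² (splitsℕ (suc r ℕ.+ e)) W ≡
  ∑² (splitsℕ r) (λ a b → W a (b ℕ.+ suc e)) ℚ.+ ∑² (splitsℕ e) (λ a b → W (suc r ℕ.+ a) b)
∑²-splitsℕ-+ zero    e W = trans (∑²-splitsℕ-suc e W)
  (cong (ℚ._+ ∑² (splitsℕ e) (λ a b → W (suc a) b)) (sym (∑²-splitsℕ-0 (λ a b → W a (b ℕ.+ suc e)))))
∑²-splitsℕ-+ (suc r) e W = begin
  ∑² (splitsℕ (suc (suc r) ℕ.+ e)) W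
    ≡⟨ ∑²-splitsℕ-suc (suc r ℕ.+ e) W ⟩
  W 0 (suc (suc r) ℕ.+ e) ℚ.+ ∑² (splitsℕ (suc r ℕ.+ e)) (λ a b → W (suc a) b)
    ≡⟨ cong₂ ℚ._+_ (cong (W 0) (sym (ℕ.+-suc (suc r) e))) (∑²-splitsℕ-+ r e _) ⟩
  W 0 (suc r ℕ.+ suc e) ℚ.+ (∑² (splitsℕ r) (λ a b → W (suc a) (b ℕ.+ suc e)) ℚ.+
    ∑² (splitsℕ e) (λ a b → W (suc (suc r) ℕ.+ a) b))
    ≡⟨ ℚ.+-assoc (W 0 (suc r ℕ.+ suc e)) _ _ ⟨
  W 0 (suc r ℕ.+ suc e) ℚ.+ ∑² (splitsℕ r) (λ a b → W (suc a) (b ℕ.+ suc e)) ℚ.+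
    ∑² (splitsℕ e) (λ a b → W (suc (suc r) ℕ.+ a) b)
    ≡⟨ cong (ℚ._+ ∑² (splitsℕ e) (λ a b → W (suc (suc r) ℕ.+ a) b)) (∑²-splitsℕ-suc r (λ a b → W a (b ℕ.+ suc e))) ⟨
  ∑² (splitsℕ (suc r)) (λ a b → W a (b ℕ.+ suc e)) ℚ.+
    ∑² (splitsℕ e) (λ a b → W (suc (suc r) ℕ.+ a) b) ∎

-- Unlike `∑²-cong`, this makes `a + b ≡ e` available when the summand is rewritten.
∑²-splitsℕ-cong : ∀ e {V W : ℕ → ℕ → ℚ} → (∀ a b → a ℕ.+ b ≡ e → V a b ≡ W a b) →
                  ∑² (splitsℕ e) V ≡ ∑² (splitsℕ e) W
∑²-splitsℕ-cong zero    eq = trans (∑²-splitsℕ-0 _) (trans (eq 0 0 refl) (sym (∑²-splitsℕ-0 _)))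
∑²-splitsℕ-cong (suc e) eq = trans (∑²-splitsℕ-suc e _) (trans
  (cong₂ ℚ._+_ (eq 0 (suc e) refl) (∑²-splitsℕ-cong e λ a b a+b≡e → eq (suc a) b (cong suc a+b≡e)))
  (sym (∑²-splitsℕ-suc e _)))

does-cong : ∀ {P Q : Set} (P? : Dec P) (Q? : Dec Q) → (P → Q) → (Q → P) → does P? ≡ does Q?
does-cong (yes p) Q? f g = sym (dec-true Q? (f p))
does-cong (no ¬p) Q? f g = sym (dec-false Q? (¬p ∘ g))

⟦∣⟧ : ℕ → ℕ → ℚ
⟦∣⟧ r e = ⟦ does (r ∣? e) ⟧

module _ (r-1 : ℕ) where

  private
    r : ℕ
    r = suc r-1

    divides-+ : ∀ e → ⟦∣⟧ r (r ℕ.+ e) ≡ ⟦∣⟧ r e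
    divides-+ e = cong ⟦_⟧ (does-cong (r ∣? (r ℕ.+ e)) (r ∣? e)
      (λ r∣r+e → ∣m+n∣m⇒∣n r∣r+e ∣-refl) (∣m∣n⇒∣m+n ∣-refl))

    divides-0 : ⟦∣⟧ r 0 ≡ 1ℚ
    divides-0 = cong ⟦_⟧ (dec-true (r ∣? 0) (r ∣0))

    divides-< : ∀ {a} → a ℕ.< r → ⟦∣⟧ r a ≡ ⟦ isZero a ⟧
    divides-< {zero}  _   = divides-0
    divides-< {suc a} a<r = cong ⟦_⟧ (dec-false (r ∣? suc a) (λ r∣a → ℕ.<⇒≱ a<r (∣⇒≤ r∣a)))

    +-/ : ∀ e → (r ℕ.+ e) / r ≡ suc (e / r)
    +-/ e = trans (m/n≡1+[m∸n]/n (ℕ.m≤m+n r e)) (cong (λ t → suc (t / r)) (ℕ.m+n∸m≡n r e))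

    -- Among the terms with `a < r` only `a = 0` survives, so divisibility acts there as the counit.
    -- The other terms have `a = r + a′`, where `a′` has the same divisibility and a quotient
    -- smaller by one, and induction on `c` applies.
    multiple : ∀ c W →
      ∑² (splitsℕ (c ℕ.* r)) (λ a b → ⟦∣⟧ r a ℚ.* ⟦∣⟧ r b ℚ.* W (a / r) (b / r)) ≡ ∑² (splitsℕ c) W
    multiple zero    W = begin
      ∑² (splitsℕ 0) (λ a b → ⟦∣⟧ r a ℚ.* ⟦∣⟧ r b ℚ.* W (a / r) (b / r))
        ≡⟨ ∑²-splitsℕ-0 _ ⟩
      ⟦∣⟧ r 0 ℚ.* ⟦∣⟧ r 0 ℚ.* W 0 0
        ≡⟨ cong (λ x → x ℚ.* x ℚ.* W 0 0) divides-0 ⟩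
      1ℚ ℚ.* 1ℚ ℚ.* W 0 0
        ≡⟨ ℚ.*-identityˡ (W 0 0) ⟩
      W 0 0
        ≡⟨ ∑²-splitsℕ-0 W ⟨
      ∑² (splitsℕ 0) W ∎
    multiple (suc c) W = begin
      ∑² (splitsℕ (r ℕ.+ c ℕ.* r)) (λ a b → ⟦∣⟧ r a ℚ.* ⟦∣⟧ r b ℚ.* W (a / r) (b / r))
        ≡⟨ ∑²-splitsℕ-+ r-1 (c ℕ.* r) _ ⟩
      ∑² (splitsℕ r-1) (λ a b → ⟦∣⟧ r a ℚ.* ⟦∣⟧ r (b ℕ.+ suc (c ℕ.* r)) ℚ.* W (a / r) ((b ℕ.+ suc (c ℕ.* r)) / r))
        ℚ.+ ∑² (splitsℕ (c ℕ.* r)) (λ a b → ⟦∣⟧ r (r ℕ.+ a) ℚ.* ⟦∣⟧ r b ℚ.* W ((r ℕ.+ a) / r) (b / r))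
        ≡⟨ cong₂ ℚ._+_
             (trans (∑²-splitsℕ-cong r-1 first) (splitsℕ-counit r-1 G))
             (trans (∑²-cong (splitsℕ (c ℕ.* r)) λ a b → cong₂ (λ x y → x ℚ.* ⟦∣⟧ r b ℚ.* W y (b / r))
                      (divides-+ a) (+-/ a))
                    (multiple c (λ a → W (suc a)))) ⟩
      G r-1 ℚ.+ ∑² (splitsℕ c) (λ a b → W (suc a) b)
        ≡⟨ cong (ℚ._+ _) (trans (cong₂ (λ x y → x ℚ.* W 0 y)
             (trans (cong (⟦∣⟧ r) (ℕ.+-suc r-1 (c ℕ.* r))) (cong ⟦_⟧ (dec-true (r ∣? (suc c ℕ.* r)) (n∣m*n (suc c)))))
             (trans (cong (_/ r) (ℕ.+-suc r-1 (c ℕ.* r))) (m*n/n≡m (suc c) r)))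
             (ℚ.*-identityˡ (W 0 (suc c)))) ⟩
      W 0 (suc c) ℚ.+ ∑² (splitsℕ c) (λ a b → W (suc a) b)
        ≡⟨ ∑²-splitsℕ-suc c W ⟨
      ∑² (splitsℕ (suc c)) W ∎
      where
      G : ℕ → ℚ
      G b = ⟦∣⟧ r (b ℕ.+ suc (c ℕ.* r)) ℚ.* W 0 ((b ℕ.+ suc (c ℕ.* r)) / r)

      first : ∀ a b → a ℕ.+ b ≡ r-1 →
        ⟦∣⟧ r a ℚ.* ⟦∣⟧ r (b ℕ.+ suc (c ℕ.* r)) ℚ.* W (a / r) ((b ℕ.+ suc (c ℕ.* r)) / r) ≡
        ⟦ isZero a ⟧ ℚ.* G b
      first a b a+b≡r-1 = trans
        (cong₂ (λ x y → x ℚ.* ⟦∣⟧ r (b ℕ.+ suc (c ℕ.* r)) ℚ.* W y ((b ℕ.+ suc (c ℕ.* r)) / r))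
          (divides-< a<r) (m<n⇒m/n≡0 a<r))
        (ℚ.*-assoc ⟦ isZero a ⟧ _ _)
        where
        a<r : a ℕ.< r
        a<r = ℕ.s≤s (ℕ.m+n≤o⇒m≤o a (ℕ.≤-reflexive a+b≡r-1))

  -- If `r` does not divide `e = a + b`, it fails to divide `a` or `b`, and every term is zero;
  -- otherwise `multiple` applies.
  splitsℕ-multiplicative : Multiplicative splitsℕ (λ e → does (r ∣? e)) (_/ r)
  splitsℕ-multiplicative e W = go (r ∣? e)
    where
    V : ℕ → ℕ → ℚ
    V a b = ⟦∣⟧ r a ℚ.* ⟦∣⟧ r b ℚ.* W (a / r) (b / r)

    vanish : ∀ a b → ¬ r ∣ a ℕ.+ b → V a b ≡ 0ℚ
    vanish a b r∤ = trans (cong (ℚ._* W (a / r) (b / r)) (begin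
      ⟦∣⟧ r a ℚ.* ⟦∣⟧ r b                     ≡⟨ ⟦∧⟧ (does (r ∣? a)) (does (r ∣? b)) ⟨
      ⟦ does ((r ∣? a) ×-dec (r ∣? b)) ⟧     ≡⟨ cong ⟦_⟧ (dec-false ((r ∣? a) ×-dec (r ∣? b))
                                                  (λ (p , q) → r∤ (∣m∣n⇒∣m+n p q))) ⟩
      0ℚ                                    ∎))
      (ℚ.*-zeroˡ (W (a / r) (b / r)))

    go : Dec (r ∣ e) → ∑² (splitsℕ e) V ≡ ⟦∣⟧ r e ℚ.* ∑² (splitsℕ (e / r)) W
    go (yes (divides c refl)) = begin
      ∑² (splitsℕ (c ℕ.* r)) V
        ≡⟨ multiple c W ⟩
      ∑² (splitsℕ c) W
        ≡⟨ cong (λ c → ∑² (splitsℕ c) W) (m*n/n≡m c r) ⟨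
      ∑² (splitsℕ (c ℕ.* r / r)) W
        ≡⟨ ℚ.*-identityˡ _ ⟨
      1ℚ ℚ.* ∑² (splitsℕ (c ℕ.* r / r)) W
        ≡⟨ cong (λ x → ⟦ x ⟧ ℚ.* ∑² (splitsℕ (c ℕ.* r / r)) W) (dec-true (r ∣? (c ℕ.* r)) (n∣m*n c)) ⟨
      ⟦∣⟧ r (c ℕ.* r) ℚ.* ∑² (splitsℕ (c ℕ.* r / r)) W ∎
    go (no r∤e) = trans
      (trans (∑²-splitsℕ-cong e λ a b a+b≡e → vanish a b (subst (λ t → ¬ r ∣ t) (sym a+b≡e) r∤e))
             (∑-0 (splitsℕ e)))
      (sym (trans (cong (λ x → ⟦ x ⟧ ℚ.* ∑² (splitsℕ (e / r)) W) (dec-false (r ∣? e) r∤e))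
                  (ℚ.*-zeroˡ (∑² (splitsℕ (e / r)) W))))

-- The algebra of series

-- `ℚ./` reduces fractions, so the equation is checked on unnormalised representatives, where it
-- becomes one between integers.
fromℤ-+ : ∀ a b → fromℤ (a ℤ.+ b) ≡ fromℤ a ℚ.+ fromℤ b
fromℤ-+ a b = ℚ.toℚᵘ-injective (ℚᵘ.≃-trans (ℚ.toℚᵘ-fromℚᵘ (ℚᵘ.mkℚᵘ (a ℤ.+ b) 0)) (ℚᵘ.≃-sym
  (ℚᵘ.≃-trans (ℚ.toℚᵘ-homo-+ (fromℤ a) (fromℤ b))
    (ℚᵘ.≃-trans (ℚᵘ.+-cong (ℚ.toℚᵘ-fromℚᵘ (ℚᵘ.mkℚᵘ a 0)) (ℚ.toℚᵘ-fromℚᵘ (ℚᵘ.mkℚᵘ b 0)))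
      (ℚᵘ.*≡* (cong (ℤ._* + 1) (cong₂ ℤ._+_ (ℤ.*-identityʳ a) (ℤ.*-identityʳ b))))))))

fromℤ-* : ∀ a b → fromℤ (a ℤ.* b) ≡ fromℤ a ℚ.* fromℤ b
fromℤ-* a b = ℚ.toℚᵘ-injective (ℚᵘ.≃-trans (ℚ.toℚᵘ-fromℚᵘ (ℚᵘ.mkℚᵘ (a ℤ.* b) 0)) (ℚᵘ.≃-sym
  (ℚᵘ.≃-trans (ℚ.toℚᵘ-homo-* (fromℤ a) (fromℤ b))
    (ℚᵘ.*-cong (ℚ.toℚᵘ-fromℚᵘ (ℚᵘ.mkℚᵘ a 0)) (ℚ.toℚᵘ-fromℚᵘ (ℚᵘ.mkℚᵘ b 0))))))

fromℕ : ℕ → ℚ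
fromℕ k = fromℤ (+ k)

fromℕ-+ : ∀ a b → fromℕ (a ℕ.+ b) ≡ fromℕ a ℚ.+ fromℕ b
fromℕ-+ a b = fromℤ-+ (+ a) (+ b)

fromℕ-* : ∀ a b → fromℕ (a ℕ.* b) ≡ fromℕ a ℚ.* fromℕ b
fromℕ-* a b = trans (cong fromℤ (ℤ.pos-* a b)) (fromℤ-* (+ a) (+ b))

splits-cocommutative : Cocommutative splits
splits-cocommutative =
  splitsList-cocommutative _ (splitsList-cocommutative _ splitsℕ-cocommutative)

splits-coassociative : Coassociative splits
splits-coassociative =
  splitsList-coassociative _ (splitsList-coassociative _ splitsℕ-coassociative)

⟦all⟧-∷ : ∀ {A : Set} (p : A → Bool) x xs → ⟦ all p (x ∷ xs) ⟧ ≡ ⟦ p x ⟧ ℚ.* ⟦ all p xs ⟧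
⟦all⟧-∷ p x xs = ⟦∧⟧ (p x) (all p xs)

isUnit : Monomial → Bool
isUnit = all (all isZero)

splits-counit : Counit splits (λ f → ⟦ isUnit f ⟧)
splits-counit =
  splitsList-counit _ (λ row → ⟦ all isZero row ⟧) _ refl (⟦all⟧-∷ (all isZero))
    (splitsList-counit _ (λ e → ⟦ isZero e ⟧) _ refl (⟦all⟧-∷ isZero) splitsℕ-counit)

⊛-def : ∀ F G f → (F ⊛ G) f ≡ ∑² (splits f) (λ g h → F g ℚ.* G h)
⊛-def F G f = sym (∑-def (splits f) _)

⊛-cong : ∀ {F F′ G G′} → F ≈ F′ → G ≈ G′ → F ⊛ G ≈ F′ ⊛ G′
⊛-cong {F} {F′} {G} {G′} F≈ G≈ f = trans (⊛-def F G f)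
  (trans (∑²-cong (splits f) λ g h → cong₂ ℚ._*_ (F≈ g) (G≈ h)) (sym (⊛-def F′ G′ f)))

⊛-comm : ∀ F G → F ⊛ G ≈ G ⊛ F
⊛-comm F G f = begin
  (F ⊛ G) f                                   ≡⟨ ⊛-def F G f ⟩
  ∑² (splits f) (λ g h → F g ℚ.* G h)         ≡⟨ splits-cocommutative f _ ⟩
  ∑² (splits f) (λ g h → F h ℚ.* G g)         ≡⟨ ∑²-cong (splits f) (λ g h → ℚ.*-comm (F h) (G g)) ⟩
  ∑² (splits f) (λ g h → G g ℚ.* F h)         ≡⟨ ⊛-def G F f ⟨
  (G ⊛ F) f                                   ∎

⊛-assoc : ∀ F G K → (F ⊛ G) ⊛ K ≈ F ⊛ (G ⊛ K)
⊛-assoc F G K f = begin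
  ((F ⊛ G) ⊛ K) f
    ≡⟨ ⊛-def (F ⊛ G) K f ⟩
  ∑² (splits f) (λ g h → (F ⊛ G) g ℚ.* K h)
    ≡⟨ ∑²-cong (splits f) (λ g h →
         trans (cong (ℚ._* K h) (⊛-def F G g)) (∑-* (splits g) _ (K h))) ⟩
  ∑² (splits f) (λ g h → ∑² (splits g) (λ a b → F a ℚ.* G b ℚ.* K h))
    ≡⟨ splits-coassociative f (λ a b h → F a ℚ.* G b ℚ.* K h) ⟩
  ∑² (splits f) (λ g h → ∑² (splits h) (λ a b → F g ℚ.* G a ℚ.* K b))
    ≡⟨ ∑²-cong (splits f) (λ g h → trans
         (∑²-cong (splits h) λ a b → ℚ.*-assoc (F g) (G a) (K b))
         (trans (sym (*-∑ (splits h) (F g) _)) (cong (F g ℚ.*_) (sym (⊛-def G K h))))) ⟩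
  ∑² (splits f) (λ g h → F g ℚ.* (G ⊛ K) h)
    ≡⟨ ⊛-def F (G ⊛ K) f ⟨
  (F ⊛ (G ⊛ K)) f ∎

⊛-∑ : ∀ {A : Set} F (xs : List A) (G : A → Series) →
  F ⊛ (λ g → ∑ xs (λ x → G x g)) ≈ (λ f → ∑ xs (λ x → (F ⊛ G x) f))
⊛-∑ F xs G f = begin
  (F ⊛ (λ g → ∑ xs (λ x → G x g))) f
    ≡⟨ ⊛-def F _ f ⟩
  ∑² (splits f) (λ g h → F g ℚ.* ∑ xs (λ x → G x h))
    ≡⟨ ∑²-cong (splits f) (λ g h → *-∑ xs (F g) _) ⟩
  ∑² (splits f) (λ g h → ∑ xs (λ x → F g ℚ.* G x h))
    ≡⟨ ∑-swap (splits f) xs _ ⟩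
  ∑ xs (λ x → ∑² (splits f) (λ g h → F g ℚ.* G x h))
    ≡⟨ ∑-cong xs (λ x → ⊛-def F (G x) f) ⟨
  ∑ xs (λ x → (F ⊛ G x) f) ∎

⊛-• : ∀ c F G → F ⊛ (c • G) ≈ c • (F ⊛ G)
⊛-• c F G f = begin
  (F ⊛ (c • G)) f                                ≡⟨ ⊛-def F (c • G) f ⟩
  ∑² (splits f) (λ g h → F g ℚ.* (c ℚ.* G h))    ≡⟨ ∑²-cong (splits f) (λ g h → *-swapˡ (F g) c (G h)) ⟩
  ∑² (splits f) (λ g h → c ℚ.* (F g ℚ.* G h))    ≡⟨ *-∑ (splits f) c _ ⟨
  c ℚ.* ∑² (splits f) (λ g h → F g ℚ.* G h)      ≡⟨ cong (c ℚ.*_) (⊛-def F G f) ⟨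
  c ℚ.* (F ⊛ G) f                                ∎

substPower-def : ∀ r-1 F f → substPower (suc r-1) F f ≡
  ⟦ does (All.all? (All.all? (suc r-1 ∣?_)) f) ⟧ ℚ.* F (map (map (_/ suc r-1)) f)
substPower-def r-1 F f = if≡⟦⟧* (does (All.all? (All.all? (suc r-1 ∣?_)) f)) _

substPower-cong : ∀ r-1 {F G} → F ≈ G → substPower (suc r-1) F ≈ substPower (suc r-1) G
substPower-cong r-1 {F} {G} F≈G f = trans (substPower-def r-1 F f)
  (trans (cong (⟦ does (All.all? (All.all? (suc r-1 ∣?_)) f) ⟧ ℚ.*_) (F≈G _))
         (sym (substPower-def r-1 G f)))

-- Multiplicativity for exponents lifts first to rows and then to monomials. It is what carries
-- Newton's identity from `F_d` over to the blocks `F_(d^r)`.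
substPower-⊛ : ∀ r-1 F G →
  substPower (suc r-1) (F ⊛ G) ≈ substPower (suc r-1) F ⊛ substPower (suc r-1) G
substPower-⊛ r-1 F G f = sym (begin
  (substPower r F ⊛ substPower r G) f
    ≡⟨ ⊛-def (substPower r F) (substPower r G) f ⟩
  ∑² (splits f) (λ g h → substPower r F g ℚ.* substPower r G h)
    ≡⟨ ∑²-cong (splits f) (λ g h → trans
         (cong₂ ℚ._*_ (substPower-def r-1 F g) (substPower-def r-1 G h))
         (*-interchange ⟦ δ g ⟧ (F (q g)) ⟦ δ h ⟧ (G (q h)))) ⟩
  ∑² (splits f) (λ g h → ⟦ δ g ⟧ ℚ.* ⟦ δ h ⟧ ℚ.* (F (q g) ℚ.* G (q h)))
    ≡⟨ splits-multiplicative f (λ g h → F g ℚ.* G h) ⟩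
  ⟦ δ f ⟧ ℚ.* ∑² (splits (q f)) (λ g h → F g ℚ.* G h)
    ≡⟨ cong (⟦ δ f ⟧ ℚ.*_) (⊛-def F G (q f)) ⟨
  ⟦ δ f ⟧ ℚ.* (F ⊛ G) (q f)
    ≡⟨ substPower-def r-1 (F ⊛ G) f ⟨
  substPower r (F ⊛ G) f ∎)
  where
  r : ℕ
  r = suc r-1

  δ : Monomial → Bool
  δ f = does (All.all? (All.all? (r ∣?_)) f)

  q : Monomial → Monomial
  q = map (map (_/ r))

  splits-multiplicative : Multiplicative splits δ q
  splits-multiplicative =
    splitsList-multiplicative _ (λ row → does (All.all? (r ∣?_) row)) δ (map (_/ r)) refl (λ _ _ → refl)
      (splitsList-multiplicative _ (λ e → does (r ∣? e)) (λ row → does (All.all? (r ∣?_) row)) (_/ r) refl (λ _ _ → refl)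
        (splitsℕ-multiplicative r-1))

substPower-∑ : ∀ {A : Set} r-1 (xs : List A) (F : A → Series) →
  substPower (suc r-1) (λ f → ∑ xs (λ x → F x f)) ≈ (λ f → ∑ xs (λ x → substPower (suc r-1) (F x) f))
substPower-∑ r-1 xs F f = trans (substPower-def r-1 (λ f → ∑ xs (λ x → F x f)) f)
  (trans (*-∑ xs ⟦ does (All.all? (All.all? (suc r-1 ∣?_)) f) ⟧ _) (sym (∑-cong xs λ x → substPower-def r-1 (F x) f)))

substPower-• : ∀ r-1 c F → substPower (suc r-1) (c • F) ≈ c • substPower (suc r-1) F
substPower-• r-1 c F f = trans (substPower-def r-1 (c • F) f)
  (trans (*-swapˡ ⟦ does (All.all? (All.all? (suc r-1 ∣?_)) f) ⟧ c _)
         (cong (c ℚ.*_) (sym (substPower-def r-1 F f))))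

-- Newton's identities

-- Zero exponents are kept: a variable of a product may be absent from one factor, so the filtered
-- lists `powers` do not decompose entry by entry.
splitPower : Split Power
splitPower (i , j , e) = map (λ (a , b) → (i , j , a) , (i , j , b)) (splitsℕ e)

splitPowers : Split (List Power)
splitPowers = splitsList splitPower

∑²-splitPower : ∀ i j e (W : Power → Power → ℚ) →
  ∑² (splitPower (i , j , e)) W ≡ ∑² (splitsℕ e) (λ a b → W (i , j , a) (i , j , b))
∑²-splitPower i j e W = ∑-map _ (splitsℕ e) _

∑²-splitsList-++ : ∀ {A : Set} (s : Split A) xs ys (W : List A → List A → ℚ) →
  ∑² (splitsList s (xs ++ ys)) W ≡
  ∑² (splitsList s xs) (λ as bs → ∑² (splitsList s ys) (λ cs ds → W (as ++ cs) (bs ++ ds)))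
∑²-splitsList-++ s []       ys W = sym (∑-singleton _ _)
∑²-splitsList-++ s (x ∷ xs) ys W = trans (∑²-splitsList s x (xs ++ ys) W) (trans
  (∑²-cong (s x) λ a b → ∑²-splitsList-++ s xs ys (λ as bs → W (a ∷ as) (b ∷ bs)))
  (sym (∑²-splitsList s x xs _)))

∑²-splits-row : ∀ i j es (W : List Power → List Power → ℚ) →
  ∑² (splitsList splitsℕ es) (λ as bs → W (rowPowers i j as) (rowPowers i j bs)) ≡
  ∑² (splitPowers (rowPowers i j es)) W
∑²-splits-row i j []       W = trans (∑-singleton _ _) (sym (∑-singleton _ _))
∑²-splits-row i j (e ∷ es) W = begin
  ∑² (splitsList splitsℕ (e ∷ es)) (λ as bs → W (rowPowers i j as) (rowPowers i j bs))
    ≡⟨ ∑²-splitsList splitsℕ e es _ ⟩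
  ∑² (splitsℕ e) (λ a b → ∑² (splitsList splitsℕ es) (λ as bs →
    W ((i , j , a) ∷ rowPowers i (suc j) as) ((i , j , b) ∷ rowPowers i (suc j) bs)))
    ≡⟨ ∑²-cong (splitsℕ e) (λ a b →
         ∑²-splits-row i (suc j) es (λ as bs → W ((i , j , a) ∷ as) ((i , j , b) ∷ bs))) ⟩
  ∑² (splitsℕ e) (λ a b → ∑² (splitPowers (rowPowers i (suc j) es)) (λ as bs →
    W ((i , j , a) ∷ as) ((i , j , b) ∷ bs)))
    ≡⟨ ∑²-splitPower i j e (λ x y → ∑² (splitPowers (rowPowers i (suc j) es)) (λ as bs → W (x ∷ as) (y ∷ bs))) ⟨
  ∑² (splitPower (i , j , e)) (λ x y → ∑² (splitPowers (rowPowers i (suc j) es)) (λ as bs → W (x ∷ as) (y ∷ bs)))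
    ≡⟨ ∑²-splitsList splitPower (i , j , e) (rowPowers i (suc j) es) W ⟨
  ∑² (splitPowers (rowPowers i j (e ∷ es))) W ∎

∑²-splits : ∀ i f (W : List Power → List Power → ℚ) →
  ∑² (splits f) (λ g h → W (powersFrom i g) (powersFrom i h)) ≡ ∑² (splitPowers (powersFrom i f)) W
∑²-splits i []        W = trans (∑-singleton _ _) (sym (∑-singleton _ _))
∑²-splits i (row ∷ f) W = begin
  ∑² (splits (row ∷ f)) (λ g h → W (powersFrom i g) (powersFrom i h))
    ≡⟨ ∑²-splitsList (splitsList splitsℕ) row f _ ⟩
  ∑² (splitsList splitsℕ row) (λ as bs → ∑² (splits f) (λ g h →
    W (rowPowers i 1 as ++ powersFrom (suc i) g) (rowPowers i 1 bs ++ powersFrom (suc i) h)))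
    ≡⟨ ∑²-cong (splitsList splitsℕ row) (λ as bs →
         ∑²-splits (suc i) f (λ g h → W (rowPowers i 1 as ++ g) (rowPowers i 1 bs ++ h))) ⟩
  ∑² (splitsList splitsℕ row) (λ as bs → ∑² (splitPowers (powersFrom (suc i) f)) (λ g h →
    W (rowPowers i 1 as ++ g) (rowPowers i 1 bs ++ h)))
    ≡⟨ ∑²-splits-row i 1 row (λ as bs → ∑² (splitPowers (powersFrom (suc i) f)) (λ g h → W (as ++ g) (bs ++ h))) ⟩
  ∑² (splitPowers (rowPowers i 1 row)) (λ as bs → ∑² (splitPowers (powersFrom (suc i) f)) (λ g h →
    W (as ++ g) (bs ++ h)))
    ≡⟨ ∑²-splitsList-++ splitPower (rowPowers i 1 row) (powersFrom (suc i) f) W ⟨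
  ∑² (splitPowers (powersFrom i (row ∷ f))) W ∎

nonzeroPowers : List Power → List Power
nonzeroPowers = filter (ℕ.nonZero? ∘ exponent)

totalDegree : List Power → ℕ
totalDegree ps = sum (map powerDegree ps)

totalDegree-nonzero : ∀ ps → totalDegree (nonzeroPowers ps) ≡ totalDegree ps
totalDegree-nonzero []                    = refl
totalDegree-nonzero ((i , j , zero)  ∷ ps) =
  trans (totalDegree-nonzero ps) (cong (ℕ._+ totalDegree ps) (sym (ℕ.*-zeroʳ i)))
totalDegree-nonzero ((i , j , suc e) ∷ ps) = cong (i ℕ.* suc e ℕ.+_) (totalDegree-nonzero ps)

degree≡ : ∀ f → degree f ≡ totalDegree (powersFrom 1 f)
degree≡ f = totalDegree-nonzero (powersFrom 1 f)

splitPowers-additive : Additive splitPowers totalDegree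
splitPowers-additive = splitsList-additive splitPower powerDegree totalDegree refl (λ _ _ → refl) step
  where
  step : Additive splitPower powerDegree
  step (i , j , e) W = begin
    ∑² (splitPower (i , j , e)) (λ x y → W (powerDegree x ℕ.+ powerDegree y) x y)
      ≡⟨ ∑²-splitPower i j e _ ⟩
    ∑² (splitsℕ e) (λ a b → W (i ℕ.* a ℕ.+ i ℕ.* b) (i , j , a) (i , j , b))
      ≡⟨ ∑²-splitsℕ-cong e (λ a b a+b≡e → cong (λ k → W k (i , j , a) (i , j , b))
           (trans (sym (ℕ.*-distribˡ-+ i a b)) (cong (i ℕ.*_) a+b≡e))) ⟩
    ∑² (splitsℕ e) (λ a b → W (i ℕ.* e) (i , j , a) (i , j , b))
      ≡⟨ ∑²-splitPower i j e _ ⟨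
    ∑² (splitPower (i , j , e)) (W (i ℕ.* e)) ∎

allZero : List Power → Bool
allZero = all (isZero ∘ exponent)

splitPowers-counit : Counit splitPowers (⟦_⟧ ∘ allZero)
splitPowers-counit = splitsList-counit splitPower (⟦_⟧ ∘ isZero ∘ exponent) (⟦_⟧ ∘ allZero) refl
  (⟦all⟧-∷ (isZero ∘ exponent))
  λ (i , j , e) W → trans (∑²-splitPower i j e _) (splitsℕ-counit e (λ b → W (i , j , b)))

-- The coefficient of a monomial in the sum of all P_d, d ≥ 1.
primitivePart : List Power → ℚ
primitivePart ((k , j , e) ∷ []) = fromℕ k
primitivePart _                  = 0ℚ

-- Separates the grading from the coefficient, so that Newton's identity can be proved first without
-- degrees.
pCoefficient≡ : ∀ d ps → pCoefficient d ps ≡ ⟦ does (totalDegree ps ℕ.≟ d) ⟧ ℚ.* primitivePart ps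
pCoefficient≡ d []                   = sym (ℚ.*-zeroʳ ⟦ does (0 ℕ.≟ d) ⟧)
pCoefficient≡ d ((k , j , e) ∷ [])   =
  trans (if≡⟦⟧* (does (k ℕ.* e ℕ.≟ d)) (fromℕ k))
        (cong (λ t → ⟦ does (t ℕ.≟ d) ⟧ ℚ.* fromℕ k) (sym (ℕ.+-identityʳ (k ℕ.* e))))
pCoefficient≡ d (x ∷ y ∷ ps)         = sym (ℚ.*-zeroʳ ⟦ does (totalDegree (x ∷ y ∷ ps) ℕ.≟ d) ⟧)

primitive′ : List Power → ℚ
primitive′ ps = primitivePart (nonzeroPowers ps)

-- A product of two factors without common variables is a power of one variable exactly if one
-- factor is such a power and the other is 1.
primitive-∷ : ∀ i j a ps → primitive′ ((i , j , a) ∷ ps) ≡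
  ⟦ isZero a ⟧ ℚ.* primitive′ ps ℚ.+ ⟦ not (isZero a) ⟧ ℚ.* fromℕ i ℚ.* ⟦ allZero ps ⟧
primitive-∷ i j zero    ps = solve 3 (λ x y z → x := con 1ℚ :* x :+ con 0ℚ :* y :* z) refl
  (primitive′ ps) (fromℕ i) ⟦ allZero ps ⟧
primitive-∷ i j (suc a) ps = trans (lemma ps)
  (solve 3 (λ x y z → y :* z := con 0ℚ :* x :+ con 1ℚ :* y :* z) refl
    (primitive′ ps) (fromℕ i) ⟦ allZero ps ⟧)
  where
  lemma : ∀ ps → primitivePart ((i , j , suc a) ∷ nonzeroPowers ps) ≡ fromℕ i ℚ.* ⟦ allZero ps ⟧
  lemma []                      = sym (ℚ.*-identityʳ (fromℕ i))
  lemma ((_ , _ , zero)  ∷ ps)  = lemma ps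
  lemma ((_ , _ , suc _) ∷ ps)  = sym (ℚ.*-zeroʳ (fromℕ i))

weightedProduct : (ℕ → ℚ) → List Power → ℚ
weightedProduct μ ps = foldr (λ x y → μ (exponent x) ℚ.* y) 1ℚ ps

-- Newton's identity without the grading, for the series whose
-- coefficients are products of factors μ(exponent).  The hypothesis is
-- the case of a single indeterminate of degree 1.
module Newton (c : ℚ) (μ : ℕ → ℚ)
  (newton₁ : ∀ e → c ℚ.* ∑² (splitsℕ e) (λ a b → ⟦ not (isZero a) ⟧ ℚ.* μ b) ≡ fromℕ e ℚ.* μ e)
  where

  m : List Power → ℚ
  m = weightedProduct μ

  -- The series with coefficients `m` is a product over the variables, so its logarithmic
  -- derivative, for the Euler operator multiplying by the degree, is a sum over them. Accordingly
  -- the only variable of `u` is either the head, where `newton₁` applies, or in the tail, where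
  -- induction applies.
  newton-ungraded : ∀ ps → c ℚ.* ∑² (splitPowers ps) (λ u v → primitive′ u ℚ.* m v) ≡
                           fromℕ (totalDegree ps) ℚ.* m ps
  newton-ungraded []                 = trans (cong (c ℚ.*_) (∑-singleton _ _)) (ℚ.*-zeroʳ c)
  newton-ungraded ((i , j , e) ∷ ps) = begin
    c ℚ.* ∑² (splitPowers ((i , j , e) ∷ ps)) (λ u v → primitive′ u ℚ.* m v)
      ≡⟨ cong (c ℚ.*_) (trans (∑²-splitsList splitPower (i , j , e) ps _) (∑²-splitPower i j e _)) ⟩
    c ℚ.* ∑² (splitsℕ e) (λ a b → ∑² (splitPowers ps) (λ u v →
      primitive′ ((i , j , a) ∷ u) ℚ.* (μ b ℚ.* m v)))
      ≡⟨ cong (c ℚ.*_) (∑²-cong (splitsℕ e) inner) ⟩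
    c ℚ.* ∑² (splitsℕ e) (λ a b → ⟦ isZero a ⟧ ℚ.* (μ b ℚ.* N) ℚ.+
      ⟦ not (isZero a) ⟧ ℚ.* μ b ℚ.* (fromℕ i ℚ.* m ps))
      ≡⟨ cong (c ℚ.*_) (trans (∑-+ (splitsℕ e) _ _) (cong₂ ℚ._+_
           (splitsℕ-counit e (λ b → μ b ℚ.* N)) (sym (∑-* (splitsℕ e) _ (fromℕ i ℚ.* m ps))))) ⟩
    c ℚ.* (μ e ℚ.* N ℚ.+ M ℚ.* (fromℕ i ℚ.* m ps))
      ≡⟨ solve 6 (λ c μe N M i mps → c :* (μe :* N :+ M :* (i :* mps)) :=
           μe :* (c :* N) :+ i :* mps :* (c :* M)) refl c (μ e) N M (fromℕ i) (m ps) ⟩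
    μ e ℚ.* (c ℚ.* N) ℚ.+ fromℕ i ℚ.* m ps ℚ.* (c ℚ.* M)
      ≡⟨ cong₂ (λ x y → μ e ℚ.* x ℚ.+ fromℕ i ℚ.* m ps ℚ.* y) (newton-ungraded ps) (newton₁ e) ⟩
    μ e ℚ.* (fromℕ (totalDegree ps) ℚ.* m ps) ℚ.+ fromℕ i ℚ.* m ps ℚ.* (fromℕ e ℚ.* μ e)
      ≡⟨ solve 5 (λ μe D mps i e → μe :* (D :* mps) :+ i :* mps :* (e :* μe) :=
           (i :* e :+ D) :* (μe :* mps)) refl (μ e) (fromℕ (totalDegree ps)) (m ps) (fromℕ i) (fromℕ e) ⟩
    (fromℕ i ℚ.* fromℕ e ℚ.+ fromℕ (totalDegree ps)) ℚ.* (μ e ℚ.* m ps)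
      ≡⟨ cong (ℚ._* (μ e ℚ.* m ps)) (trans (fromℕ-+ (i ℕ.* e) (totalDegree ps))
           (cong (ℚ._+ fromℕ (totalDegree ps)) (fromℕ-* i e))) ⟨
    fromℕ (totalDegree ((i , j , e) ∷ ps)) ℚ.* m ((i , j , e) ∷ ps) ∎
    where
    N : ℚ
    N = ∑² (splitPowers ps) (λ u v → primitive′ u ℚ.* m v)

    M : ℚ
    M = ∑² (splitsℕ e) (λ a b → ⟦ not (isZero a) ⟧ ℚ.* μ b)

    inner : ∀ a b → ∑² (splitPowers ps) (λ u v → primitive′ ((i , j , a) ∷ u) ℚ.* (μ b ℚ.* m v)) ≡
      ⟦ isZero a ⟧ ℚ.* (μ b ℚ.* N) ℚ.+ ⟦ not (isZero a) ⟧ ℚ.* μ b ℚ.* (fromℕ i ℚ.* m ps)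
    inner a b = begin
      ∑² (splitPowers ps) (λ u v → primitive′ ((i , j , a) ∷ u) ℚ.* (μ b ℚ.* m v))
        ≡⟨ ∑²-cong (splitPowers ps) (λ u v → trans (cong (ℚ._* (μ b ℚ.* m v)) (primitive-∷ i j a u))
             (solve 7 (λ za pu na i zu μb mv → (za :* pu :+ na :* i :* zu) :* (μb :* mv) :=
                za :* μb :* (pu :* mv) :+ na :* μb :* i :* (zu :* mv)) refl
                ⟦ isZero a ⟧ (primitive′ u) ⟦ not (isZero a) ⟧ (fromℕ i) ⟦ allZero u ⟧ (μ b) (m v))) ⟩
      ∑² (splitPowers ps) (λ u v → ⟦ isZero a ⟧ ℚ.* μ b ℚ.* (primitive′ u ℚ.* m v) ℚ.+
        ⟦ not (isZero a) ⟧ ℚ.* μ b ℚ.* fromℕ i ℚ.* (⟦ allZero u ⟧ ℚ.* m v))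
        ≡⟨ trans (∑-+ (splitPowers ps) _ _) (cong₂ ℚ._+_
             (sym (*-∑ (splitPowers ps) (⟦ isZero a ⟧ ℚ.* μ b) _))
             (trans (sym (*-∑ (splitPowers ps) (⟦ not (isZero a) ⟧ ℚ.* μ b ℚ.* fromℕ i) _))
                    (cong (⟦ not (isZero a) ⟧ ℚ.* μ b ℚ.* fromℕ i ℚ.*_) (splitPowers-counit ps m)))) ⟩
      ⟦ isZero a ⟧ ℚ.* μ b ℚ.* N ℚ.+ ⟦ not (isZero a) ⟧ ℚ.* μ b ℚ.* fromℕ i ℚ.* m ps
        ≡⟨ cong₂ ℚ._+_ (ℚ.*-assoc ⟦ isZero a ⟧ (μ b) N)
             (ℚ.*-assoc (⟦ not (isZero a) ⟧ ℚ.* μ b) (fromℕ i) (m ps)) ⟩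
      ⟦ isZero a ⟧ ℚ.* (μ b ℚ.* N) ℚ.+ ⟦ not (isZero a) ⟧ ℚ.* μ b ℚ.* (fromℕ i ℚ.* m ps) ∎

-- At most the pair `(k , l) = (a , b)` contributes. This collects the graded pieces of the two
-- factors into the piece of degree `d` of the product.
∑²-splitsℕ-δ : ∀ d a b →
  ∑² (splitsℕ d) (λ k l → ⟦ does (a ℕ.≟ k) ⟧ ℚ.* ⟦ does (b ℕ.≟ l) ⟧) ≡ ⟦ does (a ℕ.+ b ℕ.≟ d) ⟧
∑²-splitsℕ-δ d zero    b = trans
  (∑²-cong (splitsℕ d) λ { zero l → refl ; (suc k) l → refl })
  (splitsℕ-counit d (λ l → ⟦ does (b ℕ.≟ l) ⟧))
∑²-splitsℕ-δ zero    (suc a) b = trans (∑²-splitsℕ-0 _) (ℚ.*-zeroˡ ⟦ does (b ℕ.≟ 0) ⟧)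
∑²-splitsℕ-δ (suc d) (suc a) b = trans (∑²-splitsℕ-suc d _)
  (trans (cong (ℚ._+ rest) (ℚ.*-zeroˡ ⟦ does (b ℕ.≟ suc d) ⟧))
    (trans (ℚ.+-identityˡ rest) (∑²-splitsℕ-δ d a b)))
  where
  rest : ℚ
  rest = ∑² (splitsℕ d) (λ k l → ⟦ does (suc a ℕ.≟ suc k) ⟧ ℚ.* ⟦ does (b ℕ.≟ l) ⟧)

PositiveIndex : Power → Set
PositiveIndex (i , _ , _) = NonZero i

powersFrom-positive : ∀ i f → All PositiveIndex (powersFrom (suc i) f)
powersFrom-positive i []        = []
powersFrom-positive i (row ∷ f) = All.++⁺ (positive 1 row) (powersFrom-positive (suc i) f)
  where
  positive : ∀ j es → All PositiveIndex (rowPowers (suc i) j es)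
  positive j []       = []
  positive j (e ∷ es) = _ ∷ positive (suc j) es

-- With positive indices every variable has positive degree, so degree 0 forces all exponents to
-- vanish.
totalDegree-zero : ∀ {ps} → All PositiveIndex ps → does (totalDegree ps ℕ.≟ 0) ≡ allZero ps
totalDegree-zero []                                  = refl
totalDegree-zero {(suc i , _ , zero)  ∷ ps} (_ ∷ nz) rewrite ℕ.*-zeroʳ i = totalDegree-zero nz
totalDegree-zero {(suc i , _ , suc e) ∷ ps} (_ ∷ nz) = refl

all-++ : ∀ {A : Set} (p : A → Bool) xs ys → all p (xs ++ ys) ≡ all p xs ∧ all p ys
all-++ p []       ys = refl
all-++ p (x ∷ xs) ys = trans (cong (p x ∧_) (all-++ p xs ys)) (sym (Bool.∧-assoc (p x) _ _))

allZero-powersFrom : ∀ i f → allZero (powersFrom i f) ≡ isUnit f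
allZero-powersFrom i []        = refl
allZero-powersFrom i (row ∷ f) = trans (all-++ _ (rowPowers i 1 row) _)
  (cong₂ _∧_ (allZero-row 1 row) (allZero-powersFrom (suc i) f))
  where
  allZero-row : ∀ j es → allZero (rowPowers i j es) ≡ all isZero es
  allZero-row j []       = refl
  allZero-row j (e ∷ es) = cong (isZero e ∧_) (allZero-row (suc j) es)

degree-zero : ∀ f → does (degree f ℕ.≟ 0) ≡ allZero (powersFrom 1 f)
degree-zero f = trans (cong (λ d → does (d ℕ.≟ 0)) (degree≡ f)) (totalDegree-zero (powersFrom-positive 0 f))

𝟙≡isUnit : ∀ f → 𝟙 f ≡ ⟦ isUnit f ⟧
𝟙≡isUnit f = cong ⟦_⟧ (trans (degree-zero f) (allZero-powersFrom 1 f))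

⊛-identityˡ : ∀ F → 𝟙 ⊛ F ≈ F
⊛-identityˡ F f = begin
  (𝟙 ⊛ F) f                                         ≡⟨ ⊛-def 𝟙 F f ⟩
  ∑² (splits f) (λ g h → 𝟙 g ℚ.* F h)               ≡⟨ ∑²-cong (splits f) (λ g h → cong (ℚ._* F h) (𝟙≡isUnit g)) ⟩
  ∑² (splits f) (λ g h → ⟦ isUnit g ⟧ ℚ.* F h)      ≡⟨ splits-counit f F ⟩
  F f                                               ∎

-- A multiple of `r` with quotient 0 is 0, so the only monomial with coefficient 1 remains the empty
-- one.
substPower-𝟙 : ∀ r-1 → substPower (suc r-1) 𝟙 ≈ 𝟙
substPower-𝟙 r-1 f = begin
  substPower r 𝟙 f                            ≡⟨ substPower-def r-1 𝟙 f ⟩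
  ⟦ δ* f ⟧ ℚ.* 𝟙 (map (map (_/ r)) f)         ≡⟨ cong (⟦ δ* f ⟧ ℚ.*_) (𝟙≡isUnit (map (map (_/ r)) f)) ⟩
  ⟦ δ* f ⟧ ℚ.* ⟦ isUnit (map (map (_/ r)) f) ⟧   ≡⟨ ⟦∧⟧ (δ* f) _ ⟨
  ⟦ δ* f ∧ isUnit (map (map (_/ r)) f) ⟧      ≡⟨ cong ⟦_⟧ (lift (All.all? (r ∣?_)) (map (_/ r)) (lift (r ∣?_) (_/ r) entry) f) ⟩
  ⟦ isUnit f ⟧                                ≡⟨ 𝟙≡isUnit f ⟨
  𝟙 f                                         ∎
  where
  r : ℕ
  r = suc r-1

  δ* : Monomial → Bool
  δ* f = does (All.all? (All.all? (r ∣?_)) f)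

  entry : ∀ e → does (r ∣? e) ∧ isZero (e / r) ≡ isZero e
  entry zero    = cong (_∧ true) (dec-true (r ∣? 0) (r ∣0))
  entry (suc e) = go (r ∣? suc e)
    where
    positive : ∀ k → k ℕ.* r ≡ suc e → isZero k ≡ false
    positive (suc _) _ = refl

    go : Dec (r ∣ suc e) → does (r ∣? suc e) ∧ isZero (suc e / r) ≡ false
    go (yes r∣e) = trans (cong (does (r ∣? suc e) ∧_) (positive (suc e / r) (m/n*n≡m r∣e))) (Bool.∧-zeroʳ _)
    go (no  r∤e) = cong (_∧ isZero (suc e / r)) (dec-false (r ∣? suc e) r∤e)

  lift : ∀ {A : Set} {P : A → Set} (P? : ∀ x → Dec (P x)) (q : A → A) {p : A → Bool} →
         (∀ x → does (P? x) ∧ p (q x) ≡ p x) →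
         ∀ xs → does (All.all? P? xs) ∧ all p (map q xs) ≡ all p xs
  lift P? q {p} eq []       = refl
  lift P? q {p} eq (x ∷ xs) = trans
    (∧-interchange (does (P? x)) (does (All.all? P? xs)) (p (q x)) (all p (map q xs)))
    (cong₂ _∧_ (eq x) (lift P? q eq xs))

-- A power with positive index and positive exponent has positive degree. This removes the term
-- `k = 0` from the recursions below, where a sum over `splitsℕ d` includes it.
pSeries-0 : ∀ f → pSeries 0 f ≡ 0ℚ
pSeries-0 f = vanish (All.filter⁺ (ℕ.nonZero? ∘ exponent) (powersFrom-positive 0 f))
                     (All.all-filter (ℕ.nonZero? ∘ exponent) (powersFrom 1 f))
  where
  vanish : ∀ {ps} → All PositiveIndex ps → All (NonZero ∘ exponent) ps → pCoefficient 0 ps ≡ 0ℚ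
  vanish {[]}                        _ _ = refl
  vanish {(suc _ , _ , suc _) ∷ []}  _ _ = refl
  vanish {(zero , _) ∷ []} (() ∷ _) _
  vanish {(suc _ , _ , zero) ∷ []} _ (() ∷ _)
  vanish {_ ∷ _ ∷ _}                 _ _ = refl

substPower-pSeries-0 : ∀ r-1 f → substPower (suc r-1) (pSeries 0) f ≡ 0ℚ
substPower-pSeries-0 r-1 f = trans (substPower-def r-1 (pSeries 0) f)
  (trans (cong (⟦ does (All.all? (All.all? (suc r-1 ∣?_)) f) ⟧ ℚ.*_) (pSeries-0 (map (map (_/ suc r-1)) f)))
         (ℚ.*-zeroʳ ⟦ does (All.all? (All.all? (suc r-1 ∣?_)) f) ⟧))

-- `F d` is the homogeneous part of degree `d` of the series with coefficients `weightedProduct μ`;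
-- the logarithmic derivative of that series is `c` times the sum of all power sums.
module GradedNewton (c : ℚ) (μ : ℕ → ℚ)
  (newton₁ : ∀ e → c ℚ.* ∑² (splitsℕ e) (λ a b → ⟦ not (isZero a) ⟧ ℚ.* μ b) ≡ fromℕ e ℚ.* μ e)
  (μ0 : μ 0 ≡ 1ℚ) (F : ℕ → Series)
  (F≈ : ∀ d f → F d f ≡ ⟦ does (degree f ℕ.≟ d) ⟧ ℚ.* weightedProduct μ (powersFrom 1 f))
  where
  open Newton c μ newton₁

  -- The ungraded identity cut down to degree `d`: the degree indicators of the two factors combine
  -- by `∑²-splitsℕ-δ`, and where they are nonzero the factor `totalDegree ps` equals `d`.
  newton : ∀ d f → ∑² (splitsℕ d) (λ k l → ((c • pSeries k) ⊛ F l) f) ≡ fromℕ d ℚ.* F d f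
  newton d f = begin
    ∑² (splitsℕ d) (λ k l → ((c • pSeries k) ⊛ F l) f)
      ≡⟨ ∑²-cong (splitsℕ d) (λ k l → trans (⊛-def (c • pSeries k) (F l) f)
           (trans (∑²-cong (splits f) (coefficient k l))
                  (∑²-splits 1 f (λ u v → δ u k ℚ.* δ v l ℚ.* term u v)))) ⟩
    ∑² (splitsℕ d) (λ k l → ∑² (splitPowers ps) (λ u v → δ u k ℚ.* δ v l ℚ.* term u v))
      ≡⟨ ∑-swap (splitsℕ d) (splitPowers ps) _ ⟩
    ∑² (splitPowers ps) (λ u v → ∑² (splitsℕ d) (λ k l → δ u k ℚ.* δ v l ℚ.* term u v))
      ≡⟨ ∑²-cong (splitPowers ps) (λ u v → trans (sym (∑-* (splitsℕ d) _ (term u v)))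
           (cong (ℚ._* term u v) (∑²-splitsℕ-δ d (totalDegree u) (totalDegree v)))) ⟩
    ∑² (splitPowers ps) (λ u v → ⟦ does (totalDegree u ℕ.+ totalDegree v ℕ.≟ d) ⟧ ℚ.* term u v)
      ≡⟨ splitPowers-additive ps (λ k u v → ⟦ does (k ℕ.≟ d) ⟧ ℚ.* term u v) ⟩
    ∑² (splitPowers ps) (λ u v → δ ps d ℚ.* term u v)
      ≡⟨ *-∑ (splitPowers ps) (δ ps d) _ ⟨
    δ ps d ℚ.* ∑² (splitPowers ps) term
      ≡⟨ cong (δ ps d ℚ.*_) (trans (sym (*-∑ (splitPowers ps) c _)) (newton-ungraded ps)) ⟩
    δ ps d ℚ.* (fromℕ (totalDegree ps) ℚ.* m ps)
      ≡⟨ δ-degree (totalDegree ps ℕ.≟ d) ⟩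
    fromℕ d ℚ.* (δ ps d ℚ.* m ps)
      ≡⟨ cong (λ t → fromℕ d ℚ.* (⟦ does (t ℕ.≟ d) ⟧ ℚ.* m ps)) (degree≡ f) ⟨
    fromℕ d ℚ.* (⟦ does (degree f ℕ.≟ d) ⟧ ℚ.* m ps)
      ≡⟨ cong (fromℕ d ℚ.*_) (F≈ d f) ⟨
    fromℕ d ℚ.* F d f ∎
    where
    ps : List Power
    ps = powersFrom 1 f

    δ : List Power → ℕ → ℚ
    δ u k = ⟦ does (totalDegree u ℕ.≟ k) ⟧

    term : List Power → List Power → ℚ
    term u v = c ℚ.* (primitive′ u ℚ.* m v)

    coefficient : ∀ k l g h → c ℚ.* pSeries k g ℚ.* F l h ≡
      δ (powersFrom 1 g) k ℚ.* δ (powersFrom 1 h) l ℚ.* term (powersFrom 1 g) (powersFrom 1 h)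
    coefficient k l g h = trans
      (cong₂ (λ x y → c ℚ.* x ℚ.* y)
        (trans (pCoefficient≡ k (powers g))
          (cong (λ t → ⟦ does (t ℕ.≟ k) ⟧ ℚ.* primitivePart (powers g)) (degree≡ g)))
        (trans (F≈ l h)
          (cong (λ t → ⟦ does (t ℕ.≟ l) ⟧ ℚ.* m (powersFrom 1 h)) (degree≡ h))))
      (solve 5 (λ c x p y m → c :* (x :* p) :* (y :* m) := x :* y :* (c :* (p :* m))) refl
        c (δ (powersFrom 1 g) k) (primitive′ (powersFrom 1 g)) (δ (powersFrom 1 h) l) (m (powersFrom 1 h)))

    δ-degree : Dec (totalDegree ps ≡ d) →
      δ ps d ℚ.* (fromℕ (totalDegree ps) ℚ.* m ps) ≡ fromℕ d ℚ.* (δ ps d ℚ.* m ps)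
    δ-degree (yes refl) = *-swapˡ (δ ps d) (fromℕ d) (m ps)
    δ-degree (no  D≢d)  = begin
      δ ps d ℚ.* (fromℕ (totalDegree ps) ℚ.* m ps)  ≡⟨ cong (ℚ._* (fromℕ (totalDegree ps) ℚ.* m ps)) δ≡0 ⟩
      0ℚ ℚ.* (fromℕ (totalDegree ps) ℚ.* m ps)      ≡⟨ solve 3 (λ x y z → con 0ℚ :* (x :* y) := z :* (con 0ℚ :* y)) refl
                                                       (fromℕ (totalDegree ps)) (m ps) (fromℕ d) ⟩
      fromℕ d ℚ.* (0ℚ ℚ.* m ps)                     ≡⟨ cong (λ x → fromℕ d ℚ.* (x ℚ.* m ps)) δ≡0 ⟨
      fromℕ d ℚ.* (δ ps d ℚ.* m ps)                 ∎
      where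
      δ≡0 : δ ps d ≡ 0ℚ
      δ≡0 = cong ⟦_⟧ (dec-false (totalDegree ps ℕ.≟ d) D≢d)

  F-0 : F 0 ≈ 𝟙
  F-0 f = begin
    F 0 f                                                ≡⟨ F≈ 0 f ⟩
    𝟙 f ℚ.* m ps                                         ≡⟨ cong (λ b → ⟦ b ⟧ ℚ.* m ps) (degree-zero f) ⟩
    ⟦ allZero ps ⟧ ℚ.* m ps                              ≡⟨ absorb ps ⟩
    ⟦ allZero ps ⟧                                       ≡⟨ cong ⟦_⟧ (degree-zero f) ⟨
    𝟙 f                                                  ∎
    where
    ps : List Power
    ps = powersFrom 1 f

    absorb : ∀ ps → ⟦ allZero ps ⟧ ℚ.* m ps ≡ ⟦ allZero ps ⟧
    absorb []                    = refl
    absorb ((_ , _ , zero)  ∷ ps) = trans (cong (λ x → ⟦ allZero ps ⟧ ℚ.* (x ℚ.* m ps)) μ0)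
      (trans (cong (⟦ allZero ps ⟧ ℚ.*_) (ℚ.*-identityˡ (m ps))) (absorb ps))
    absorb ((i , j , suc e) ∷ ps) = ℚ.*-zeroˡ (m ((i , j , suc e) ∷ ps))

  module _ {n : ℕ} where

    -- The constant `c` is attached to each single power sum, so that a product over the blocks of τ
    -- acquires one factor `c` per block.
    blockP blockF : Block n → Series
    blockP (d , i) = c • substPower (index i) (pSeries d)
    blockF (d , i) = substPower (index i) (F d)

    blockF-0 : ∀ i → blockF (0 , i) ≈ 𝟙
    blockF-0 i f = trans (substPower-cong _ F-0 f) (substPower-𝟙 _ f)

    block-newton : ∀ d i f →
      ∑² (splitsℕ d) (λ k l → (blockP (k , i) ⊛ blockF (l , i)) f) ≡ fromℕ d ℚ.* blockF (d , i) f
    block-newton d i f = begin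
      ∑² (splitsℕ d) (λ k l → (blockP (k , i) ⊛ blockF (l , i)) f)
        ≡⟨ ∑²-cong (splitsℕ d) (λ k l → trans
             (⊛-cong {G = blockF (l , i)} (λ g → sym (substPower-• _ c (pSeries k) g)) (λ _ → refl) f)
             (sym (substPower-⊛ _ (c • pSeries k) (F l) f))) ⟩
      ∑² (splitsℕ d) (λ k l → substPower (index i) ((c • pSeries k) ⊛ F l) f)
        ≡⟨ substPower-∑ _ (splitsℕ d) (λ (k , l) → (c • pSeries k) ⊛ F l) f ⟨
      substPower (index i) (λ f → ∑² (splitsℕ d) (λ k l → ((c • pSeries k) ⊛ F l) f)) f
        ≡⟨ substPower-cong _ (newton d) f ⟩
      substPower (index i) (fromℕ d • F d) f
        ≡⟨ substPower-• _ (fromℕ d) (F d) f ⟩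
      fromℕ d ℚ.* blockF (d , i) f ∎

-- One variable contributes `1/(1 - x)`, and the coefficient of `x^e` in `x/(1 - x)` times this
-- series counts the `a` with `1 ≤ a ≤ e`.
h-newton₁ : ∀ e → 1ℚ ℚ.* ∑² (splitsℕ e) (λ a b → ⟦ not (isZero a) ⟧ ℚ.* 1ℚ) ≡ fromℕ e ℚ.* 1ℚ
h-newton₁ zero    = cong (1ℚ ℚ.*_) (∑²-splitsℕ-0 _)
h-newton₁ (suc e) = begin
  1ℚ ℚ.* ∑² (splitsℕ (suc e)) (λ a b → ⟦ not (isZero a) ⟧ ℚ.* 1ℚ)
    ≡⟨ ℚ.*-identityˡ _ ⟩
  ∑² (splitsℕ (suc e)) (λ a b → ⟦ not (isZero a) ⟧ ℚ.* 1ℚ)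
    ≡⟨ trans (∑²-splitsℕ-suc e _) (ℚ.+-identityˡ _) ⟩
  ∑² (splitsℕ e) (λ a b → 1ℚ)
    ≡⟨ count e ⟩
  fromℕ (suc e)
    ≡⟨ ℚ.*-identityʳ _ ⟨
  fromℕ (suc e) ℚ.* 1ℚ ∎
  where
  count : ∀ e → ∑² (splitsℕ e) (λ a b → 1ℚ) ≡ fromℕ (suc e)
  count zero    = ∑²-splitsℕ-0 _
  count (suc e) = trans (∑²-splitsℕ-suc e _)
    (trans (cong (1ℚ ℚ.+_) (count e)) (sym (fromℕ-+ 1 (suc e))))

-- The coefficients of `1 - x`, the factor that one variable contributes to the sum of all `E_d`.
ε : ℕ → ℚ
ε 0 = 1ℚ
ε 1 = ℚ.- 1ℚ
ε _ = 0ℚ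

-- Both sides are the coefficients of `-x`: on the left `x/(1 - x)` cancels against `1 - x`, on the
-- right the Euler operator acts on `1 - x`. The cancellation says that the partial sums of `ε` are
-- 1, 0, 0 and so on.
e-newton₁ : ∀ e → ℚ.- 1ℚ ℚ.* ∑² (splitsℕ e) (λ a b → ⟦ not (isZero a) ⟧ ℚ.* ε b) ≡ fromℕ e ℚ.* ε e
e-newton₁ zero    = cong (ℚ.- 1ℚ ℚ.*_) (∑²-splitsℕ-0 _)
e-newton₁ (suc e) = trans (cong (ℚ.- 1ℚ ℚ.*_) (begin
  ∑² (splitsℕ (suc e)) (λ a b → ⟦ not (isZero a) ⟧ ℚ.* ε b)
    ≡⟨ ∑²-splitsℕ-suc e _ ⟩
  0ℚ ℚ.* ε (suc e) ℚ.+ ∑² (splitsℕ e) (λ a b → 1ℚ ℚ.* ε b)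
    ≡⟨ cong₂ ℚ._+_ (ℚ.*-zeroˡ (ε (suc e))) (∑²-cong (splitsℕ e) λ a b → ℚ.*-identityˡ (ε b)) ⟩
  0ℚ ℚ.+ ∑² (splitsℕ e) (λ a b → ε b)
    ≡⟨ trans (ℚ.+-identityˡ _) (splitsℕ-cocommutative e (λ a b → ε b)) ⟩
  ∑² (splitsℕ e) (λ a b → ε a) ∎)) (partialSum e)
  where
  partialSum : ∀ e → ℚ.- 1ℚ ℚ.* ∑² (splitsℕ e) (λ a b → ε a) ≡ fromℕ (suc e) ℚ.* ε (suc e)
  partialSum 0             = cong (ℚ.- 1ℚ ℚ.*_) (∑²-splitsℕ-0 _)
  partialSum 1             = cong (ℚ.- 1ℚ ℚ.*_)
    (trans (∑²-splitsℕ-suc 0 _) (cong (1ℚ ℚ.+_) (∑²-splitsℕ-0 _)))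
  partialSum (suc (suc e)) = trans
    (cong (ℚ.- 1ℚ ℚ.*_) (trans (∑²-splitsℕ-suc (suc e) _) (cong (1ℚ ℚ.+_)
      (trans (∑²-splitsℕ-suc e _) (cong (ℚ.- 1ℚ ℚ.+_) (∑-0 (splitsℕ e)))))))
    (sym (ℚ.*-zeroʳ (fromℕ (3 ℕ.+ e))))

hSeries≡ : ∀ d f → hSeries d f ≡ ⟦ does (degree f ℕ.≟ d) ⟧ ℚ.* weightedProduct (λ _ → 1ℚ) (powersFrom 1 f)
hSeries≡ d f = sym (trans (cong (hSeries d f ℚ.*_) (ones (powersFrom 1 f))) (ℚ.*-identityʳ (hSeries d f)))
  where
  ones : ∀ ps → weightedProduct (λ _ → 1ℚ) ps ≡ 1ℚ
  ones []       = refl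
  ones (x ∷ ps) = trans (ℚ.*-identityˡ _) (ones ps)

-- Distributes the sign over the variables: exponent 1 gives a factor -1, and a larger exponent
-- annihilates the product just as it violates square-freeness.
eSeries≡ : ∀ d f → eSeries d f ≡ ⟦ does (degree f ℕ.≟ d) ⟧ ℚ.* weightedProduct ε (powersFrom 1 f)
eSeries≡ d f = begin
  eSeries d f
    ≡⟨ if≡⟦⟧* (does ((degree f ℕ.≟ d) ×-dec squareFree? f)) _ ⟩
  ⟦ does (degree f ℕ.≟ d) ∧ does (squareFree? f) ⟧ ℚ.* fromℤ (sign (variables f))
    ≡⟨ cong (ℚ._* fromℤ (sign (variables f))) (⟦∧⟧ (does (degree f ℕ.≟ d)) _) ⟩
  ⟦ does (degree f ℕ.≟ d) ⟧ ℚ.* ⟦ does (squareFree? f) ⟧ ℚ.* fromℤ (sign (variables f))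
    ≡⟨ ℚ.*-assoc ⟦ does (degree f ℕ.≟ d) ⟧ _ _ ⟩
  ⟦ does (degree f ℕ.≟ d) ⟧ ℚ.* (⟦ does (squareFree? f) ⟧ ℚ.* fromℤ (sign (variables f)))
    ≡⟨ cong (⟦ does (degree f ℕ.≟ d) ⟧ ℚ.*_) (signs (powersFrom 1 f)) ⟩
  ⟦ does (degree f ℕ.≟ d) ⟧ ℚ.* weightedProduct ε (powersFrom 1 f) ∎
  where
  signs : ∀ ps → ⟦ does (All.all? (λ x → exponent x ℕ.≤? 1) (nonzeroPowers ps)) ⟧ ℚ.*
                 fromℤ (sign (length (nonzeroPowers ps))) ≡ weightedProduct ε ps
  signs []                          = refl
  signs ((_ , _ , zero)       ∷ ps) = trans (signs ps) (sym (ℚ.*-identityˡ (weightedProduct ε ps)))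
  signs ((_ , _ , 1)          ∷ ps) = begin
    s ℚ.* fromℤ (-1ℤ ℤ.* sign k)          ≡⟨ cong (s ℚ.*_) (fromℤ-* -1ℤ (sign k)) ⟩
    s ℚ.* (ℚ.- 1ℚ ℚ.* fromℤ (sign k))     ≡⟨ *-swapˡ s (ℚ.- 1ℚ) _ ⟩
    ℚ.- 1ℚ ℚ.* (s ℚ.* fromℤ (sign k))     ≡⟨ cong (ℚ.- 1ℚ ℚ.*_) (signs ps) ⟩
    ℚ.- 1ℚ ℚ.* weightedProduct ε ps       ∎
    where
    s : ℚ
    s = ⟦ does (All.all? (λ x → exponent x ℕ.≤? 1) (nonzeroPowers ps)) ⟧
    k : ℕ
    k = length (nonzeroPowers ps)
  signs ((_ , _ , suc (suc _)) ∷ ps) = trans (ℚ.*-zeroˡ (fromℤ (sign (suc (length (nonzeroPowers ps))))))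
    (sym (ℚ.*-zeroˡ (weightedProduct ε ps)))

module H-Newton = GradedNewton 1ℚ (λ _ → 1ℚ) h-newton₁ refl hSeries hSeries≡
module E-Newton = GradedNewton (ℚ.- 1ℚ) ε e-newton₁ refl eSeries eSeries≡

-- Assignments of bricks to rows

-- Both sides range over the triples with sum `d`. The exchange corresponds to cutting two bricks
-- off the same row in the other order.
∑²-splitsℕ-triple : ∀ d (W : ℕ → ℕ → ℕ → ℚ) →
  ∑² (splitsℕ d) (λ k l → ∑² (splitsℕ l) (λ a m → W k a m)) ≡
  ∑² (splitsℕ d) (λ k l → ∑² (splitsℕ l) (λ a m → W a k m))
∑²-splitsℕ-triple d W = begin
  ∑² (splitsℕ d) (λ k l → ∑² (splitsℕ l) (λ a m → W k a m))
    ≡⟨ splitsℕ-coassociative d W ⟨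
  ∑² (splitsℕ d) (λ p m → ∑² (splitsℕ p) (λ k a → W k a m))
    ≡⟨ ∑²-cong (splitsℕ d) (λ p m → splitsℕ-cocommutative p (λ k a → W k a m)) ⟩
  ∑² (splitsℕ d) (λ p m → ∑² (splitsℕ p) (λ k a → W a k m))
    ≡⟨ splitsℕ-coassociative d (λ k a m → W a k m) ⟩
  ∑² (splitsℕ d) (λ k l → ∑² (splitsℕ l) (λ a m → W a k m)) ∎

module _ {n : ℕ} where

  infix 4 _≟ᵇ_
  _≟ᵇ_ : DecidableEquality (Block n)
  _≟ᵇ_ = ≡-dec ℕ._≟_ Fin._≟_

  ⟦≟⟧ : Fin n → Fin n → ℚ
  ⟦≟⟧ i j = ⟦ does (i Fin.≟ j) ⟧

  -- The sum of F over the ways of cutting the brick (k , i) off one row.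
  place : Block n → (List (Block n) → ℚ) → List (Block n) → ℚ
  place b       F []            = 0ℚ
  place (k , i) F ((d , j) ∷ s) =
    ⟦≟⟧ i j ℚ.* ∑² (splitsℕ d) (λ a l → ⟦ does (k ℕ.≟ a) ⟧ ℚ.* F ((l , j) ∷ s))
    ℚ.+ place (k , i) (λ s → F ((d , j) ∷ s)) s

  -- The number of ways to distribute labelled bricks to rows of the same
  -- tensor factor such that the lengths of the bricks in each row add up
  -- to the length of the row.
  assignments : List (Block n) → List (Block n) → ℚ
  assignments s []       = ⟦ all (isZero ∘ proj₁) s ⟧
  assignments s (b ∷ bs) = place b (λ s → assignments s bs) s

  place-cong : ∀ b {F G} → (∀ s → F s ≡ G s) → ∀ s → place b F s ≡ place b G s
  place-cong b       eq []            = refl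
  place-cong (k , i) eq ((d , j) ∷ s) = cong₂ ℚ._+_
    (cong (⟦≟⟧ i j ℚ.*_) (∑²-cong (splitsℕ d) λ a l → cong (⟦ does (k ℕ.≟ a) ⟧ ℚ.*_) (eq _)))
    (place-cong (k , i) (λ s → eq ((d , j) ∷ s)) s)

  place-+ : ∀ b F G s → place b (λ s → F s ℚ.+ G s) s ≡ place b F s ℚ.+ place b G s
  place-+ b       F G []            = refl
  place-+ (k , i) F G ((d , j) ∷ s) = trans
    (cong₂ ℚ._+_
      (trans
        (cong (⟦≟⟧ i j ℚ.*_) (trans
          (∑²-cong (splitsℕ d) λ a l → ℚ.*-distribˡ-+ ⟦ does (k ℕ.≟ a) ⟧ (F ((l , j) ∷ s)) (G ((l , j) ∷ s)))
          (∑-+ (splitsℕ d) _ _)))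
        (ℚ.*-distribˡ-+ (⟦≟⟧ i j) _ _))
      (place-+ (k , i) _ _ s))
    (+-interchange (⟦≟⟧ i j ℚ.* ∑² (splitsℕ d) (λ a l → ⟦ does (k ℕ.≟ a) ⟧ ℚ.* F ((l , j) ∷ s))) _ _ _)

  place-* : ∀ b c F s → place b (λ s → c ℚ.* F s) s ≡ c ℚ.* place b F s
  place-* b       c F []            = sym (ℚ.*-zeroʳ c)
  place-* (k , i) c F ((d , j) ∷ s) = trans
    (cong₂ ℚ._+_
      (trans
        (cong (⟦≟⟧ i j ℚ.*_) (trans
          (∑²-cong (splitsℕ d) λ a l → *-swapˡ ⟦ does (k ℕ.≟ a) ⟧ c (F ((l , j) ∷ s)))
          (sym (*-∑ (splitsℕ d) c _))))
        (*-swapˡ (⟦≟⟧ i j) c _))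
      (place-* (k , i) c _ s))
    (sym (ℚ.*-distribˡ-+ c _ _))

  place-0 : ∀ b s → place b (λ _ → 0ℚ) s ≡ 0ℚ
  place-0 b s = trans (place-* b 0ℚ (λ _ → 0ℚ) s) (ℚ.*-zeroˡ (place b (λ _ → 0ℚ) s))

  place-∑ : ∀ {A : Set} b (xs : List A) (F : A → List (Block n) → ℚ) s →
            place b (λ s → ∑ xs (λ x → F x s)) s ≡ ∑ xs (λ x → place b (F x) s)
  place-∑ b []       F s = trans (place-cong b (λ _ → ∑-[] _) s) (trans (place-0 b s) (sym (∑-[] _)))
  place-∑ b (x ∷ xs) F s = begin
    place b (λ s → ∑ (x ∷ xs) (λ x → F x s)) s
      ≡⟨ place-cong b (λ s → ∑-∷ x xs (λ x → F x s)) s ⟩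
    place b (λ s → F x s ℚ.+ ∑ xs (λ x → F x s)) s
      ≡⟨ place-+ b (F x) _ s ⟩
    place b (F x) s ℚ.+ place b (λ s → ∑ xs (λ x → F x s)) s
      ≡⟨ cong (place b (F x) s ℚ.+_) (place-∑ b xs F s) ⟩
    place b (F x) s ℚ.+ ∑ xs (λ x → place b (F x) s)
      ≡⟨ ∑-∷ x xs _ ⟨
    ∑ (x ∷ xs) (λ x → place b (F x) s) ∎

  -- Sorted by which bricks go into the head row, there are four terms: both, only `b`, only `c`,
  -- neither. Exchanging the bricks swaps the two mixed terms; the first is symmetric by
  -- `∑²-splitsℕ-triple` and the last by induction.
  place-comm : ∀ b c F s → place b (place c F) s ≡ place c (place b F) s
  place-comm b         c         F []            = refl
  place-comm b@(k , i) c@(k′ , i′) F ((d , j) ∷ s) = begin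
    place b (place c F) ((d , j) ∷ s)
      ≡⟨ expand k i k′ i′ ⟩
    same k i k′ i′ ℚ.+ mixed k i c ℚ.+ (mixed k′ i′ b ℚ.+ place b (place c F′) s)
      ≡⟨ cong₂ (λ x y → x ℚ.+ mixed k i c ℚ.+ (mixed k′ i′ b ℚ.+ y)) same-comm (place-comm b c F′ s) ⟩
    same k′ i′ k i ℚ.+ mixed k i c ℚ.+ (mixed k′ i′ b ℚ.+ place c (place b F′) s)
      ≡⟨ +-interchange (same k′ i′ k i) (mixed k i c) (mixed k′ i′ b) _ ⟩
    same k′ i′ k i ℚ.+ mixed k′ i′ b ℚ.+ (mixed k i c ℚ.+ place c (place b F′) s)
      ≡⟨ expand k′ i′ k i ⟨
    place c (place b F) ((d , j) ∷ s) ∎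
    where
    F′ : List (Block n) → ℚ
    F′ s = F ((d , j) ∷ s)

    δ : ℕ → ℕ → ℚ
    δ k a = ⟦ does (k ℕ.≟ a) ⟧

    same : ℕ → Fin n → ℕ → Fin n → ℚ
    same k i k′ i′ = ⟦≟⟧ i j ℚ.* (⟦≟⟧ i′ j ℚ.* ∑² (splitsℕ d) (λ a l →
      ∑² (splitsℕ l) (λ a′ m → δ k a ℚ.* δ k′ a′ ℚ.* F ((m , j) ∷ s))))

    mixed : ℕ → Fin n → Block n → ℚ
    mixed k i c = ⟦≟⟧ i j ℚ.* ∑² (splitsℕ d) (λ a l → δ k a ℚ.* place c (λ s → F ((l , j) ∷ s)) s)

    same-comm : same k i k′ i′ ≡ same k′ i′ k i
    same-comm = trans (*-swapˡ (⟦≟⟧ i j) (⟦≟⟧ i′ j) _)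
      (cong (λ x → ⟦≟⟧ i′ j ℚ.* (⟦≟⟧ i j ℚ.* x)) (trans
        (∑²-splitsℕ-triple d (λ a a′ m → δ k a ℚ.* δ k′ a′ ℚ.* F ((m , j) ∷ s)))
        (∑²-cong (splitsℕ d) λ a l → ∑²-cong (splitsℕ l) λ a′ m →
          cong (ℚ._* F ((m , j) ∷ s)) (ℚ.*-comm (δ k a′) (δ k′ a)))))

    expand : ∀ k i k′ i′ → place (k , i) (place (k′ , i′) F) ((d , j) ∷ s) ≡
      same k i k′ i′ ℚ.+ mixed k i (k′ , i′) ℚ.+ (mixed k′ i′ (k , i) ℚ.+ place (k , i) (place (k′ , i′) F′) s)
    expand k i k′ i′ = cong₂ ℚ._+_
      (begin
        ⟦≟⟧ i j ℚ.* ∑² (splitsℕ d) (λ a l → δ k a ℚ.* (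
          ⟦≟⟧ i′ j ℚ.* ∑² (splitsℕ l) (λ a′ m → δ k′ a′ ℚ.* F ((m , j) ∷ s)) ℚ.+
          place (k′ , i′) (λ s → F ((l , j) ∷ s)) s))
          ≡⟨ cong (⟦≟⟧ i j ℚ.*_) (trans
               (∑²-cong (splitsℕ d) λ a l → trans (ℚ.*-distribˡ-+ (δ k a) _ _)
                 (cong (ℚ._+ δ k a ℚ.* place (k′ , i′) (λ s → F ((l , j) ∷ s)) s)
                   (trans (*-swapˡ (δ k a) (⟦≟⟧ i′ j) _) (cong (⟦≟⟧ i′ j ℚ.*_)
                     (trans (*-∑ (splitsℕ l) (δ k a) _)
                       (∑²-cong (splitsℕ l) λ a′ m → sym (ℚ.*-assoc (δ k a) (δ k′ a′) _)))))))
               (trans (∑-+ (splitsℕ d) _ _) (cong (ℚ._+ ∑² (splitsℕ d) _) (sym (*-∑ (splitsℕ d) (⟦≟⟧ i′ j) _))))) ⟩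
        ⟦≟⟧ i j ℚ.* (⟦≟⟧ i′ j ℚ.* ∑² (splitsℕ d) (λ a l →
          ∑² (splitsℕ l) (λ a′ m → δ k a ℚ.* δ k′ a′ ℚ.* F ((m , j) ∷ s))) ℚ.+
          ∑² (splitsℕ d) (λ a l → δ k a ℚ.* place (k′ , i′) (λ s → F ((l , j) ∷ s)) s))
          ≡⟨ ℚ.*-distribˡ-+ (⟦≟⟧ i j) _ _ ⟩
        same k i k′ i′ ℚ.+ mixed k i (k′ , i′) ∎)
      (trans (place-+ (k , i) _ _ s) (cong (ℚ._+ place (k , i) (place (k′ , i′) F′) s)
        (trans (place-* (k , i) (⟦≟⟧ i′ j) _ s) (cong (⟦≟⟧ i′ j ℚ.*_)
          (trans (place-∑ (k , i) (splitsℕ d) _ s)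
            (∑²-cong (splitsℕ d) λ a l → place-* (k , i) (δ k′ a) _ s))))))

  -- Needed because the blocks of a type are listed in sorted order, so an inserted block does not
  -- come first.
  assignments-↭ : ∀ s {bs cs} → bs ↭ cs → assignments s bs ≡ assignments s cs
  assignments-↭ s ↭.refl                    = refl
  assignments-↭ s (↭.prep b p)              = place-cong b (λ s → assignments-↭ s p) s
  assignments-↭ s (↭.swap {xs} {ys} b c p)  = trans
    (place-comm b c (λ s → assignments s xs) s)
    (place-cong c (place-cong b (λ s → assignments-↭ s p)) s)
  assignments-↭ s (↭.trans p q)             = trans (assignments-↭ s p) (assignments-↭ s q)

  -- The sum of F over the ways of removing one brick equal to b.
  delete : Block n → (List (Block n) → ℚ) → List (Block n) → ℚ
  delete b F []       = 0ℚ
  delete b F (c ∷ bs) = ⟦ does (b ≟ᵇ c) ⟧ ℚ.* F bs ℚ.+ delete b (λ bs → F (c ∷ bs)) bs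

  delete-cong : ∀ b {F G} → (∀ bs → F bs ≡ G bs) → ∀ bs → delete b F bs ≡ delete b G bs
  delete-cong b eq []       = refl
  delete-cong b eq (c ∷ bs) = cong₂ ℚ._+_ (cong (⟦ does (b ≟ᵇ c) ⟧ ℚ.*_) (eq bs))
                                          (delete-cong b (λ bs → eq (c ∷ bs)) bs)

  delete-+ : ∀ b F G bs → delete b (λ bs → F bs ℚ.+ G bs) bs ≡ delete b F bs ℚ.+ delete b G bs
  delete-+ b F G []       = refl
  delete-+ b F G (c ∷ bs) = trans
    (cong₂ ℚ._+_ (ℚ.*-distribˡ-+ ⟦ does (b ≟ᵇ c) ⟧ (F bs) (G bs)) (delete-+ b _ _ bs))
    (+-interchange (⟦ does (b ≟ᵇ c) ⟧ ℚ.* F bs) _ _ _)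

  delete-* : ∀ b c F bs → delete b (λ bs → c ℚ.* F bs) bs ≡ c ℚ.* delete b F bs
  delete-* b c F []       = sym (ℚ.*-zeroʳ c)
  delete-* b c F (e ∷ bs) = trans
    (cong₂ ℚ._+_ (*-swapˡ ⟦ does (b ≟ᵇ e) ⟧ c (F bs)) (delete-* b c _ bs))
    (sym (ℚ.*-distribˡ-+ c _ _))

  delete-0 : ∀ b bs → delete b (λ _ → 0ℚ) bs ≡ 0ℚ
  delete-0 b bs = trans (delete-* b 0ℚ (λ _ → 0ℚ) bs) (ℚ.*-zeroˡ (delete b (λ _ → 0ℚ) bs))

  delete-∑ : ∀ {A : Set} b (xs : List A) (F : A → List (Block n) → ℚ) bs →
             delete b (λ bs → ∑ xs (λ x → F x bs)) bs ≡ ∑ xs (λ x → delete b (F x) bs)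
  delete-∑ b []       F bs = trans (delete-cong b (λ _ → ∑-[] _) bs) (trans (delete-0 b bs) (sym (∑-[] _)))
  delete-∑ b (x ∷ xs) F bs = begin
    delete b (λ bs → ∑ (x ∷ xs) (λ x → F x bs)) bs
      ≡⟨ delete-cong b (λ bs → ∑-∷ x xs (λ x → F x bs)) bs ⟩
    delete b (λ bs → F x bs ℚ.+ ∑ xs (λ x → F x bs)) bs
      ≡⟨ delete-+ b (F x) _ bs ⟩
    delete b (F x) bs ℚ.+ delete b (λ bs → ∑ xs (λ x → F x bs)) bs
      ≡⟨ cong (delete b (F x) bs ℚ.+_) (delete-∑ b xs F bs) ⟩
    delete b (F x) bs ℚ.+ ∑ xs (λ x → delete b (F x) bs)
      ≡⟨ ∑-∷ x xs _ ⟨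
    ∑ (x ∷ xs) (λ x → delete b (F x) bs) ∎

  -- Deletion acts on the content and placement on the shape, so they commute.
  delete-place : ∀ b c (F : List (Block n) → List (Block n) → ℚ) s bs →
    delete b (λ bs → place c (λ s → F s bs) s) bs ≡ place c (λ s → delete b (F s) bs) s
  delete-place b c F s []       = sym (place-0 c s)
  delete-place b c F s (e ∷ bs) = trans
    (cong₂ ℚ._+_ (sym (place-* c ⟦ does (b ≟ᵇ e) ⟧ (λ s → F s bs) s))
                 (delete-place b c (λ s bs → F s (e ∷ bs)) s bs))
    (sym (place-+ c _ _ s))

  PermutationInvariant : (List (Block n) → ℚ) → Set
  PermutationInvariant F = ∀ {bs cs} → bs ↭ cs → F bs ≡ F cs

  delete-↭ : ∀ b {F} → PermutationInvariant F → PermutationInvariant (delete b F)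
  delete-↭ b         inv ↭.refl       = refl
  delete-↭ b         inv (↭.prep c p) = cong₂ ℚ._+_ (cong (⟦ does (b ≟ᵇ c) ⟧ ℚ.*_) (inv p))
    (delete-↭ b (λ q → inv (↭.prep c q)) p)
  delete-↭ b {F} inv (↭.swap {xs} {ys} c e p) = trans
    (+-swapˡ (⟦ does (b ≟ᵇ c) ⟧ ℚ.* F (e ∷ xs)) (⟦ does (b ≟ᵇ e) ⟧ ℚ.* F (c ∷ xs)) _)
    (cong₂ ℚ._+_ (cong (⟦ does (b ≟ᵇ e) ⟧ ℚ.*_) (inv (↭.prep c p)))
      (cong₂ ℚ._+_ (cong (⟦ does (b ≟ᵇ c) ⟧ ℚ.*_) (inv (↭.prep e p)))
        (trans (delete-cong b (λ bs → inv (↭.swap c e ↭.refl)) xs)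
               (delete-↭ b (λ q → inv (↭.prep e (↭.prep c q))) p))))
  delete-↭ b         inv (↭.trans p q) = trans (delete-↭ b inv p) (delete-↭ b inv q)

  count : Block n → List (Block n) → ℚ
  count b = delete b (λ _ → 1ℚ)

  -- Removing any of the equal copies of `b` leaves `bs` up to order, so all contribute alike. The
  -- factor is the number `m` of copies, later cancelled by the quotient of the `z`-values.
  delete-∷ : ∀ b {F} → PermutationInvariant F → ∀ bs →
             delete b F (b ∷ bs) ≡ (1ℚ ℚ.+ count b bs) ℚ.* F bs
  delete-∷ b {F} inv bs = begin
    ⟦ does (b ≟ᵇ b) ⟧ ℚ.* F bs ℚ.+ delete b (λ bs → F (b ∷ bs)) bs
      ≡⟨ cong₂ ℚ._+_ (cong (λ x → ⟦ x ⟧ ℚ.* F bs) (dec-true (b ≟ᵇ b) refl)) (later inv bs) ⟩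
    1ℚ ℚ.* F bs ℚ.+ count b bs ℚ.* F bs
      ≡⟨ ℚ.*-distribʳ-+ (F bs) 1ℚ (count b bs) ⟨
    (1ℚ ℚ.+ count b bs) ℚ.* F bs ∎
    where
    later : ∀ {F} → PermutationInvariant F → ∀ bs →
            delete b (λ bs → F (b ∷ bs)) bs ≡ count b bs ℚ.* F bs
    later {F} inv []       = sym (ℚ.*-zeroˡ (F []))
    later {F} inv (c ∷ bs) = begin
      ⟦ does (b ≟ᵇ c) ⟧ ℚ.* F (b ∷ bs) ℚ.+ delete b (λ bs → F (b ∷ c ∷ bs)) bs
        ≡⟨ cong₂ ℚ._+_ (replace (b ≟ᵇ c)) (trans
             (delete-cong b (λ bs → inv (↭.swap b c ↭.refl)) bs)
             (later (λ p → inv (↭.prep c p)) bs)) ⟩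
      ⟦ does (b ≟ᵇ c) ⟧ ℚ.* 1ℚ ℚ.* F (c ∷ bs) ℚ.+ count b bs ℚ.* F (c ∷ bs)
        ≡⟨ ℚ.*-distribʳ-+ (F (c ∷ bs)) (⟦ does (b ≟ᵇ c) ⟧ ℚ.* 1ℚ) (count b bs) ⟨
      count b (c ∷ bs) ℚ.* F (c ∷ bs) ∎
      where
      replace : Dec (b ≡ c) → ⟦ does (b ≟ᵇ c) ⟧ ℚ.* F (b ∷ bs) ≡ ⟦ does (b ≟ᵇ c) ⟧ ℚ.* 1ℚ ℚ.* F (c ∷ bs)
      replace (yes refl) = cong (ℚ._* F (b ∷ bs)) (sym (ℚ.*-identityʳ ⟦ does (b ≟ᵇ b) ⟧))
      replace (no  b≢c)  rewrite dec-false (b ≟ᵇ c) b≢c =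
        trans (ℚ.*-zeroˡ (F (b ∷ bs))) (sym (ℚ.*-zeroˡ (F (c ∷ bs))))

  delete-∉ : ∀ {b F bs} → b ∉ bs → delete b F bs ≡ 0ℚ
  delete-∉ {b} {F} {[]}     b∉ = refl
  delete-∉ {b} {F} {c ∷ bs} b∉ = trans
    (cong₂ ℚ._+_ (trans (cong (λ x → ⟦ x ⟧ ℚ.* F bs) (dec-false (b ≟ᵇ c) (b∉ ∘ here)))
                        (ℚ.*-zeroˡ (F bs)))
                 (delete-∉ {bs = bs} (b∉ ∘ there)))
    (ℚ.+-identityˡ 0ℚ)

  -- Double counting of the pairs of an assignment and a cell of the first
  -- row, according to the brick that contains the cell.
  assignments-first-row : ∀ d i s bs → fromℕ d ℚ.* assignments ((d , i) ∷ s) bs ≡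
    ∑² (splitsℕ d) (λ k l → fromℕ k ℚ.* delete (k , i) (assignments ((l , i) ∷ s)) bs)
  assignments-first-row d i s [] = trans (vanish d) (sym (trans
    (∑²-cong (splitsℕ d) λ k l → ℚ.*-zeroʳ (fromℕ k)) (∑-0 (splitsℕ d))))
    where
    vanish : ∀ d → fromℕ d ℚ.* assignments ((d , i) ∷ s) [] ≡ 0ℚ
    vanish zero    = ℚ.*-zeroˡ (assignments ((zero , i) ∷ s) [])
    vanish (suc d) = ℚ.*-zeroʳ (fromℕ (suc d))
  assignments-first-row d i s (x@(k₀ , i₀) ∷ bs) = begin
    fromℕ d ℚ.* (η ℚ.* ∑² (splitsℕ d) (λ a l → δ a ℚ.* A l bs) ℚ.+ place x (λ s → assignments ((d , i) ∷ s) bs) s)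
      ≡⟨ trans (ℚ.*-distribˡ-+ (fromℕ d) _ _) (cong₂ ℚ._+_ shortened other) ⟩
    removed ℚ.+ kept ℚ.+ rest
      ≡⟨ ℚ.+-assoc removed kept rest ⟩
    removed ℚ.+ (kept ℚ.+ rest)
      ≡⟨ cong (removed ℚ.+_) (∑-+ (splitsℕ d) _ _) ⟨
    removed ℚ.+ ∑² (splitsℕ d) (λ k l →
      fromℕ k ℚ.* (η ℚ.* ∑² (splitsℕ l) (λ a m → δ a ℚ.* delete (k , i) (A m) bs)) ℚ.+
      fromℕ k ℚ.* place x (λ s → delete (k , i) (assignments ((l , i) ∷ s)) bs) s)
      ≡⟨ ∑-+ (splitsℕ d) _ _ ⟨
    ∑² (splitsℕ d) (λ k l →
      fromℕ k ℚ.* (⟦ does ((k , i) ≟ᵇ x) ⟧ ℚ.* A l bs) ℚ.+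
      (fromℕ k ℚ.* (η ℚ.* ∑² (splitsℕ l) (λ a m → δ a ℚ.* delete (k , i) (A m) bs)) ℚ.+
       fromℕ k ℚ.* place x (λ s → delete (k , i) (assignments ((l , i) ∷ s)) bs) s))
      ≡⟨ ∑²-cong (splitsℕ d) collect ⟩
    ∑² (splitsℕ d) (λ k l → fromℕ k ℚ.* delete (k , i) (assignments ((l , i) ∷ s)) (x ∷ bs)) ∎
    where
    A : ℕ → List (Block n) → ℚ
    A l = assignments ((l , i) ∷ s)

    η : ℚ
    η = ⟦≟⟧ i₀ i

    δ : ℕ → ℚ
    δ a = ⟦ does (k₀ ℕ.≟ a) ⟧

    -- The three cases for the first brick `x` and the marked cell of the first row: the cell is in
    -- `x`; `x` is in the first row but the cell is in another brick; `x` is in another row.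
    removed kept rest : ℚ
    removed = ∑² (splitsℕ d) (λ k l → fromℕ k ℚ.* (⟦ does ((k , i) ≟ᵇ x) ⟧ ℚ.* A l bs))
    kept    = ∑² (splitsℕ d) (λ k l →
      fromℕ k ℚ.* (η ℚ.* ∑² (splitsℕ l) (λ a m → δ a ℚ.* delete (k , i) (A m) bs)))
    rest    = ∑² (splitsℕ d) (λ k l →
      fromℕ k ℚ.* place x (λ s → delete (k , i) (assignments ((l , i) ∷ s)) bs) s)

    ⟦≟ᵇ⟧ : ∀ k → η ℚ.* δ k ≡ ⟦ does ((k , i) ≟ᵇ x) ⟧
    ⟦≟ᵇ⟧ k = trans (sym (⟦∧⟧ (does (i₀ Fin.≟ i)) (does (k₀ ℕ.≟ k))))
      (cong ⟦_⟧ (does-cong ((i₀ Fin.≟ i) ×-dec (k₀ ℕ.≟ k)) ((k , i) ≟ᵇ x)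
        (λ { (refl , refl) → refl }) (λ { refl → refl , refl })))

    other : fromℕ d ℚ.* place x (λ s → assignments ((d , i) ∷ s) bs) s ≡ rest
    other = begin
      fromℕ d ℚ.* place x (λ s → assignments ((d , i) ∷ s) bs) s
        ≡⟨ place-* x (fromℕ d) _ s ⟨
      place x (λ s → fromℕ d ℚ.* assignments ((d , i) ∷ s) bs) s
        ≡⟨ place-cong x (λ s → assignments-first-row d i s bs) s ⟩
      place x (λ s → ∑² (splitsℕ d) (λ k l → fromℕ k ℚ.* delete (k , i) (assignments ((l , i) ∷ s)) bs)) s
        ≡⟨ place-∑ x (splitsℕ d) _ s ⟩
      ∑² (splitsℕ d) (λ k l → place x (λ s → fromℕ k ℚ.* delete (k , i) (assignments ((l , i) ∷ s)) bs) s)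
        ≡⟨ ∑²-cong (splitsℕ d) (λ k l → place-* x (fromℕ k) _ s) ⟩
      rest ∎

    shortened : fromℕ d ℚ.* (η ℚ.* ∑² (splitsℕ d) (λ a l → δ a ℚ.* A l bs)) ≡ removed ℚ.+ kept
    shortened = begin
      fromℕ d ℚ.* (η ℚ.* ∑² (splitsℕ d) (λ a l → δ a ℚ.* A l bs))
        ≡⟨ trans (*-swapˡ (fromℕ d) η _) (cong (η ℚ.*_) (*-∑ (splitsℕ d) (fromℕ d) _)) ⟩
      η ℚ.* ∑² (splitsℕ d) (λ a l → fromℕ d ℚ.* (δ a ℚ.* A l bs))
        ≡⟨ cong (η ℚ.*_) (trans
             -- Of the `d` cells of the row, `a` lie in the brick `x` and `l` in the remainder of
             -- the row, to which induction applies.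
             (∑²-splitsℕ-cong d λ a l a+l≡d → trans
               (cong (ℚ._* (δ a ℚ.* A l bs)) (trans (cong fromℕ (sym a+l≡d)) (fromℕ-+ a l)))
               (solve 4 (λ a l δ A → (a :+ l) :* (δ :* A) := a :* (δ :* A) :+ δ :* (l :* A)) refl
                 (fromℕ a) (fromℕ l) (δ a) (A l bs)))
             (∑-+ (splitsℕ d) _ _)) ⟩
      η ℚ.* (∑² (splitsℕ d) (λ a l → fromℕ a ℚ.* (δ a ℚ.* A l bs)) ℚ.+
             ∑² (splitsℕ d) (λ a l → δ a ℚ.* (fromℕ l ℚ.* A l bs)))
        ≡⟨ ℚ.*-distribˡ-+ η _ _ ⟩
      η ℚ.* ∑² (splitsℕ d) (λ a l → fromℕ a ℚ.* (δ a ℚ.* A l bs)) ℚ.+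
      η ℚ.* ∑² (splitsℕ d) (λ a l → δ a ℚ.* (fromℕ l ℚ.* A l bs))
        ≡⟨ cong₂ ℚ._+_
             (trans (*-∑ (splitsℕ d) η _) (∑²-cong (splitsℕ d) λ a l → trans
               (solve 4 (λ η a δ A → η :* (a :* (δ :* A)) := a :* (η :* δ :* A)) refl η (fromℕ a) (δ a) (A l bs))
               (cong (λ x → fromℕ a ℚ.* (x ℚ.* A l bs)) (⟦≟ᵇ⟧ a))))
             remaining ⟩
      removed ℚ.+ kept ∎
      where
      remaining : η ℚ.* ∑² (splitsℕ d) (λ a l → δ a ℚ.* (fromℕ l ℚ.* A l bs)) ≡ kept
      remaining = begin
        η ℚ.* ∑² (splitsℕ d) (λ a l → δ a ℚ.* (fromℕ l ℚ.* A l bs))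
          ≡⟨ cong (η ℚ.*_) (∑²-cong (splitsℕ d) λ a l → trans
               (cong (δ a ℚ.*_) (assignments-first-row l i s bs)) (*-∑ (splitsℕ l) (δ a) _)) ⟩
        η ℚ.* ∑² (splitsℕ d) (λ a l → ∑² (splitsℕ l) (λ k m → δ a ℚ.* (fromℕ k ℚ.* delete (k , i) (A m) bs)))
          -- The brick through the marked cell, of length `k`, is now removed before `x`, of length
          -- `a`, is placed.
          ≡⟨ cong (η ℚ.*_) (∑²-splitsℕ-triple d (λ a k m → δ a ℚ.* (fromℕ k ℚ.* delete (k , i) (A m) bs))) ⟩
        η ℚ.* ∑² (splitsℕ d) (λ k l → ∑² (splitsℕ l) (λ a m → δ a ℚ.* (fromℕ k ℚ.* delete (k , i) (A m) bs)))
          ≡⟨ trans (*-∑ (splitsℕ d) η _) (∑²-cong (splitsℕ d) λ k l → begin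
               η ℚ.* ∑² (splitsℕ l) (λ a m → δ a ℚ.* (fromℕ k ℚ.* delete (k , i) (A m) bs))
                 ≡⟨ cong (η ℚ.*_) (trans (∑²-cong (splitsℕ l) λ a m → *-swapˡ (δ a) (fromℕ k) _)
                      (sym (*-∑ (splitsℕ l) (fromℕ k) _))) ⟩
               η ℚ.* (fromℕ k ℚ.* ∑² (splitsℕ l) (λ a m → δ a ℚ.* delete (k , i) (A m) bs))
                 ≡⟨ *-swapˡ η (fromℕ k) _ ⟩
               fromℕ k ℚ.* (η ℚ.* ∑² (splitsℕ l) (λ a m → δ a ℚ.* delete (k , i) (A m) bs)) ∎) ⟩
        kept ∎

    collect : ∀ k l →
      fromℕ k ℚ.* (⟦ does ((k , i) ≟ᵇ x) ⟧ ℚ.* A l bs) ℚ.+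
      (fromℕ k ℚ.* (η ℚ.* ∑² (splitsℕ l) (λ a m → δ a ℚ.* delete (k , i) (A m) bs)) ℚ.+
       fromℕ k ℚ.* place x (λ s → delete (k , i) (assignments ((l , i) ∷ s)) bs) s) ≡
      fromℕ k ℚ.* delete (k , i) (A l) (x ∷ bs)
    collect k l = begin
      fromℕ k ℚ.* (⟦ does ((k , i) ≟ᵇ x) ⟧ ℚ.* A l bs) ℚ.+
      (fromℕ k ℚ.* (η ℚ.* ∑² (splitsℕ l) (λ a m → δ a ℚ.* delete (k , i) (A m) bs)) ℚ.+
       fromℕ k ℚ.* place x (λ s → delete (k , i) (assignments ((l , i) ∷ s)) bs) s)
        ≡⟨ solve 4 (λ k x y z → k :* x :+ (k :* y :+ k :* z) := k :* (x :+ (y :+ z))) refl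
             (fromℕ k) (⟦ does ((k , i) ≟ᵇ x) ⟧ ℚ.* A l bs)
             (η ℚ.* ∑² (splitsℕ l) (λ a m → δ a ℚ.* delete (k , i) (A m) bs))
             (place x (λ s → delete (k , i) (assignments ((l , i) ∷ s)) bs) s) ⟩
      fromℕ k ℚ.* (⟦ does ((k , i) ≟ᵇ x) ⟧ ℚ.* A l bs ℚ.+
        (η ℚ.* ∑² (splitsℕ l) (λ a m → δ a ℚ.* delete (k , i) (A m) bs) ℚ.+
         place x (λ s → delete (k , i) (assignments ((l , i) ∷ s)) bs) s))
        ≡⟨ cong (λ y → fromℕ k ℚ.* (⟦ does ((k , i) ≟ᵇ x) ⟧ ℚ.* A l bs ℚ.+ y)) (trans (delete-+ (k , i) _ _ bs)
             (cong₂ ℚ._+_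
               (trans (delete-* (k , i) η _ bs) (cong (η ℚ.*_) (trans (delete-∑ (k , i) (splitsℕ l) _ bs)
                 (∑²-cong (splitsℕ l) λ a m → delete-* (k , i) (δ a) (A m) bs))))
               (delete-place (k , i) x (λ s → assignments ((l , i) ∷ s)) s bs))) ⟨
      fromℕ k ℚ.* delete (k , i) (A l) (x ∷ bs) ∎

-- Types as vectors of partitions

unique-↭ : ∀ {A : Set} {xs ys : List A} → Unique xs → Unique ys → (∀ {x} → x ∈ xs ⇔ x ∈ ys) → xs ↭ ys
unique-↭ u v eq = ∼bag⇒↭ (unique∧set⇒bag u v eq)

concat-↭ : ∀ {A : Set} {xss yss : List (List A)} → xss ↭ yss → concat xss ↭ concat yss
concat-↭ ↭.refl           = ↭.refl
concat-↭ (↭.prep xs p)    = ↭.++⁺ˡ xs (concat-↭ p)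
concat-↭ (↭.swap xs ys p) = ↭-trans (↭.shifts xs ys) (↭.++⁺ˡ ys (↭.++⁺ˡ xs (concat-↭ p)))
concat-↭ (↭.trans p q)    = ↭-trans (concat-↭ p) (concat-↭ q)

unique-extract : ∀ {A : Set} {x : A} {xs} → Unique xs → x ∈ xs → ∃ λ ys → xs ↭ x ∷ ys × x ∉ ys
unique-extract {x = x} u x∈ with ∈-∃++ x∈
... | as , bs , refl = as ++ bs , ↭.shift x as bs , x∉
  where
  u′ : Unique (x ∷ as ++ bs)
  u′ = Permutationₛ.Unique-resp-↭ (setoid _) (↭⇒↭ₛ (↭.shift x as bs)) u

  x∉ : x ∉ as ++ bs
  x∉ x∈ with u′
  ... | x≢ ∷ _ = All.lookup x≢ x∈ refl

-- A weakly decreasing list is determined by its multiset of entries, and the proofs of positivity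
-- and order are unique.
partition-≡ : ∀ (p q : Partition) → parts p ↭ parts q → p ≡ q
partition-≡ (ps , nz , ps↘) (qs , nz′ , qs↘) ps↭qs
  with refl ← Pointwise.Pointwise-≡⇒≡ (Sorted.↗↭↗⇒≋ (DecTotalOrder.totalOrder ≥-decTotalOrder) ps↘ qs↘ (↭⇒↭ₛ ps↭qs)) =
  cong (ps ,_) (isPartition-irrelevant (nz , ps↘) (nz′ , qs↘))

sortPartition : ∀ ps → All NonZero ps → Partition
sortPartition ps nz = sort ps , ↭.All-resp-↭ (↭-sym (sort-↭ ps)) nz , sort-↗ ps

insertPart : ∀ k .{{_ : NonZero k}} → Partition → Partition
insertPart (suc k) p = sortPartition (suc k ∷ parts p) (_ ∷ proj₁ (proj₂ p))

parts-insertPart : ∀ k .{{_ : NonZero k}} p → parts (insertPart k p) ↭ k ∷ parts p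
parts-insertPart (suc k) p = sort-↭ (suc k ∷ parts p)

insertPart-injective : ∀ k .{{_ : NonZero k}} {p q} → insertPart k p ≡ insertPart k q → p ≡ q
insertPart-injective k {p} {q} eq = partition-≡ p q (↭.drop-∷ (↭-trans (↭-sym (parts-insertPart k p))
  (subst (λ r → parts r ↭ k ∷ parts q) (sym eq) (parts-insertPart k q))))

insertPart-surjective : ∀ k .{{_ : NonZero k}} p → k ∈ parts p → ∃ λ q → insertPart k q ≡ p
insertPart-surjective k p@(ps , nz , _) k∈ with ∈-∃++ k∈
... | as , bs , refl = q , partition-≡ (insertPart k q) p
      (↭-trans (parts-insertPart k q) (↭-trans (↭.prep k (sort-↭ (as ++ bs))) (↭-sym (↭.shift k as bs))))
  where
  q : Partition
  q = sortPartition (as ++ bs) (All.++⁺ (All.++⁻ˡ as nz) (All.drop⁺ 1 (All.++⁻ʳ as nz)))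

multiplicity-insertPart : ∀ j k .{{_ : NonZero k}} p →
  multiplicity j (insertPart k p) ≡ length (filter (ℕ._≟ j) (k ∷ parts p))
multiplicity-insertPart j k p = ↭.↭-length (↭.filter-↭ (ℕ._≟ j) (parts-insertPart k p))

multiplicity-≡ : ∀ k .{{_ : NonZero k}} p → multiplicity k (insertPart k p) ≡ suc (multiplicity k p)
multiplicity-≡ k p = trans (multiplicity-insertPart k k p) (cong length (List.filter-accept (ℕ._≟ k) refl))

multiplicity-≢ : ∀ {j k} .{{_ : NonZero k}} p → k ≢ j → multiplicity j (insertPart k p) ≡ multiplicity j p
multiplicity-≢ {j} {k} p k≢j =
  trans (multiplicity-insertPart j k p) (cong length (List.filter-reject (ℕ._≟ j) k≢j))

size-insertPart : ∀ k .{{_ : NonZero k}} p → size (insertPart k p) ≡ k ℕ.+ size p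
size-insertPart k p = sum-↭ (parts-insertPart k p)

zFactor : Partition → ℕ → ℕ
zFactor p i = suc i ℕ.^ multiplicity (suc i) p ℕ.* multiplicity (suc i) p ℕ.!

multiplicity-large : ∀ p {j} → size p ℕ.< j → multiplicity j p ≡ 0
multiplicity-large (ps , _) {j} = none ps
  where
  none : ∀ ps → sum ps ℕ.< j → length (filter (ℕ._≟ j) ps) ≡ 0
  none []       _   = refl
  none (x ∷ ps) s<j = trans
    (cong length (List.filter-reject (ℕ._≟ j) (ℕ.<⇒≢ (ℕ.≤-<-trans (ℕ.m≤m+n x (sum ps)) s<j))))
    (none ps (ℕ.≤-<-trans (ℕ.m≤n+m (sum ps) x) s<j))

-- The range of the product in `z` grows with the size, so comparing `z` before and after an
-- insertion needs a common range. Added factors are 1, since such parts do not occur.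
z-extend : ∀ d p → product (map (zFactor p) (upTo (d ℕ.+ size p))) ≡ z p
z-extend zero    p = refl
z-extend (suc d) p = begin
  product (map (zFactor p) (upTo (suc N)))
    ≡⟨ cong (product ∘ map (zFactor p)) (List.upTo-∷ʳ N) ⟨
  product (map (zFactor p) (upTo N ++ N ∷ []))
    ≡⟨ cong product (List.map-++ (zFactor p) (upTo N) (N ∷ [])) ⟩
  product (map (zFactor p) (upTo N) ++ zFactor p N ∷ [])
    ≡⟨ product-++ (map (zFactor p) (upTo N)) (zFactor p N ∷ []) ⟩
  product (map (zFactor p) (upTo N)) ℕ.* (zFactor p N ℕ.* 1)
    ≡⟨ cong (λ m → product (map (zFactor p) (upTo N)) ℕ.* (suc N ℕ.^ m ℕ.* m ℕ.! ℕ.* 1))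
         (multiplicity-large p (ℕ.s≤s (ℕ.m≤n+m (size p) d))) ⟩
  product (map (zFactor p) (upTo N)) ℕ.* 1
    ≡⟨ ℕ.*-identityʳ _ ⟩
  product (map (zFactor p) (upTo N))
    ≡⟨ z-extend d p ⟩
  z p ∎
  where
  N : ℕ
  N = d ℕ.+ size p

map-cong-∈ : ∀ {A B : Set} {f g : A → B} xs → (∀ {x} → x ∈ xs → f x ≡ g x) → map f xs ≡ map g xs
map-cong-∈ xs eq = List.map-cong-local (All.tabulate eq)

product-extract : ∀ {A : Set} {x : A} {xs ys} (f : A → ℕ) → xs ↭ x ∷ ys →
  product (map f xs) ≡ f x ℕ.* product (map f ys)
product-extract f xs↭ = product-↭ (↭.map⁺ f xs↭)

sum-extract : ∀ {A : Set} {x : A} {xs ys} (f : A → ℕ) → xs ↭ x ∷ ys →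
  sum (map f xs) ≡ f x ℕ.+ sum (map f ys)
sum-extract f xs↭ = sum-↭ (↭.map⁺ f xs↭)

-- Only the factor for parts equal to `k`, at position `k-1`, changes: the exponent and the
-- factorial both pass from `m` to `m + 1`.
z-insertPart : ∀ k .{{_ : NonZero k}} p → z (insertPart k p) ≡ k ℕ.* suc (multiplicity k p) ℕ.* z p
z-insertPart k@(suc k-1) p = begin
  z q
    ≡⟨ cong (product ∘ map (zFactor q) ∘ upTo) (size-insertPart k p) ⟩
  product (map (zFactor q) (upTo N))
    ≡⟨ product-extract (zFactor q) perm ⟩
  zFactor q k-1 ℕ.* product (map (zFactor q) ys)
    ≡⟨ cong₂ ℕ._*_
         (cong (λ m → k ℕ.^ m ℕ.* m ℕ.!) (multiplicity-≡ k p))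
         (cong product (map-cong-∈ ys λ {j} j∈ →
           cong (λ m → suc j ℕ.^ m ℕ.* m ℕ.!) (multiplicity-≢ p λ { refl → k-1∉ j∈ }))) ⟩
  k ℕ.^ suc m ℕ.* suc m ℕ.! ℕ.* product (map (zFactor p) ys)
    ≡⟨ regroup k (k ℕ.^ m) (suc m) (m ℕ.!) (product (map (zFactor p) ys)) ⟩
  k ℕ.* suc m ℕ.* (zFactor p k-1 ℕ.* product (map (zFactor p) ys))
    ≡⟨ cong (k ℕ.* suc m ℕ.*_) (product-extract (zFactor p) perm) ⟨
  k ℕ.* suc m ℕ.* product (map (zFactor p) (upTo N))
    ≡⟨ cong (k ℕ.* suc m ℕ.*_) (z-extend k p) ⟩
  k ℕ.* suc m ℕ.* z p ∎
  where
  q : Partition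
  q = insertPart k p

  N m : ℕ
  N = k ℕ.+ size p
  m = multiplicity k p

  extraction : ∃ λ ys → upTo N ↭ k-1 ∷ ys × k-1 ∉ ys
  extraction = unique-extract (Unique.upTo⁺ N) (∈-upTo⁺ (ℕ.m≤m+n k (size p)))

  ys : List ℕ
  ys = proj₁ extraction

  perm : upTo N ↭ k-1 ∷ ys
  perm = proj₁ (proj₂ extraction)

  k-1∉ : k-1 ∉ ys
  k-1∉ = proj₂ (proj₂ extraction)

  regroup : ∀ a b c d e → a ℕ.* b ℕ.* (c ℕ.* d) ℕ.* e ≡ a ℕ.* c ℕ.* (b ℕ.* d ℕ.* e)
  regroup = solve-∀

module _ {n : ℕ} where

  -- `vectorBlocks` and `vectorZ` are `blocks` and `z⊗` freed from the condition on the weight,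
  -- which the removal of a block violates.
  vectorBlocks : Vec Partition n → List (Block n)
  vectorBlocks v = concatMap (λ i → map (_, i) (parts (lookup v i))) (allFin n)

  vectorZ : Vec Partition n → ℕ
  vectorZ v = product (map (λ i → z (lookup v i)) (allFin n))

  insertBlock : ∀ (b : Block n) .{{_ : NonZero (proj₁ b)}} → Vec Partition n → Vec Partition n
  insertBlock (k , i) v = updateAt v i (insertPart k)

  others : ∀ i → ∃ λ js → allFin n ↭ i ∷ js × i ∉ js
  others i = unique-extract (Unique.allFin⁺ n) (∈-allFin i)

  lookup-other : ∀ {k i j} .{{_ : NonZero k}} v → i ∉ proj₁ (others i) → j ∈ proj₁ (others i) →
    lookup (insertBlock (k , i) v) j ≡ lookup v j
  lookup-other {k} {i} {j} v i∉ j∈ = Vec.lookup∘updateAt′ j i (λ { refl → i∉ j∈ }) v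

  lookup-insertBlock : ∀ k i .{{_ : NonZero k}} v → lookup (insertBlock (k , i) v) i ≡ insertPart k (lookup v i)
  lookup-insertBlock k i v = Vec.lookup∘updateAt i v

  weight-insertBlock : ∀ k i .{{_ : NonZero k}} v → weight (insertBlock (k , i) v) ≡ index i ℕ.* k ℕ.+ weight v
  weight-insertBlock k i v = begin
    weight v′
      ≡⟨ sum-extract _ perm ⟩
    index i ℕ.* size (lookup v′ i) ℕ.+ sum (map (λ j → index j ℕ.* size (lookup v′ j)) js)
      ≡⟨ cong₂ ℕ._+_
           (trans (cong (λ p → index i ℕ.* size p) (lookup-insertBlock k i v))
             (trans (cong (index i ℕ.*_) (size-insertPart k (lookup v i)))
                    (ℕ.*-distribˡ-+ (index i) k (size (lookup v i)))))
           (cong sum (map-cong-∈ js λ {j} j∈ → cong (λ p → index j ℕ.* size p) (lookup-other v i∉ j∈))) ⟩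
    index i ℕ.* k ℕ.+ index i ℕ.* size (lookup v i) ℕ.+ sum (map (λ j → index j ℕ.* size (lookup v j)) js)
      ≡⟨ ℕ.+-assoc (index i ℕ.* k) _ _ ⟩
    index i ℕ.* k ℕ.+ (index i ℕ.* size (lookup v i) ℕ.+ sum (map (λ j → index j ℕ.* size (lookup v j)) js))
      ≡⟨ cong (index i ℕ.* k ℕ.+_) (sum-extract _ perm) ⟨
    index i ℕ.* k ℕ.+ weight v ∎
    where
    v′ : Vec Partition n
    v′ = insertBlock (k , i) v
    js = proj₁ (others i)
    perm = proj₁ (proj₂ (others i))
    i∉ = proj₂ (proj₂ (others i))

  vectorZ-insertBlock : ∀ k i .{{_ : NonZero k}} v →
    vectorZ (insertBlock (k , i) v) ≡ k ℕ.* suc (multiplicity k (lookup v i)) ℕ.* vectorZ v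
  vectorZ-insertBlock k i v = begin
    vectorZ v′
      ≡⟨ product-extract _ perm ⟩
    z (lookup v′ i) ℕ.* product (map (z ∘ lookup v′) js)
      ≡⟨ cong₂ ℕ._*_
           (trans (cong z (lookup-insertBlock k i v)) (z-insertPart k (lookup v i)))
           (cong product (map-cong-∈ js λ j∈ → cong z (lookup-other v i∉ j∈))) ⟩
    k ℕ.* suc (multiplicity k (lookup v i)) ℕ.* z (lookup v i) ℕ.* product (map (z ∘ lookup v) js)
      ≡⟨ ℕ.*-assoc (k ℕ.* suc (multiplicity k (lookup v i))) _ _ ⟩
    k ℕ.* suc (multiplicity k (lookup v i)) ℕ.* (z (lookup v i) ℕ.* product (map (z ∘ lookup v) js))
      ≡⟨ cong (k ℕ.* suc (multiplicity k (lookup v i)) ℕ.*_) (product-extract _ perm) ⟨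
    k ℕ.* suc (multiplicity k (lookup v i)) ℕ.* vectorZ v ∎
    where
    v′ : Vec Partition n
    v′ = insertBlock (k , i) v
    js = proj₁ (others i)
    perm = proj₁ (proj₂ (others i))
    i∉ = proj₂ (proj₂ (others i))

  vectorBlocks-extract : ∀ v i → let js = proj₁ (others i) in vectorBlocks v ↭
    map (_, i) (parts (lookup v i)) ++ concatMap (λ j → map (_, j) (parts (lookup v j))) js
  vectorBlocks-extract v i = concat-↭ (↭.map⁺ _ (proj₁ (proj₂ (others i))))

  vectorBlocks-insertBlock : ∀ k i .{{_ : NonZero k}} v →
    vectorBlocks (insertBlock (k , i) v) ↭ (k , i) ∷ vectorBlocks v
  vectorBlocks-insertBlock k i v = ↭-trans (vectorBlocks-extract v′ i) (↭-trans
    (↭.++⁺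
      (↭.map⁺ (_, i) (subst (λ p → parts p ↭ k ∷ parts (lookup v i)) (sym (lookup-insertBlock k i v))
        (parts-insertPart k (lookup v i))))
      (↭.↭-reflexive (cong concat (map-cong-∈ js λ {j} j∈ → cong (map (_, j) ∘ parts) (lookup-other v i∉ j∈)))))
    (↭.prep (k , i) (↭-sym (vectorBlocks-extract v i))))
    where
    v′ : Vec Partition n
    v′ = insertBlock (k , i) v
    js = proj₁ (others i)
    i∉ = proj₂ (proj₂ (others i))

  ∈-vectorBlocks⁻ : ∀ {k i} v → (k , i) ∈ vectorBlocks v → k ∈ parts (lookup v i)
  ∈-vectorBlocks⁻ v b∈ with find (∈-concatMap⁻ (λ i → map (_, i) (parts (lookup v i))) {xs = allFin n} b∈)
  ... | i , _ , b∈′ with ∈-map⁻ (_, i) b∈′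
  ...   | k , k∈ , refl = k∈

  ∈-vectorBlocks⁺ : ∀ v i {k} → k ∈ parts (lookup v i) → (k , i) ∈ vectorBlocks v
  ∈-vectorBlocks⁺ v i k∈ = ∈-concatMap⁺ (λ i → map (_, i) (parts (lookup v i)))
    (lose (∈-allFin i) (∈-map⁺ (_, i) k∈))

  insertBlock-injective : ∀ b .{{_ : NonZero (proj₁ b)}} {v w} → insertBlock b v ≡ insertBlock b w → v ≡ w
  insertBlock-injective (k , i) {v} {w} eq = go i v w eq
    where
    go : ∀ {m} i (v w : Vec Partition m) → updateAt v i (insertPart k) ≡ updateAt w i (insertPart k) → v ≡ w
    go Fin.zero    (p ∷ v) (q ∷ w) eq =
      cong₂ _∷_ (insertPart-injective k (Vec.∷-injectiveˡ eq)) (Vec.∷-injectiveʳ eq)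
    go (Fin.suc i) (p ∷ v) (q ∷ w) eq = cong₂ _∷_ (Vec.∷-injectiveˡ eq) (go i v w (Vec.∷-injectiveʳ eq))

  insertBlock-surjective : ∀ k i .{{_ : NonZero k}} v → (k , i) ∈ vectorBlocks v → ∃ λ w → insertBlock (k , i) w ≡ v
  insertBlock-surjective k i v b∈ with insertPart-surjective k (lookup v i) (∈-vectorBlocks⁻ v b∈)
  ... | q , eq = updateAt v i (λ _ → q) , trans
    (Vec.updateAt-updateAt-local i {g = λ _ → q} {h = λ _ → insertPart k q} v refl)
    (Vec.updateAt-id-local i v eq)

  -- Blocks of multiplicity `index i` come only from tensor factor `i`, so the other factors
  -- contribute nothing to the count.
  multiplicity≡count : ∀ k i v → fromℕ (multiplicity k (lookup v i)) ≡ count (k , i) (vectorBlocks v)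
  multiplicity≡count k i v = sym (begin
    count (k , i) (vectorBlocks v)
      ≡⟨ delete-↭ (k , i) (λ _ → refl) (vectorBlocks-extract v i) ⟩
    count (k , i) (map (_, i) (parts (lookup v i)) ++ rest)
      ≡⟨ count-++ (map (_, i) (parts (lookup v i))) ⟩
    count (k , i) (map (_, i) (parts (lookup v i))) ℚ.+ count (k , i) rest
      ≡⟨ cong₂ ℚ._+_ (count-map (parts (lookup v i))) (delete-∉ absent) ⟩
    fromℕ (multiplicity k (lookup v i)) ℚ.+ 0ℚ
      ≡⟨ ℚ.+-identityʳ _ ⟩
    fromℕ (multiplicity k (lookup v i)) ∎)
    where
    js = proj₁ (others i)

    rest : List (Block n)
    rest = concatMap (λ j → map (_, j) (parts (lookup v j))) js

    absent : (k , i) ∉ rest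
    absent b∈ with find (∈-concatMap⁻ (λ j → map (_, j) (parts (lookup v j))) {xs = js} b∈)
    ... | j , j∈ , b∈′ with ∈-map⁻ (_, j) b∈′
    ...   | _ , _ , refl = proj₂ (proj₂ (others i)) j∈

    count-++ : ∀ {b : Block n} xs {ys} → count b (xs ++ ys) ≡ count b xs ℚ.+ count b ys
    count-++     []       = sym (ℚ.+-identityˡ _)
    count-++ {b} (x ∷ xs) = trans (cong (⟦ does (b ≟ᵇ x) ⟧ ℚ.* 1ℚ ℚ.+_) (count-++ xs))
      (sym (ℚ.+-assoc (⟦ does (b ≟ᵇ x) ⟧ ℚ.* 1ℚ) _ _))

    count-map : ∀ ps → count (k , i) (map (_, i) ps) ≡ fromℕ (length (filter (ℕ._≟ k) ps))
    count-map []       = refl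
    count-map (x ∷ ps) = go (x ℕ.≟ k)
      where
      go : Dec (x ≡ k) → count (k , i) (map (_, i) (x ∷ ps)) ≡ fromℕ (length (filter (ℕ._≟ k) (x ∷ ps)))
      go (yes refl) = trans
        (cong₂ (λ b y → ⟦ b ⟧ ℚ.* 1ℚ ℚ.+ y) (dec-true ((k , i) ≟ᵇ (x , i)) refl) (count-map ps))
        (trans (sym (fromℕ-+ 1 (length (filter (ℕ._≟ k) ps))))
               (cong (fromℕ ∘ length) (sym (List.filter-accept (ℕ._≟ k) refl))))
      go (no x≢k)   = trans
        (cong₂ (λ b y → ⟦ b ⟧ ℚ.* 1ℚ ℚ.+ y) (dec-false ((k , i) ≟ᵇ (x , i)) (λ { refl → x≢k refl })) (count-map ps))
        (trans (ℚ.+-identityˡ _) (cong (fromℕ ∘ length) (sym (List.filter-reject (ℕ._≟ k) x≢k))))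

  -- The types of w, with n tensor factors.
  vectors : ℕ → List (Vec Partition n)
  vectors w = filter (λ v → weight v ℕ.≟ w) (tuples (boundedPartitions n) n)

  vectors-unique : ∀ w → Unique (vectors w)
  vectors-unique w = Unique.filter⁺ (λ v → weight v ℕ.≟ w) (tuples-unique (boundedPartitions-unique n) n)

  ∈-vectors⁻ : ∀ {v w} → v ∈ vectors w → weight v ≡ w
  ∈-vectors⁻ {w = w} v∈ = proj₂ (∈-filter⁻ (λ v → weight v ℕ.≟ w) {xs = tuples (boundedPartitions n) n} v∈)

  -- The bound keeps every entry of `v` among `boundedPartitions n`; this is why bounds by `n`
  -- accompany the recursion below.
  ∈-vectors⁺ : ∀ {v} → weight v ℕ.≤ n → v ∈ vectors (weight v)
  ∈-vectors⁺ {v} w≤n = ∈-filter⁺ (λ u → weight u ℕ.≟ weight v)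
    (∈-tuples v λ i → ∈-boundedPartitions (lookup v i) (ℕ.≤-trans (size≤weight i) w≤n)) refl
    where
    size≤weight : ∀ i → size (lookup v i) ℕ.≤ weight v
    size≤weight i = ℕ.≤-trans (ℕ.m≤n*m (size (lookup v i)) (index i)) (ℕ.≤-trans (ℕ.m≤m+n _ _)
      (ℕ.≤-reflexive (sym (sum-extract _ (proj₁ (proj₂ (others i)))))))

  -- Insertion of the block is a bijection from the types of `w` onto those types of the larger
  -- weight that contain it, and `Y` vanishes on the rest.
  ∑-insertBlock : ∀ k i .{{_ : NonZero k}} w → index i ℕ.* k ℕ.+ w ℕ.≤ n → (Y : Vec Partition n → ℚ) →
    (∀ v → (k , i) ∉ vectorBlocks v → Y v ≡ 0ℚ) →
    ∑ (vectors (index i ℕ.* k ℕ.+ w)) Y ≡ ∑ (vectors w) (Y ∘ insertBlock (k , i))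
  ∑-insertBlock k i w ≤n Y vanish = begin
    ∑ (vectors w′) Y
      ≡⟨ ∑-cong (vectors w′) restrict ⟩
    ∑ (vectors w′) (λ v → ⟦ does (b∈? v) ⟧ ℚ.* Y v)
      ≡⟨ ∑-filter b∈? (vectors w′) Y ⟨
    ∑ (filter b∈? (vectors w′)) Y
      ≡⟨ ∑-↭ Y (unique-↭ (Unique.filter⁺ b∈? (vectors-unique w′))
           (Unique.map⁺ (insertBlock-injective (k , i)) (vectors-unique w)) (mk⇔ to from)) ⟩
    ∑ (map (insertBlock (k , i)) (vectors w)) Y
      ≡⟨ ∑-map (insertBlock (k , i)) (vectors w) Y ⟩
    ∑ (vectors w) (Y ∘ insertBlock (k , i)) ∎
    where
    open DecMembership (_≟ᵇ_ {n}) using (_∈?_)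

    w′ : ℕ
    w′ = index i ℕ.* k ℕ.+ w

    b∈? : ∀ v → Dec ((k , i) ∈ vectorBlocks v)
    b∈? v = (k , i) ∈? vectorBlocks v

    restrict : ∀ v → Y v ≡ ⟦ does (b∈? v) ⟧ ℚ.* Y v
    restrict v with b∈? v
    ... | yes _  = sym (ℚ.*-identityˡ (Y v))
    ... | no  b∉ = trans (vanish v b∉) (sym (ℚ.*-zeroˡ (Y v)))

    to : ∀ {v} → v ∈ filter b∈? (vectors w′) → v ∈ map (insertBlock (k , i)) (vectors w)
    to {v} v∈ with ∈-filter⁻ b∈? {xs = vectors w′} v∈
    ... | v∈w′ , b∈ with insertBlock-surjective k i v b∈
    ...   | u , refl = ∈-map⁺ (insertBlock (k , i)) (subst (λ x → u ∈ vectors x) weight-u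
              (∈-vectors⁺ (ℕ.≤-trans (ℕ.≤-reflexive weight-u) (ℕ.≤-trans (ℕ.m≤n+m w (index i ℕ.* k)) ≤n))))
      where
      weight-u : weight u ≡ w
      weight-u = ℕ.+-cancelˡ-≡ (index i ℕ.* k) (weight u) w
        (trans (sym (weight-insertBlock k i u)) (∈-vectors⁻ v∈w′))

    from : ∀ {v} → v ∈ map (insertBlock (k , i)) (vectors w) → v ∈ filter b∈? (vectors w′)
    from v∈ with ∈-map⁻ (insertBlock (k , i)) v∈
    ... | u , u∈ , refl = ∈-filter⁺ b∈?
      (subst (λ x → insertBlock (k , i) u ∈ vectors x) weight-v
        (∈-vectors⁺ (ℕ.≤-trans (ℕ.≤-reflexive weight-v) ≤n)))
      (↭.∈-resp-↭ (↭-sym (vectorBlocks-insertBlock k i u)) (here refl))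
      where
      weight-v : weight (insertBlock (k , i) u) ≡ w′
      weight-v = trans (weight-insertBlock k i u) (cong (index i ℕ.* k ℕ.+_) (∈-vectors⁻ u∈))

-- Expansions in the products of power sums

reciprocal : ∀ d .{{_ : NonZero d}} → ℚ
reciprocal d = + 1 ℚ./ d

/≡*-reciprocal : ∀ a d .{{_ : NonZero d}} → a ℚ./ d ≡ fromℤ a ℚ.* reciprocal d
/≡*-reciprocal a (suc d) = ℚ.toℚᵘ-injective (ℚᵘ.≃-trans (ℚ.toℚᵘ-fromℚᵘ (ℚᵘ.mkℚᵘ a d)) (ℚᵘ.≃-sym
  (ℚᵘ.≃-trans (ℚ.toℚᵘ-homo-* (fromℤ a) (reciprocal (suc d)))
    (ℚᵘ.≃-trans (ℚᵘ.*-cong (ℚ.toℚᵘ-fromℚᵘ (ℚᵘ.mkℚᵘ a 0)) (ℚ.toℚᵘ-fromℚᵘ (ℚᵘ.mkℚᵘ (+ 1) d)))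
      (ℚᵘ.*≡* (cong₂ ℤ._*_ (ℤ.*-identityʳ a) (cong +_ (sym (ℕ.+-identityʳ (suc d))))))))))

fromℕ-reciprocal : ∀ d .{{_ : NonZero d}} → fromℕ d ℚ.* reciprocal d ≡ 1ℚ
fromℕ-reciprocal (suc d) = trans (sym (/≡*-reciprocal (+ suc d) (suc d)))
  (ℚ.toℚᵘ-injective (ℚᵘ.≃-trans (ℚ.toℚᵘ-fromℚᵘ (ℚᵘ.mkℚᵘ (+ suc d) d)) (ℚᵘ.*≡* (ℤ.*-comm (+ suc d) (+ 1)))))

∏ : ∀ {n} → (Block n → Series) → List (Block n) → Series
∏ F bs = foldr _⊛_ 𝟙 (map F bs)

∏-↭ : ∀ {n} (F : Block n → Series) {bs cs} → bs ↭ cs → ∏ F bs ≈ ∏ F cs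
∏-↭ F ↭.refl         f = refl
∏-↭ F (↭.prep b p)   f = ⊛-cong {F = F b} (λ _ → refl) (∏-↭ F p) f
∏-↭ F (↭.swap {xs} {ys} b c p) f = begin
  (F b ⊛ (F c ⊛ ∏ F xs)) f   ≡⟨ ⊛-assoc (F b) (F c) (∏ F xs) f ⟨
  ((F b ⊛ F c) ⊛ ∏ F xs) f   ≡⟨ ⊛-cong (⊛-comm (F b) (F c)) (∏-↭ F p) f ⟩
  ((F c ⊛ F b) ⊛ ∏ F ys) f   ≡⟨ ⊛-assoc (F c) (F b) (∏ F ys) f ⟩
  (F c ⊛ (F b ⊛ ∏ F ys)) f   ∎
∏-↭ F (↭.trans p q)  f = trans (∏-↭ F p f) (∏-↭ F q f)

0-⊛ : ∀ {F} G → (∀ f → F f ≡ 0ℚ) → ∀ f → (F ⊛ G) f ≡ 0ℚ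
0-⊛ {F} G F≡0 f = trans (⊛-def F G f) (trans
  (∑²-cong (splits f) λ g h → trans (cong (ℚ._* G h) (F≡0 g)) (ℚ.*-zeroˡ (G h))) (∑-0 (splits f)))

emptyPartition : Partition
emptyPartition = [] , [] , Linked.[]

module _ {n : ℕ} where

  blocksWeight : List (Block n) → ℕ
  blocksWeight bs = sum (map (λ (d , i) → index i ℕ.* d) bs)

  vectorZ≢0 : ∀ (v : Vec Partition n) → NonZero (vectorZ v)
  vectorZ≢0 v = product≢0 (All.map⁺ (All.universal (λ i → z≢0 (lookup v i)) (allFin n)))

  recipZ : Vec Partition n → ℚ
  recipZ v = reciprocal (vectorZ v) {{vectorZ≢0 v}}

  -- The relation between `z` of a type and of the type with one block removed, in terms of
  -- reciprocals; `1 + count` is the number of copies after the insertion.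
  recipZ-insertBlock : ∀ k i .{{_ : NonZero k}} v →
    fromℕ k ℚ.* (1ℚ ℚ.+ count (k , i) (vectorBlocks v)) ℚ.* recipZ (insertBlock (k , i) v) ≡ recipZ v
  recipZ-insertBlock k i v = begin
    c ℚ.* r′                    ≡⟨ ℚ.*-identityʳ (c ℚ.* r′) ⟨
    c ℚ.* r′ ℚ.* 1ℚ             ≡⟨ cong (c ℚ.* r′ ℚ.*_) (fromℕ-reciprocal (vectorZ v) {{vectorZ≢0 v}}) ⟨
    c ℚ.* r′ ℚ.* (ζ ℚ.* r)      ≡⟨ solve 4 (λ c r′ ζ r → c :* r′ :* (ζ :* r) := c :* ζ :* r′ :* r) refl c r′ ζ r ⟩
    c ℚ.* ζ ℚ.* r′ ℚ.* r        ≡⟨ cong (λ x → x ℚ.* r′ ℚ.* r) ζ′≡ ⟨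
    ζ′ ℚ.* r′ ℚ.* r             ≡⟨ cong (ℚ._* r) (fromℕ-reciprocal (vectorZ v′) {{vectorZ≢0 v′}}) ⟩
    1ℚ ℚ.* r                    ≡⟨ ℚ.*-identityˡ r ⟩
    r                           ∎
    where
    v′ : Vec Partition n
    v′ = insertBlock (k , i) v

    c r r′ ζ ζ′ : ℚ
    c  = fromℕ k ℚ.* (1ℚ ℚ.+ count (k , i) (vectorBlocks v))
    r  = recipZ v
    r′ = recipZ v′
    ζ  = fromℕ (vectorZ v)
    ζ′ = fromℕ (vectorZ v′)

    ζ′≡ : ζ′ ≡ c ℚ.* ζ
    ζ′≡ = begin
      fromℕ (vectorZ v′)
        ≡⟨ cong fromℕ (vectorZ-insertBlock k i v) ⟩
      fromℕ (k ℕ.* suc (multiplicity k (lookup v i)) ℕ.* vectorZ v)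
        ≡⟨ trans (fromℕ-* (k ℕ.* suc (multiplicity k (lookup v i))) (vectorZ v)) (cong (ℚ._* ζ)
             (trans (fromℕ-* k (suc (multiplicity k (lookup v i)))) (cong (fromℕ k ℚ.*_)
               (trans (fromℕ-+ 1 (multiplicity k (lookup v i))) (cong (1ℚ ℚ.+_) (multiplicity≡count k i v)))))) ⟩
      c ℚ.* ζ ∎

  vectorBlocks-positive : ∀ v → All (NonZero ∘ proj₁) (vectorBlocks v)
  vectorBlocks-positive v = All.concat⁺ (All.map⁺ (All.universal
    (λ i → All.map⁺ (proj₁ (proj₂ (lookup v i)))) (allFin n)))

  blocksWeight-vectorBlocks : ∀ v → blocksWeight (vectorBlocks v) ≡ weight v
  blocksWeight-vectorBlocks v = go (allFin n)
    where
    row : ∀ i ps → blocksWeight (map (_, i) ps) ≡ index i ℕ.* sum ps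
    row i []       = sym (ℕ.*-zeroʳ (index i))
    row i (p ∷ ps) = trans (cong (index i ℕ.* p ℕ.+_) (row i ps)) (sym (ℕ.*-distribˡ-+ (index i) p (sum ps)))

    blocksWeight-++ : ∀ bs cs → blocksWeight (bs ++ cs) ≡ blocksWeight bs ℕ.+ blocksWeight cs
    blocksWeight-++ bs cs = trans (cong sum (List.map-++ _ bs cs)) (sum-++ (map _ bs) _)

    go : ∀ is → blocksWeight (concatMap (λ i → map (_, i) (parts (lookup v i))) is) ≡
                sum (map (λ i → index i ℕ.* size (lookup v i)) is)
    go []       = refl
    go (i ∷ is) = trans (blocksWeight-++ (map (_, i) (parts (lookup v i))) _)
      (cong₂ ℕ._+_ (row i (parts (lookup v i))) (go is))

  emptyVector : Vec Partition n
  emptyVector = replicate n emptyPartition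

  vectorBlocks-empty : ∀ v → weight v ≡ 0 → vectorBlocks v ≡ []
  vectorBlocks-empty v w≡0 = empty (vectorBlocks-positive v) (trans (blocksWeight-vectorBlocks v) w≡0)
    where
    empty : ∀ {bs} → All (NonZero ∘ proj₁) bs → blocksWeight bs ≡ 0 → bs ≡ []
    empty []                          _ = refl
    empty {(suc _ , i) ∷ _} (_ ∷ _)   ()

  weight-empty : weight emptyVector ≡ 0
  weight-empty = zeros (allFin n)
    where
    zeros : ∀ is → sum (map (λ i → index i ℕ.* size (lookup emptyVector i)) is) ≡ 0
    zeros []       = refl
    zeros (i ∷ is) = cong₂ ℕ._+_
      (trans (cong (λ p → index i ℕ.* size p) (Vec.lookup-replicate i emptyPartition)) (ℕ.*-zeroʳ (index i)))
      (zeros is)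

  vectors-0 : vectors 0 ↭ emptyVector ∷ []
  vectors-0 = unique-↭ (vectors-unique 0) ([] ∷ []) (mk⇔ to from)
    where
    to : ∀ {v} → v ∈ vectors 0 → v ∈ emptyVector ∷ []
    to {v} v∈ = here (Extensional.Pointwise-≡⇒≡ (Extensional.ext λ i → partition-≡ (lookup v i) (lookup emptyVector i)
      (subst (parts (lookup v i) ↭_) (cong parts (sym (Vec.lookup-replicate i emptyPartition))) (↭.↭-reflexive (noParts i)))))
      where
      noParts : ∀ i → parts (lookup v i) ≡ []
      noParts i with parts (lookup v i) | (λ {k} → ∈-vectorBlocks⁺ v i {k})
      ... | []     | _   = refl
      ... | k ∷ ks | mem with subst ((k , i) ∈_) (vectorBlocks-empty v (∈-vectors⁻ v∈)) (mem (here refl))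
      ...   | ()

    from : ∀ {v} → v ∈ emptyVector ∷ [] → v ∈ vectors 0
    from (here refl) = subst (λ w → emptyVector ∈ vectors w) weight-empty
      (∈-vectors⁺ (subst (ℕ._≤ n) (sym weight-empty) ℕ.z≤n))

  -- No brick of positive length fits into an exhausted row, which the recursion keeps in the list.
  assignments-zero-row : ∀ i s {bs : List (Block n)} → All (NonZero ∘ proj₁) bs →
    assignments ((0 , i) ∷ s) bs ≡ assignments s bs
  assignments-zero-row i s []                              = refl
  assignments-zero-row i s {(suc k , j) ∷ bs} (_ ∷ nz) = begin
    ⟦≟⟧ j i ℚ.* ∑² (splitsℕ 0) (λ a l → ⟦ does (suc k ℕ.≟ a) ⟧ ℚ.* assignments ((l , i) ∷ s) bs)
      ℚ.+ place (suc k , j) (λ s → assignments ((0 , i) ∷ s) bs) s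
      ≡⟨ cong₂ ℚ._+_
           (trans (cong (⟦≟⟧ j i ℚ.*_) (trans (∑²-splitsℕ-0 _) (ℚ.*-zeroˡ (assignments ((0 , i) ∷ s) bs))))
                  (ℚ.*-zeroʳ (⟦≟⟧ j i)))
           (place-cong (suc k , j) (λ s → assignments-zero-row i s nz) s) ⟩
    0ℚ ℚ.+ assignments s ((suc k , j) ∷ bs)
      ≡⟨ ℚ.+-identityˡ _ ⟩
    assignments s ((suc k , j) ∷ bs) ∎

  -- All that is used about H and E: `Q` will be the power sums with their sign, and `G` obeys
  -- Newton's identity with respect to `Q`.
  module Expansion (Q G : Block n → Series)
    (Q-0 : ∀ i f → Q (0 , i) f ≡ 0ℚ) (G-0 : ∀ i → G (0 , i) ≈ 𝟙)
    (newton : ∀ d i f → ∑² (splitsℕ d) (λ k l → (Q (k , i) ⊛ G (l , i)) f) ≡ fromℕ d ℚ.* G (d , i) f)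
    where

    -- The claimed expansion for an arbitrary list `s` of rows, with the sum over the types of `w`;
    -- the sign is contained in `Q`.
    R : ℕ → List (Block n) → Series
    R w s f = ∑ (vectors w) (λ v →
      assignments s (vectorBlocks v) ℚ.* recipZ v ℚ.* ∏ Q (vectorBlocks v) f)

    -- The types containing the brick are written as insertions into types of `w′`. The brick length
    -- and the number of equal bricks turn the reciprocal of one `z`-value into that of the other,
    -- and `Q (k , i)` splits off the product.
    R-brick : ∀ k l i s w′ .{{_ : NonZero k}} → index i ℕ.* k ℕ.+ w′ ℕ.≤ n → ∀ f →
      ∑ (vectors (index i ℕ.* k ℕ.+ w′)) (λ v →
        fromℕ k ℚ.* delete (k , i) (assignments ((l , i) ∷ s)) (vectorBlocks v) ℚ.* recipZ v
          ℚ.* ∏ Q (vectorBlocks v) f) ≡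
      (Q (k , i) ⊛ R w′ ((l , i) ∷ s)) f
    R-brick k l i s w′ ≤n f = begin
      ∑ (vectors (index i ℕ.* k ℕ.+ w′)) Y
        ≡⟨ ∑-insertBlock k i w′ ≤n Y vanish ⟩
      ∑ (vectors w′) (Y ∘ insertBlock (k , i))
        ≡⟨ ∑-cong (vectors w′) inserted ⟩
      ∑ (vectors w′) (λ v → (Q (k , i) ⊛ ((A (vectorBlocks v) ℚ.* recipZ v) • ∏ Q (vectorBlocks v))) f)
        ≡⟨ ⊛-∑ (Q (k , i)) (vectors w′) _ f ⟨
      (Q (k , i) ⊛ R w′ ((l , i) ∷ s)) f ∎
      where
      A : List (Block n) → ℚ
      A = assignments ((l , i) ∷ s)

      Y : Vec Partition n → ℚ
      Y v = fromℕ k ℚ.* delete (k , i) A (vectorBlocks v) ℚ.* recipZ v ℚ.* ∏ Q (vectorBlocks v) f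

      vanish : ∀ v → (k , i) ∉ vectorBlocks v → Y v ≡ 0ℚ
      vanish v b∉ = trans (cong (λ x → fromℕ k ℚ.* x ℚ.* recipZ v ℚ.* ∏ Q (vectorBlocks v) f) (delete-∉ b∉))
        (solve 3 (λ k r p → k :* con 0ℚ :* r :* p := con 0ℚ) refl (fromℕ k) (recipZ v) (∏ Q (vectorBlocks v) f))

      inserted : ∀ v → Y (insertBlock (k , i) v) ≡
        (Q (k , i) ⊛ ((A (vectorBlocks v) ℚ.* recipZ v) • ∏ Q (vectorBlocks v))) f
      inserted v = begin
        fromℕ k ℚ.* delete (k , i) A (vectorBlocks v′) ℚ.* recipZ v′ ℚ.* ∏ Q (vectorBlocks v′) f
          ≡⟨ cong₂ (λ x y → fromℕ k ℚ.* x ℚ.* recipZ v′ ℚ.* y)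
               (trans (delete-↭ (k , i) (assignments-↭ ((l , i) ∷ s)) (vectorBlocks-insertBlock k i v))
                      (delete-∷ (k , i) (assignments-↭ ((l , i) ∷ s)) (vectorBlocks v)))
               (∏-↭ Q (vectorBlocks-insertBlock k i v) f) ⟩
        fromℕ k ℚ.* ((1ℚ ℚ.+ count (k , i) (vectorBlocks v)) ℚ.* A (vectorBlocks v)) ℚ.* recipZ v′ ℚ.* X
          ≡⟨ solve 5 (λ k c a r x → k :* (c :* a) :* r :* x := a :* (k :* c :* r) :* x) refl
               (fromℕ k) (1ℚ ℚ.+ count (k , i) (vectorBlocks v)) (A (vectorBlocks v)) (recipZ v′) X ⟩
        A (vectorBlocks v) ℚ.* (fromℕ k ℚ.* (1ℚ ℚ.+ count (k , i) (vectorBlocks v)) ℚ.* recipZ v′) ℚ.* X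
          ≡⟨ cong (λ x → A (vectorBlocks v) ℚ.* x ℚ.* X) (recipZ-insertBlock k i v) ⟩
        A (vectorBlocks v) ℚ.* recipZ v ℚ.* X
          ≡⟨ ⊛-• (A (vectorBlocks v) ℚ.* recipZ v) (Q (k , i)) (∏ Q (vectorBlocks v)) f ⟨
        (Q (k , i) ⊛ ((A (vectorBlocks v) ℚ.* recipZ v) • ∏ Q (vectorBlocks v))) f ∎
        where
        v′ : Vec Partition n
        v′ = insertBlock (k , i) v

        X : ℚ
        X = (Q (k , i) ⊛ ∏ Q (vectorBlocks v)) f

    R-newton : ∀ d i s → blocksWeight ((d , i) ∷ s) ℕ.≤ n → ∀ f →
      fromℕ d ℚ.* R (blocksWeight ((d , i) ∷ s)) ((d , i) ∷ s) f ≡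
      ∑² (splitsℕ d) (λ k l → (Q (k , i) ⊛ R (blocksWeight ((l , i) ∷ s)) ((l , i) ∷ s)) f)
    R-newton d i s ≤n f = begin
      fromℕ d ℚ.* R w ((d , i) ∷ s) f
        ≡⟨ trans (*-∑ (vectors w) (fromℕ d) _) (∑-cong (vectors w) λ v → trans
             (solve 4 (λ d a r p → d :* (a :* r :* p) := d :* a :* (r :* p)) refl
               (fromℕ d) (assignments ((d , i) ∷ s) (vectorBlocks v)) (recipZ v) (∏ Q (vectorBlocks v) f))
             (trans (cong (ℚ._* (recipZ v ℚ.* ∏ Q (vectorBlocks v) f)) (assignments-first-row d i s (vectorBlocks v)))
               (trans (∑-* (splitsℕ d) _ _) (∑²-cong (splitsℕ d) λ k l → sym (ℚ.*-assoc
                   (fromℕ k ℚ.* delete (k , i) (assignments ((l , i) ∷ s)) (vectorBlocks v)) (recipZ v) (∏ Q (vectorBlocks v) f)))))) ⟩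
      ∑ (vectors w) (λ v → ∑² (splitsℕ d) (λ k l → term k l v))
        ≡⟨ ∑-swap (vectors w) (splitsℕ d) _ ⟩
      ∑² (splitsℕ d) (λ k l → ∑ (vectors w) (term k l))
        ≡⟨ ∑²-splitsℕ-cong d byLength ⟩
      ∑² (splitsℕ d) (λ k l → (Q (k , i) ⊛ R (blocksWeight ((l , i) ∷ s)) ((l , i) ∷ s)) f) ∎
      where
      w : ℕ
      w = blocksWeight ((d , i) ∷ s)

      term : ℕ → ℕ → Vec Partition n → ℚ
      term k l v = fromℕ k ℚ.* delete (k , i) (assignments ((l , i) ∷ s)) (vectorBlocks v) ℚ.* recipZ v
        ℚ.* ∏ Q (vectorBlocks v) f

      byLength : ∀ k l → k ℕ.+ l ≡ d →
        ∑ (vectors w) (term k l) ≡ (Q (k , i) ⊛ R (blocksWeight ((l , i) ∷ s)) ((l , i) ∷ s)) f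
      -- On the left the factor `k = 0` kills the term, on the right `Q-0`; thus `R-brick` only has
      -- to treat nonempty bricks.
      byLength zero l _ = trans
        (trans
          (∑-cong (vectors w) λ v → solve 3 (λ x r p → con 0ℚ :* x :* r :* p := con 0ℚ) refl
            (delete (0 , i) (assignments ((l , i) ∷ s)) (vectorBlocks v)) (recipZ v) (∏ Q (vectorBlocks v) f))
          (∑-0 (vectors w)))
        (sym (0-⊛ (R (blocksWeight ((l , i) ∷ s)) ((l , i) ∷ s)) (Q-0 i) f))
      byLength k@(suc _) l refl = trans
        (cong (λ w → ∑ (vectors w) (term k l)) w≡)
        (R-brick k l i s (blocksWeight ((l , i) ∷ s)) (subst (ℕ._≤ n) w≡ ≤n) f)
        where
        w≡ : w ≡ index i ℕ.* k ℕ.+ blocksWeight ((l , i) ∷ s)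
        w≡ = trans (cong (ℕ._+ blocksWeight s) (ℕ.*-distribˡ-+ (index i) k l)) (ℕ.+-assoc (index i ℕ.* k) _ _)

    -- Both sides obey the same recursion in the length `d` of the first row. Strong induction on
    -- `d` inside the induction on `s`: an empty row is dropped, and for `d > 0` the recursion is
    -- divided by `d`.
    R≈∏ : ∀ s → blocksWeight s ℕ.≤ n → R (blocksWeight s) s ≈ ∏ G s
    R≈∏ [] _ f = begin
      R 0 [] f
        ≡⟨ trans (∑-↭ _ vectors-0) (∑-singleton emptyVector _) ⟩
      assignments [] (vectorBlocks emptyVector) ℚ.* recipZ emptyVector ℚ.* ∏ Q (vectorBlocks emptyVector) f
        ≡⟨ cong (λ bs → assignments [] bs ℚ.* recipZ emptyVector ℚ.* ∏ Q bs f) (vectorBlocks-empty emptyVector weight-empty) ⟩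
      1ℚ ℚ.* recipZ emptyVector ℚ.* 𝟙 f
        ≡⟨ cong (λ x → 1ℚ ℚ.* x ℚ.* 𝟙 f) recipZ-empty ⟩
      1ℚ ℚ.* 1ℚ ℚ.* 𝟙 f
        ≡⟨ ℚ.*-identityˡ (𝟙 f) ⟩
      𝟙 f ∎
      where
      vectorZ-empty : vectorZ emptyVector ≡ 1
      vectorZ-empty = ones (allFin n)
        where
        ones : ∀ is → product (map (λ i → z (lookup emptyVector i)) is) ≡ 1
        ones []       = refl
        ones (i ∷ is) = cong₂ ℕ._*_ (cong z (Vec.lookup-replicate i emptyPartition)) (ones is)

      recipZ-empty : recipZ emptyVector ≡ 1ℚ
      recipZ-empty = begin
        recipZ emptyVector                                      ≡⟨ ℚ.*-identityˡ _ ⟨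
        1ℚ ℚ.* recipZ emptyVector                               ≡⟨ cong (λ m → fromℕ m ℚ.* recipZ emptyVector) vectorZ-empty ⟨
        fromℕ (vectorZ emptyVector) ℚ.* recipZ emptyVector      ≡⟨ fromℕ-reciprocal (vectorZ emptyVector) {{vectorZ≢0 emptyVector}} ⟩
        1ℚ                                                      ∎
    R≈∏ ((d , i) ∷ s) = <-rec Goal step d
      where
      Goal : ℕ → Set
      Goal d = blocksWeight ((d , i) ∷ s) ℕ.≤ n → R (blocksWeight ((d , i) ∷ s)) ((d , i) ∷ s) ≈ ∏ G ((d , i) ∷ s)

      step : ∀ d → (∀ {l} → l ℕ.< d → Goal l) → Goal d
      step zero _ ≤n f = begin
        R (index i ℕ.* 0 ℕ.+ blocksWeight s) ((0 , i) ∷ s) f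
          ≡⟨ cong (λ w → R w ((0 , i) ∷ s) f) w≡ ⟩
        R (blocksWeight s) ((0 , i) ∷ s) f
          ≡⟨ ∑-cong (vectors (blocksWeight s)) (λ v → cong (λ a → a ℚ.* recipZ v ℚ.* ∏ Q (vectorBlocks v) f)
               (assignments-zero-row i s (vectorBlocks-positive v))) ⟩
        R (blocksWeight s) s f
          ≡⟨ R≈∏ s (subst (ℕ._≤ n) w≡ ≤n) f ⟩
        ∏ G s f
          ≡⟨ ⊛-identityˡ (∏ G s) f ⟨
        (𝟙 ⊛ ∏ G s) f
          ≡⟨ ⊛-cong {G = ∏ G s} (G-0 i) (λ _ → refl) f ⟨
        ∏ G ((0 , i) ∷ s) f ∎
        where
        w≡ : index i ℕ.* 0 ℕ.+ blocksWeight s ≡ blocksWeight s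
        w≡ = cong (ℕ._+ blocksWeight s) (ℕ.*-zeroʳ (index i))
      step d@(suc _) rec ≤n f = begin
        R w ((d , i) ∷ s) f
          ≡⟨ cancel (R w ((d , i) ∷ s) f) ⟨
        reciprocal d ℚ.* (fromℕ d ℚ.* R w ((d , i) ∷ s) f)
          ≡⟨ cong (reciprocal d ℚ.*_) scaled ⟩
        reciprocal d ℚ.* (fromℕ d ℚ.* ∏ G ((d , i) ∷ s) f)
          ≡⟨ cancel (∏ G ((d , i) ∷ s) f) ⟩
        ∏ G ((d , i) ∷ s) f ∎
        where
        w : ℕ
        w = blocksWeight ((d , i) ∷ s)

        cancel : ∀ x → reciprocal d ℚ.* (fromℕ d ℚ.* x) ≡ x
        cancel x = begin
          reciprocal d ℚ.* (fromℕ d ℚ.* x)   ≡⟨ solve 3 (λ r d x → r :* (d :* x) := d :* r :* x) refl (reciprocal d) (fromℕ d) x ⟩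
          fromℕ d ℚ.* reciprocal d ℚ.* x     ≡⟨ cong (ℚ._* x) (fromℕ-reciprocal d) ⟩
          1ℚ ℚ.* x                           ≡⟨ ℚ.*-identityˡ x ⟩
          x                                  ∎

        shorter : ∀ k l → k ℕ.+ l ≡ d →
          (Q (k , i) ⊛ R (blocksWeight ((l , i) ∷ s)) ((l , i) ∷ s)) f ≡
          ((Q (k , i) ⊛ G (l , i)) ⊛ ∏ G s) f
        -- Here `l = d`, outside the reach of the induction hypothesis; both sides vanish through
        -- `Q-0`.
        shorter zero l _ = trans
          (0-⊛ (R (blocksWeight ((l , i) ∷ s)) ((l , i) ∷ s)) (Q-0 i) f)
          (sym (0-⊛ (∏ G s) (0-⊛ (G (l , i)) (Q-0 i)) f))
        shorter k@(suc k-1) l k+l≡d = trans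
          (⊛-cong {F = Q (k , i)} (λ _ → refl) (rec l<d (ℕ.≤-trans
            (ℕ.+-monoˡ-≤ (blocksWeight s) (ℕ.*-monoʳ-≤ (index i) (ℕ.<⇒≤ l<d))) ≤n)) f)
          (sym (⊛-assoc (Q (k , i)) (G (l , i)) (∏ G s) f))
          where
          l<d : l ℕ.< d
          l<d = ℕ.≤-trans (ℕ.s≤s (ℕ.m≤n+m l k-1)) (ℕ.≤-reflexive k+l≡d)

        scaled : fromℕ d ℚ.* R w ((d , i) ∷ s) f ≡ fromℕ d ℚ.* ∏ G ((d , i) ∷ s) f
        scaled = begin
          fromℕ d ℚ.* R w ((d , i) ∷ s) f
            ≡⟨ R-newton d i s ≤n f ⟩
          ∑² (splitsℕ d) (λ k l → (Q (k , i) ⊛ R (blocksWeight ((l , i) ∷ s)) ((l , i) ∷ s)) f)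
            ≡⟨ ∑²-splitsℕ-cong d shorter ⟩
          ∑² (splitsℕ d) (λ k l → ((Q (k , i) ⊛ G (l , i)) ⊛ ∏ G s) f)
            -- The common factor is moved to the left because linearity of `⊛` is available in its
            -- second argument.
            ≡⟨ trans (⊛-∑ (∏ G s) (splitsℕ d) (λ (k , l) → Q (k , i) ⊛ G (l , i)) f)
                 (∑²-cong (splitsℕ d) λ k l → ⊛-comm (∏ G s) (Q (k , i) ⊛ G (l , i)) f) ⟨
          (∏ G s ⊛ (λ g → ∑² (splitsℕ d) (λ k l → (Q (k , i) ⊛ G (l , i)) g))) f
            ≡⟨ ⊛-cong {F = ∏ G s} (λ _ → refl) (newton d i) f ⟩
          (∏ G s ⊛ (fromℕ d • G (d , i))) f
            ≡⟨ ⊛-• (fromℕ d) (∏ G s) (G (d , i)) f ⟩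
          fromℕ d ℚ.* (∏ G s ⊛ G (d , i)) f
            ≡⟨ cong (fromℕ d ℚ.*_) (⊛-comm (∏ G s) (G (d , i)) f) ⟩
          fromℕ d ℚ.* ∏ G ((d , i) ∷ s) f ∎

-- Ordered simple polybrick tabloids

∑-length : ∀ {A : Set} (xs : List A) → ∑ xs (λ _ → 1ℚ) ≡ fromℕ (length xs)
∑-length []       = ∑-[] _
∑-length (x ∷ xs) = trans (∑-∷ x xs _) (trans (cong (1ℚ ℚ.+_) (∑-length xs)) (sym (fromℕ-+ 1 (length xs))))

-- Only `a = k` contributes, and it occurs when `k ≤ d`. This links the sums in `place` with the
-- actual cutting of rows.
∑²-splitsℕ-cut : ∀ k d (F : ℕ → ℚ) →
  ∑² (splitsℕ d) (λ a l → ⟦ does (k ℕ.≟ a) ⟧ ℚ.* F l) ≡ ⟦ does (k ℕ.≤? d) ⟧ ℚ.* F (d ℕ.∸ k)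
∑²-splitsℕ-cut zero    d F = trans
  (∑²-cong (splitsℕ d) λ { zero l → refl ; (suc a) l → refl })
  (trans (splitsℕ-counit d F) (sym (ℚ.*-identityˡ (F d))))
∑²-splitsℕ-cut (suc k) zero    F = ∑²-splitsℕ-0 _
∑²-splitsℕ-cut (suc k) (suc d) F = trans (∑²-splitsℕ-suc d _) (trans
  (cong₂ ℚ._+_ (ℚ.*-zeroˡ (F (suc d))) (∑²-splitsℕ-cut k d F))
  (trans (ℚ.+-identityˡ _) (cong (λ b → ⟦ b ⟧ ℚ.* F (d ℕ.∸ k))
    (does-cong (k ℕ.≤? d) (suc k ℕ.≤? suc d) ℕ.s≤s ℕ.s≤s⁻¹))))

module _ {n : ℕ} where

  -- The uncovered part of a row: its leftmost cell and its length.
  Row : Set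
  Row = Cell n × ℕ

  rowCellsOf : Row → List (Cell n)
  rowCellsOf (x , len) = brick len x

  cells : List Row → List (Cell n)
  cells = concatMap rowCellsOf

  rowId : Row → Fin n × ℕ
  rowId ((i , j , _) , _) = i , j

  toBlock : Row → Block n
  toBlock ((i , _) , len) = len , i

  Distinct : List Row → Set
  Distinct S = Unique (map rowId S)

  -- A brick is always taken from the left end of what remains of a row. As labels increase to the
  -- right, cutting the bricks in the order of their labels yields all ordered simple tabloids.
  data Cut : Block n → List Row → Cell n → List Row → Set where
    here  : ∀ {k i j c len S} →
            Cut (k , i) (((i , j , c) , k ℕ.+ len) ∷ S) (i , j , c) (((i , j , c ℕ.+ k) , len) ∷ S)
    there : ∀ {b r S x S′} → Cut b S x S′ → Cut b (r ∷ S) x (r ∷ S′)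

  ∈-brick⁻ : ∀ {d i j c i′ j′ c′} → (i′ , j′ , c′) ∈ brick {n} d (i , j , c) →
             i′ ≡ i × j′ ≡ j × ∃[ t ] (t ℕ.< d × c′ ≡ c ℕ.+ t)
  ∈-brick⁻ x∈ with ∈-applyUpTo⁻ _ x∈
  ... | t , t<d , refl = refl , refl , t , t<d , refl

  ∈-brick⁺ : ∀ {d i j c t} → t ℕ.< d → (i , j , c ℕ.+ t) ∈ brick {n} d (i , j , c)
  ∈-brick⁺ {i = i} {j} {c} = ∈-applyUpTo⁺ (λ k → i , j , c ℕ.+ k)

  start∈brick : ∀ {d} {x : Cell n} → NonZero d → x ∈ brick d x
  start∈brick {suc d} {i , j , c} _ =
    subst (λ c′ → (i , j , c′) ∈ brick (suc d) (i , j , c)) (ℕ.+-identityʳ c) (∈-brick⁺ (ℕ.s≤s ℕ.z≤n))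

  ∈-cells⁻ : ∀ {x} S → x ∈ cells S → ∃[ r ] (r ∈ S × x ∈ rowCellsOf r)
  ∈-cells⁻ S x∈ = find (∈-concatMap⁻ rowCellsOf {xs = S} x∈)

  ∈-cells⁺ : ∀ {x r S} → r ∈ S → x ∈ rowCellsOf r → x ∈ cells S
  ∈-cells⁺ r∈ x∈ = ∈-concatMap⁺ rowCellsOf (lose r∈ x∈)

  rowId-injective : ∀ {S r r′} → Distinct S → r ∈ S → r′ ∈ S → rowId r ≡ rowId r′ → r ≡ r′
  rowId-injective (_ ∷ _)  (here refl) (here refl) _  = refl
  rowId-injective (u ∷ _)  (here refl) (there r′∈) eq = contradiction eq (All.lookup u (∈-map⁺ rowId r′∈))
  rowId-injective (u ∷ _)  (there r∈)  (here refl) eq = contradiction (sym eq) (All.lookup u (∈-map⁺ rowId r∈))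
  rowId-injective (_ ∷ us) (there r∈)  (there r′∈) eq = rowId-injective us r∈ r′∈ eq

  sameRow : ∀ {S i j c len c′} → Distinct S → ((i , j , c) , len) ∈ S → (i , j , c′) ∈ cells S →
            ∃[ t ] (t ℕ.< len × c′ ≡ c ℕ.+ t)
  sameRow {S} dist r∈ x∈ with ∈-cells⁻ S x∈
  ... | r′ , r′∈ , x∈r′ with ∈-brick⁻ x∈r′
  ...   | refl , refl , t , t< , eq with rowId-injective dist r∈ r′∈ refl
  ...     | refl = t , t< , eq

  module _ {b : Block n} where

    Cut-start : ∀ {S x S′} → Cut b S x S′ → proj₁ x ≡ proj₂ b
    Cut-start here      = refl
    Cut-start (there c) = Cut-start c

    Cut-rowId : ∀ {S x S′} → Cut b S x S′ → map rowId S ≡ map rowId S′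
    Cut-rowId here      = refl
    Cut-rowId (there c) = cong (_ ∷_) (Cut-rowId c)

    Cut-row : ∀ {S x S′} → Cut b S x S′ → ∃[ len ] (x , len) ∈ S
    Cut-row here      = _ , here refl
    Cut-row (there c) = map₂ there (Cut-row c)

    Cut-brick : ∀ {S x S′ y} → Cut b S x S′ → y ∈ brick (proj₁ b) x → y ∈ cells S
    Cut-brick (here {k} {len = len}) y∈ with ∈-brick⁻ y∈
    ... | refl , refl , t , t<k , refl = ∈-++⁺ˡ (∈-brick⁺ (ℕ.≤-trans t<k (ℕ.m≤m+n k len)))
    Cut-brick (there {r = r} c) y∈ = ∈-++⁺ʳ (rowCellsOf r) (Cut-brick c y∈)

    Cut-rest : ∀ {S x S′ y} → Cut b S x S′ → y ∈ cells S′ → y ∈ cells S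
    Cut-rest (here {k} {i} {j} {c} {len}) y∈ with ∈-++⁻ (brick len (i , j , c ℕ.+ k)) y∈
    ... | inj₂ y∈S = ∈-++⁺ʳ (brick (k ℕ.+ len) (i , j , c)) y∈S
    ... | inj₁ y∈r with ∈-brick⁻ y∈r
    ...   | refl , refl , t , t<len , refl =
      ∈-++⁺ˡ (subst (λ c′ → (i , j , c′) ∈ brick (k ℕ.+ len) (i , j , c)) (sym (ℕ.+-assoc c k t))
        (∈-brick⁺ (ℕ.+-monoʳ-< k t<len)))
    Cut-rest (there {r = r} cut) y∈ with ∈-++⁻ (rowCellsOf r) y∈
    ... | inj₁ y∈r = ∈-++⁺ˡ y∈r
    ... | inj₂ y∈S = ∈-++⁺ʳ (rowCellsOf r) (Cut-rest cut y∈S)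

    Cut-cells : ∀ {S x S′ y} → Cut b S x S′ → y ∈ cells S → y ∈ brick (proj₁ b) x ⊎ y ∈ cells S′
    Cut-cells (here {k} {i} {j} {c} {len}) y∈ with ∈-++⁻ (brick (k ℕ.+ len) (i , j , c)) y∈
    ... | inj₂ y∈S = inj₂ (∈-++⁺ʳ (brick len (i , j , c ℕ.+ k)) y∈S)
    ... | inj₁ y∈r with ∈-brick⁻ y∈r
    ...   | refl , refl , t , t< , refl with t ℕ.<? k
    ...     | yes t<k = inj₁ (∈-brick⁺ t<k)
    ...     | no  t≮k with ℕ.m≤n⇒∃[o]m+o≡n (ℕ.≮⇒≥ t≮k)
    ...       | t′ , refl = inj₂ (∈-++⁺ˡ (subst (λ c′ → (i , j , c′) ∈ brick len (i , j , c ℕ.+ k))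
                  (ℕ.+-assoc c k t′) (∈-brick⁺ (ℕ.+-cancelˡ-< k t′ len t<))))
    Cut-cells (there {r = r} cut) y∈ with ∈-++⁻ (rowCellsOf r) y∈
    ... | inj₁ y∈r = inj₂ (∈-++⁺ˡ y∈r)
    ... | inj₂ y∈S with Cut-cells cut y∈S
    ...   | inj₁ y∈b = inj₁ y∈b
    ...   | inj₂ y∈S′ = inj₂ (∈-++⁺ʳ (rowCellsOf r) y∈S′)

    Cut-newRow : ∀ {S i j c S′} → Cut b S (i , j , c) S′ → ∃[ len ] ((i , j , c ℕ.+ proj₁ b) , len) ∈ S′
    Cut-newRow here      = _ , here refl
    Cut-newRow (there c) = map₂ there (Cut-newRow c)

    -- Since row identifiers are distinct, the cells left in this row belong to the one shortened
    -- interval that begins where the brick ends.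
    Cut-right : ∀ {S i j c c′ S′} → Distinct S → Cut b S (i , j , c) S′ → (i , j , c′) ∈ cells S′ →
                c ℕ.+ proj₁ b ℕ.≤ c′
    Cut-right dist cut y∈ with sameRow (subst Unique (Cut-rowId cut) dist) (proj₂ (Cut-newRow cut)) y∈
    ... | t , _ , refl = ℕ.m≤m+n _ t

    Cut-disjoint : ∀ {S x S′ y} → Distinct S → Cut b S x S′ → y ∈ brick (proj₁ b) x → y ∉ cells S′
    Cut-disjoint {x = i , j , c} dist cut y∈ y∈S′ with ∈-brick⁻ y∈
    ... | refl , refl , t , t<k , refl =
      ℕ.<⇒≱ t<k (ℕ.+-cancelˡ-≤ c (proj₁ b) t (Cut-right dist cut y∈S′))

  makeCut : ∀ {k i j c len S} → ((i , j , c) , k ℕ.+ len) ∈ S → ∃[ S′ ] Cut (k , i) S (i , j , c) S′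
  makeCut (here refl) = _ , here
  makeCut (there r∈) with makeCut r∈
  ... | S′ , cut = _ , there cut

  -- The conditions for a region `D` that need not be a diagram: after some bricks have been
  -- removed, the remaining cells form none.
  record OrderedSimple (D : List (Cell n)) (bs : List (Block n)) (v : Vec (Cell n) (length bs)) : Set where
    brickOf : Fin (length bs) → List (Cell n)
    brickOf l = brick (proj₁ (List.lookup bs l)) (lookup v l)

    field
      inDiagram : ∀ l {y} → y ∈ brickOf l → y ∈ D
      covers    : ∀ {y} → y ∈ D → ∃[ l ] y ∈ brickOf l
      disjoint  : ∀ l l′ → l ≢ l′ → ∀ {y} → y ∈ brickOf l → y ∉ brickOf l′
      factor    : ∀ l → proj₁ (lookup v l) ≡ proj₂ (List.lookup bs l)
      increase  : ∀ l l′ {i j c c′} → lookup v l ≡ (i , j , c) → lookup v l′ ≡ (i , j , c′) → c ℕ.< c′ → l Fin.< l′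

  open OrderedSimple

  cons-orderedSimple : ∀ {k i bs S x S′ v} → Distinct S → All (NonZero ∘ proj₁) ((k , i) ∷ bs) →
    Cut (k , i) S x S′ → OrderedSimple (cells S′) bs v → OrderedSimple (cells S) ((k , i) ∷ bs) (x ∷ v)
  cons-orderedSimple {k} {i} {bs} {S} {x} {S′} {v} dist (_ ∷ nz) cut os = record
    { inDiagram = λ where
        zero    → Cut-brick cut
        (suc l) → Cut-rest cut ∘ inDiagram os l
    ; covers = λ y∈ → cover (Cut-cells cut y∈)
    ; disjoint = λ where
        zero    zero     0≢0 _ _   → 0≢0 refl
        zero    (suc l′) _   y∈ y∈′ → Cut-disjoint dist cut y∈ (inDiagram os l′ y∈′)
        (suc l) zero     _   y∈ y∈′ → Cut-disjoint dist cut y∈′ (inDiagram os l y∈)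
        (suc l) (suc l′) l≢l′      → disjoint os l l′ (l≢l′ ∘ cong suc)
    ; factor = λ where
        zero    → Cut-start cut
        (suc l) → factor os l
    ; increase = λ where
        zero    zero     refl refl c<c → contradiction c<c (ℕ.<-irrefl refl)
        zero    (suc l′) _    _    _   → ℕ.s≤s ℕ.z≤n
        -- A brick with a larger label begins in a cell of `S′`, hence not to the left of the brick
        -- just cut; this uses that it is nonempty.
        (suc l) zero     eq   refl c<c′ → contradiction c<c′ (ℕ.≤⇒≯ (ℕ.≤-trans (ℕ.m≤m+n _ k)
          (Cut-right dist cut (inDiagram os l (subst (_∈ brickOf os l) eq (start∈brick (All.lookup nz (∈-lookup l))))))))
        (suc l) (suc l′) eq   eq′  c<c′ → ℕ.s≤s (increase os l l′ eq eq′ c<c′)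
    }
    where
    cover : ∀ {y} → y ∈ brick k x ⊎ y ∈ cells S′ →
            ∃[ l ] y ∈ brick (proj₁ (List.lookup ((k , i) ∷ bs) l)) (lookup (x ∷ v) l)
    cover (inj₁ y∈b)  = zero , y∈b
    cover (inj₂ y∈S′) with covers os y∈S′
    ... | l , y∈ = suc l , y∈

  -- The cell at the left end of the row of the first brick is covered by
  -- that brick, since no label is smaller.
  uncons-orderedSimple : ∀ {k i bs S x v} → Distinct S → NonZero k →
    OrderedSimple (cells S) ((k , i) ∷ bs) (x ∷ v) →
    ∃[ S′ ] (Cut (k , i) S x S′ × OrderedSimple (cells S′) bs v)
  uncons-orderedSimple {suc k-1} {i} {bs} {S} {ix , j , c} {v} dist _ os
    with refl ← factor os zero
    with ∈-cells⁻ S (inDiagram os zero (start∈brick {x = ix , j , c} _))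
  ... | ((_ , _ , c₀) , len) , r∈ , x∈r with ∈-brick⁻ x∈r
  ...   | refl , refl , t , t<len , refl with leftEnd t t<len r∈ os
    where
    leftEnd : ∀ t → t ℕ.< len → ((i , j , c₀) , len) ∈ S →
      OrderedSimple (cells S) ((suc k-1 , i) ∷ bs) ((i , j , c₀ ℕ.+ t) ∷ v) → t ≡ 0
    leftEnd zero    _     _  _  = refl
    leftEnd (suc t) t<len r∈ os with covers os (∈-cells⁺ r∈ (start∈brick (ℕ.>-nonZero (ℕ.≤-<-trans ℕ.z≤n t<len))))
    ... | zero , y∈ with ∈-brick⁻ y∈
    ...   | _ , _ , t′ , _ , c₀≡ = contradiction c₀≡ (ℕ.<⇒≢ (ℕ.<-≤-trans (ℕ.m<m+n c₀ (ℕ.s≤s ℕ.z≤n)) (ℕ.m≤m+n (c₀ ℕ.+ suc t) t′)))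
    leftEnd (suc t) t<len r∈ os | suc l , y∈ with lookup v l in eq
    ...   | i′ , j′ , c′ with ∈-brick⁻ y∈
    ...     | refl , refl , t′ , _ , refl with increase os (suc l) zero eq refl
                (ℕ.≤-<-trans (ℕ.m≤m+n c′ t′) (ℕ.m<m+n (c′ ℕ.+ t′) (ℕ.s≤s ℕ.z≤n)))
    ...       | ()
  ...     | refl with len-bound
    where
    -- The last cell of the brick, `k-1` columns from its start, lies in the diagram, so the brick
    -- fits into the row.
    len-bound : ∃[ len′ ] suc k-1 ℕ.+ len′ ≡ len
    len-bound with sameRow dist r∈ (inDiagram os zero
      (subst (λ c → (i , j , c ℕ.+ k-1) ∈ brick (suc k-1) (i , j , c₀ ℕ.+ 0)) (ℕ.+-identityʳ c₀) (∈-brick⁺ ℕ.≤-refl)))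
    ... | t , t<len , eq = ℕ.m≤n⇒∃[o]m+o≡n (subst (ℕ._< len) (sym (ℕ.+-cancelˡ-≡ c₀ k-1 t eq)) t<len)
  ...       | len′ , refl
    with S′ , cut ← makeCut (subst (λ c → ((i , j , c) , suc k-1 ℕ.+ len′) ∈ S) (sym (ℕ.+-identityʳ c₀)) r∈) =
    S′ , cut , record
    { inDiagram = λ l y∈ → remaining l y∈ (Cut-cells cut (inDiagram os (suc l) y∈))
    ; covers    = λ y∈ → cover y∈ (covers os (Cut-rest cut y∈))
    ; disjoint  = λ l l′ l≢l′ → disjoint os (suc l) (suc l′) (l≢l′ ∘ Fin.suc-injective)
    ; factor    = λ l → factor os (suc l)
    ; increase  = λ l l′ eq eq′ c<c′ → ℕ.s≤s⁻¹ (increase os (suc l) (suc l′) eq eq′ c<c′)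
    }
    where
    remaining : ∀ l {y} → y ∈ brickOf os (suc l) → y ∈ brickOf os zero ⊎ y ∈ cells S′ → y ∈ cells S′
    remaining l y∈ (inj₁ y∈b)  = contradiction y∈ (disjoint os zero (suc l) (λ ()) y∈b)
    remaining l y∈ (inj₂ y∈S′) = y∈S′

    cover : ∀ {y} → y ∈ cells S′ → ∃[ l ] y ∈ brickOf os l →
            ∃[ l ] y ∈ brick (proj₁ (List.lookup bs l)) (lookup v l)
    cover y∈ (zero , y∈b)  = contradiction y∈ (Cut-disjoint dist cut y∈b)
    cover y∈ (suc l , y∈b) = l , y∈b

-- Enumeration of tabloids by successive cuts

module _ {n : ℕ} where

  private
    headCut : Block n → Row → List Row → List (Cell n × List Row)
    headCut (k , i) ((i′ , j , c) , len) S =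
      if does ((i Fin.≟ i′) ×-dec (k ℕ.≤? len))
      then ((i′ , j , c) , ((i′ , j , c ℕ.+ k) , len ℕ.∸ k) ∷ S) ∷ []
      else []

  cuts : Block n → List Row → List (Cell n × List Row)
  cuts b []      = []
  cuts b (r ∷ S) = headCut b r S ++ map (map₂ (r ∷_)) (cuts b S)

  -- The recursion of `assignments` with the positions of the bricks recorded, so that its results
  -- can be compared with tabloids.
  placements : List Row → (bs : List (Block n)) → List (Vec (Cell n) (length bs))
  placements S []       = if all (isZero ∘ proj₂) S then [] ∷ [] else []
  placements S (b ∷ bs) = concatMap (λ (x , S′) → map (x ∷_) (placements S′ bs)) (cuts b S)

  -- Forgetting the columns and row numbers turns the enumeration of cuts into `place`.
  ∑-cuts : ∀ b (F : List (Block n) → ℚ) S →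
           ∑ (cuts b S) (λ (x , S′) → F (map toBlock S′)) ≡ place b F (map toBlock S)
  ∑-cuts b       F []                           = ∑-[] _
  ∑-cuts (k , i) F (r@((i′ , j , c) , len) ∷ S) = begin
    ∑ (cuts (k , i) (r ∷ S)) (λ (x , S′) → F (map toBlock S′))
      ≡⟨ ∑-++ (headCut (k , i) r S) _ _ ⟩
    ∑ (headCut (k , i) r S) (λ (x , S′) → F (map toBlock S′)) ℚ.+
    ∑ (map (map₂ (r ∷_)) (cuts (k , i) S)) (λ (x , S′) → F (map toBlock S′))
      ≡⟨ cong₂ ℚ._+_ head (trans (∑-map (map₂ (r ∷_)) (cuts (k , i) S) _)
           (∑-cuts (k , i) (λ s → F ((len , i′) ∷ s)) S)) ⟩
    place (k , i) F (map toBlock (r ∷ S)) ∎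
    where
    head : ∑ (headCut (k , i) r S) (λ (x , S′) → F (map toBlock S′)) ≡
      ⟦≟⟧ i i′ ℚ.* ∑² (splitsℕ len) (λ a l → ⟦ does (k ℕ.≟ a) ⟧ ℚ.* F ((l , i′) ∷ map toBlock S))
    head = begin
      ∑ (headCut (k , i) r S) (λ (x , S′) → F (map toBlock S′))
        ≡⟨ ∑-if (does ((i Fin.≟ i′) ×-dec (k ℕ.≤? len))) ⟩
      ⟦ does ((i Fin.≟ i′) ×-dec (k ℕ.≤? len)) ⟧ ℚ.* F ((len ℕ.∸ k , i′) ∷ map toBlock S)
        ≡⟨ trans (cong (ℚ._* F ((len ℕ.∸ k , i′) ∷ map toBlock S)) (⟦∧⟧ (does (i Fin.≟ i′)) (does (k ℕ.≤? len))))
                 (ℚ.*-assoc (⟦≟⟧ i i′) ⟦ does (k ℕ.≤? len) ⟧ _) ⟩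
      ⟦≟⟧ i i′ ℚ.* (⟦ does (k ℕ.≤? len) ⟧ ℚ.* F ((len ℕ.∸ k , i′) ∷ map toBlock S))
        ≡⟨ cong (⟦≟⟧ i i′ ℚ.*_) (∑²-splitsℕ-cut k len (λ l → F ((l , i′) ∷ map toBlock S))) ⟨
      ⟦≟⟧ i i′ ℚ.* ∑² (splitsℕ len) (λ a l → ⟦ does (k ℕ.≟ a) ⟧ ℚ.* F ((l , i′) ∷ map toBlock S)) ∎
      where
      ∑-if : ∀ b {A : Set} {x : A} {G : A → ℚ} → ∑ (if b then x ∷ [] else []) G ≡ ⟦ b ⟧ ℚ.* G x
      ∑-if true  {x = x} {G} = trans (∑-singleton x G) (sym (ℚ.*-identityˡ (G x)))
      ∑-if false {x = x} {G} = trans (∑-[] G) (sym (ℚ.*-zeroˡ (G x)))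

  length-placements : ∀ S bs → fromℕ (length (placements S bs)) ≡ assignments (map toBlock S) bs
  length-placements S bs = trans (sym (∑-length (placements S bs))) (go S bs)
    where
    allZero-rows : ∀ S → all (isZero ∘ proj₂) S ≡ all (isZero ∘ proj₁) (map toBlock S)
    allZero-rows []      = refl
    allZero-rows (r ∷ S) = cong (isZero (proj₂ r) ∧_) (allZero-rows S)

    ∑-if : ∀ b → ∑ (if b then [] ∷ [] else []) (λ (_ : Vec (Cell n) 0) → 1ℚ) ≡ ⟦ b ⟧
    ∑-if true  = ∑-singleton _ _
    ∑-if false = ∑-[] _

    go : ∀ S bs → ∑ (placements S bs) (λ _ → 1ℚ) ≡ assignments (map toBlock S) bs
    go S []       = trans (∑-if (all (isZero ∘ proj₂) S)) (cong ⟦_⟧ (allZero-rows S))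
    go S (b ∷ bs) = begin
      ∑ (placements S (b ∷ bs)) (λ _ → 1ℚ)
        ≡⟨ ∑-concatMap (λ (x , S′) → map (x ∷_) (placements S′ bs)) (cuts b S) _ ⟩
      ∑ (cuts b S) (λ (x , S′) → ∑ (map (x ∷_) (placements S′ bs)) (λ _ → 1ℚ))
        ≡⟨ ∑-cong (cuts b S) (λ (x , S′) → trans (∑-map (x ∷_) (placements S′ bs) _) (go S′ bs)) ⟩
      ∑ (cuts b S) (λ (x , S′) → assignments (map toBlock S′) bs)
        ≡⟨ ∑-cuts b (λ s → assignments s bs) S ⟩
      assignments (map toBlock S) (b ∷ bs) ∎

  ∈-cuts⁻ : ∀ {b x S′} S → (x , S′) ∈ cuts b S → Cut b S x S′
  ∈-cuts⁻ {k , i} (r@((i′ , j , c) , len) ∷ S) x∈ with ∈-++⁻ (headCut (k , i) r S) x∈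
  ... | inj₁ x∈h = head ((i Fin.≟ i′) ×-dec (k ℕ.≤? len)) x∈h
    where
    head : ∀ {x S′} (d : Dec (i ≡ i′ × k ℕ.≤ len)) →
      (x , S′) ∈ (if does d then ((i′ , j , c) , ((i′ , j , c ℕ.+ k) , len ℕ.∸ k) ∷ S) ∷ [] else []) →
      Cut (k , i) (r ∷ S) x S′
    head (yes (refl , k≤len)) (here refl) =
      subst (λ m → Cut (k , i) (((i , j , c) , m) ∷ S) (i , j , c) (((i , j , c ℕ.+ k) , len ℕ.∸ k) ∷ S))
        (ℕ.m+[n∸m]≡n k≤len) here
  ... | inj₂ x∈t with ∈-map⁻ (map₂ (r ∷_)) x∈t
  ...   | _ , x∈S , refl = there (∈-cuts⁻ S x∈S)

  ∈-cuts⁺ : ∀ {b S x S′} → Cut b S x S′ → (x , S′) ∈ cuts b S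
  ∈-cuts⁺ {k , i} (here {j = j} {c} {len} {S}) =
    ∈-++⁺ˡ (subst₂ (λ b l → ((i , j , c) , ((i , j , c ℕ.+ k) , len) ∷ S) ∈
        (if b then ((i , j , c) , ((i , j , c ℕ.+ k) , l) ∷ S) ∷ [] else []))
      (sym (dec-true ((i Fin.≟ i) ×-dec (k ℕ.≤? k ℕ.+ len)) (refl , ℕ.m≤m+n k len)))
      (sym (ℕ.m+n∸m≡n k len)) (here refl))
  ∈-cuts⁺ {k , i} (there {r = r} {S} cut) = ∈-++⁺ʳ (headCut (k , i) r S) (∈-map⁺ (map₂ (r ∷_)) (∈-cuts⁺ cut))

  cells-zero : ∀ S → all (isZero ∘ proj₂) S ≡ true → ∀ {y : Cell n} → y ∉ cells S
  cells-zero (((i , j , c) , zero) ∷ S) eq y∈ = cells-zero S eq y∈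

  cells-empty : ∀ S → (∀ {y : Cell n} → y ∉ cells S) → all (isZero ∘ proj₂) S ≡ true
  cells-empty []                              none = refl
  cells-empty (((i , j , c) , zero) ∷ S)      none = cells-empty S none
  cells-empty (((i , j , c) , suc len) ∷ S)   none = contradiction (here refl) none

  ∈-placements⁻ : ∀ S bs {v} → Distinct S → All (NonZero ∘ proj₁) bs → v ∈ placements S bs →
                  OrderedSimple (cells S) bs v
  ∈-placements⁻ S [] dist nz v∈ with all (isZero ∘ proj₂) S in eq
  ∈-placements⁻ S [] dist nz (here refl) | true = record
    { inDiagram = λ ()
    ; covers    = λ y∈ → contradiction y∈ (cells-zero S eq)
    ; disjoint  = λ ()
    ; factor    = λ ()
    ; increase  = λ ()
    }
  ∈-placements⁻ S (b ∷ bs) dist (nz ∷ nzs) v∈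
    with find (∈-concatMap⁻ (λ (x , S′) → map (x ∷_) (placements S′ bs)) {xs = cuts b S} v∈)
  ... | (x , S′) , xS′∈ , v∈′ with ∈-map⁻ (x ∷_) v∈′
  ...   | v′ , v′∈ , refl = cons-orderedSimple dist (nz ∷ nzs) cut
          (∈-placements⁻ S′ bs (subst Unique (Cut-rowId cut) dist) nzs v′∈)
    where
    cut : Cut b S x S′
    cut = ∈-cuts⁻ S xS′∈

  -- In a tabloid the brick with the smallest label must be a cut, by `uncons-orderedSimple`; what
  -- remains is a tabloid on the rest.
  ∈-placements⁺ : ∀ S bs {v} → Distinct S → All (NonZero ∘ proj₁) bs → OrderedSimple (cells S) bs v →
                  v ∈ placements S bs
  ∈-placements⁺ S []       {[]}    dist nz os =
    subst (λ b → [] ∈ (if b then [] ∷ [] else [])) (sym (cells-empty S none)) (here refl)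
    where
    none : ∀ {y} → y ∉ cells S
    none y∈ with OrderedSimple.covers os y∈
    ... | () , _
  ∈-placements⁺ S (b ∷ bs) {x ∷ v} dist (nz ∷ nzs) os with uncons-orderedSimple dist nz os
  ... | S′ , cut , os′ = ∈-concatMap⁺ (λ (x , S′) → map (x ∷_) (placements S′ bs))
    (lose (∈-cuts⁺ cut) (∈-map⁺ (x ∷_) (∈-placements⁺ S′ bs (subst Unique (Cut-rowId cut) dist) nzs os′)))

  -- Different cuts of the same brick come from different rows, so they start in different cells,
  -- and the resulting vectors differ already in their first entry.
  placements-unique : ∀ S bs → Distinct S → Unique (placements S bs)
  placements-unique S [] dist with all (isZero ∘ proj₂) S
  ... | true  = [] ∷ []
  ... | false = []
  placements-unique S (b ∷ bs) dist = Unique.concat⁺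
    (All.map⁺ (All.tabulate λ {(x , S′)} x∈ → Unique.map⁺ Vec.∷-injectiveʳ
      (placements-unique S′ bs (subst Unique (Cut-rowId (∈-cuts⁻ S x∈)) dist))))
    (AllPairs.map⁺ (AllPairs.map disjoint′ (starts-distinct b S dist)))
    where
    disjoint′ : ∀ {p q} → proj₁ p ≢ proj₁ q →
      Disjoint (map (proj₁ p ∷_) (placements (proj₂ p) bs)) (map (proj₁ q ∷_) (placements (proj₂ q) bs))
    disjoint′ {x , S′} {x′ , S″} x≢x′ (v∈ , v∈′) with ∈-map⁻ (x ∷_) v∈ | ∈-map⁻ (x′ ∷_) v∈′
    ... | _ , _ , refl | _ , _ , eq = x≢x′ (Vec.∷-injectiveˡ eq)

    starts-distinct : ∀ b S → Distinct S → AllPairs (λ p q → proj₁ p ≢ proj₁ q) (cuts b S)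
    starts-distinct b []      _          = []
    starts-distinct (k , i) (r@((i′ , j , c) , len) ∷ S) (r∉ ∷ dist) =
      AllPairs.++⁺ (single (does ((i Fin.≟ i′) ×-dec (k ℕ.≤? len)))) (AllPairs.map⁺ (starts-distinct (k , i) S dist))
        (each (does ((i Fin.≟ i′) ×-dec (k ℕ.≤? len))))
      where
      single : ∀ b {p : Cell n × List Row} → AllPairs (λ p q → proj₁ p ≢ proj₁ q) (if b then p ∷ [] else [])
      single true  = [] ∷ []
      single false = []

      later : All (λ q → (i′ , j , c) ≢ proj₁ q) (map (map₂ (r ∷_)) (cuts (k , i) S))
      later = All.map⁺ (All.tabulate λ { {_ , S′} q∈ refl →
        All.lookup r∉ (∈-map⁺ rowId (proj₂ (Cut-row (∈-cuts⁻ S q∈)))) refl })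

      each : ∀ b {S′} → All (λ p → All (λ q → proj₁ p ≢ proj₁ q) (map (map₂ (r ∷_)) (cuts (k , i) S)))
                        (if b then ((i′ , j , c) , S′) ∷ [] else [])
      each true  = later ∷ []
      each false = []

  cells-unique : ∀ {S : List Row} → Distinct S → Unique (cells {n} S)
  cells-unique {S} dist = Unique.concat⁺
    (All.map⁺ (All.universal (λ ((i , j , c) , len) → Unique.applyUpTo⁺₁ _ len λ k<l _ eq →
      ℕ.<⇒≢ k<l (ℕ.+-cancelˡ-≡ c _ _ (cong (proj₂ ∘ proj₂) eq))) S))
    (AllPairs.map⁺ (AllPairs.map disjoint′ (AllPairs.map⁻ dist)))
    where
    disjoint′ : ∀ {r r′} → rowId r ≢ rowId r′ → Disjoint (rowCellsOf {n} r) (rowCellsOf r′)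
    disjoint′ r≢r′ (x∈ , x∈′) with ∈-brick⁻ x∈ | ∈-brick⁻ x∈′
    ... | refl , refl , _ | refl , refl , _ = r≢r′ refl

  rowsFrom : Fin n → ℕ → List ℕ → List Row
  rowsFrom i j []       = []
  rowsFrom i j (p ∷ ps) = ((i , j , 0) , p) ∷ rowsFrom i (suc j) ps

  rows : Typ n → List Row
  rows σ = concatMap (λ i → rowsFrom i 0 (parts (σ ∣^ i))) (allFin n)

  toBlock-rows : ∀ σ → map toBlock (rows σ) ≡ blocks σ
  toBlock-rows σ = trans (List.map-concatMap toBlock _ (allFin n)) (List.concatMap-cong (λ i → row i 0 (parts (σ ∣^ i))) (allFin n))
    where
    row : ∀ i j ps → map toBlock (rowsFrom i j ps) ≡ map (_, i) ps
    row i j []       = refl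
    row i j (p ∷ ps) = cong ((p , i) ∷_) (row i (suc j) ps)

  cells-rows : ∀ σ → cells (rows σ) ≡ tensorDiagram σ
  cells-rows σ = go (allFin n)
    where
    row : ∀ i j ps → cells (rowsFrom i j ps) ≡ map (i ,_) (rowCells j ps)
    row i j []       = refl
    row i j (p ∷ ps) = sym (begin
      map (i ,_) (map (j ,_) (upTo p) ++ rowCells (suc j) ps)
        ≡⟨ List.map-++ (i ,_) (map (j ,_) (upTo p)) _ ⟩
      map (i ,_) (map (j ,_) (upTo p)) ++ map (i ,_) (rowCells (suc j) ps)
        ≡⟨ cong₂ _++_ (trans (sym (List.map-∘ (upTo p))) (List.map-upTo _ p)) (sym (row i (suc j) ps)) ⟩
      brick p (i , j , 0) ++ cells (rowsFrom i (suc j) ps) ∎)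

    go : ∀ is → cells (concatMap (λ i → rowsFrom i 0 (parts (σ ∣^ i))) is) ≡
                concatMap (λ i → map (i ,_) (rowCells 0 (parts (σ ∣^ i)))) is
    go []       = refl
    go (i ∷ is) = trans (List.concatMap-++ rowCellsOf (rowsFrom i 0 (parts (σ ∣^ i))) _)
      (cong₂ _++_ (row i 0 (parts (σ ∣^ i))) (go is))

  rows-distinct : ∀ σ → Distinct (rows σ)
  rows-distinct σ = subst Unique (sym (List.map-concatMap rowId _ (allFin n))) (Unique.concat⁺
    (All.map⁺ (All.universal (λ i → factor-distinct i 0 (parts (σ ∣^ i))) (allFin n)))
    (AllPairs.map⁺ (AllPairs.map disjoint′ (Unique.allFin⁺ n))))
    where
    ids : Fin n → ℕ → List ℕ → List (Fin n × ℕ)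
    ids i j ps = map rowId (rowsFrom i j ps)

    ∈-ids : ∀ {i j x} ps → x ∈ ids i j ps → proj₁ x ≡ i × j ℕ.≤ proj₂ x
    ∈-ids (p ∷ ps) (here refl) = refl , ℕ.≤-refl
    ∈-ids (p ∷ ps) (there x∈)  with ∈-ids ps x∈
    ... | eq , j<x = eq , ℕ.<⇒≤ j<x

    factor-distinct : ∀ i j ps → Unique (ids i j ps)
    factor-distinct i j []       = []
    factor-distinct i j (p ∷ ps) =
      All.tabulate (λ x∈ eq → ℕ.<-irrefl (cong proj₂ eq) (proj₂ (∈-ids ps x∈))) ∷ factor-distinct i (suc j) ps

    disjoint′ : ∀ {i i′} → i ≢ i′ → Disjoint (ids i 0 (parts (σ ∣^ i))) (ids i′ 0 (parts (σ ∣^ i′)))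
    disjoint′ {i} {i′} i≢i′ (x∈ , x∈′) =
      i≢i′ (trans (sym (proj₁ (∈-ids (parts (σ ∣^ i)) x∈))) (proj₁ (∈-ids (parts (σ ∣^ i′)) x∈′)))

  module _ (σ τ : Typ n) where

    isOrderedSimple⇒ : ∀ {v} → IsOrderedSimple σ τ v → OrderedSimple (tensorDiagram σ) (blocks τ) v
    isOrderedSimple⇒ {v} (inD , cover , disj , mult , incr) = record
      { inDiagram = λ l → All.lookup (inD l)
      ; covers    = All.lookup cover
      ; disjoint  = λ l l′ l≢l′ → All.lookup (disj l l′ l≢l′)
      ; factor    = mult
      ; increase  = λ l l′ eq eq′ c<c′ → incr l l′ (subst₂ (LeftInRowOf σ τ v) (sym eq) (sym eq′) (refl , refl , c<c′))
      }

    isOrderedSimple⇐ : ∀ {v} → OrderedSimple (tensorDiagram σ) (blocks τ) v → IsOrderedSimple σ τ v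
    isOrderedSimple⇐ os =
      (λ l → All.tabulate (inDiagram l)) , All.tabulate covers ,
      (λ l l′ l≢l′ → All.tabulate (disjoint l l′ l≢l′)) , factor ,
      λ l l′ (i≡ , j≡ , c<c′) → increase l l′ refl (cong₂ _,_ (sym i≡) (cong (_, _) (sym j≡))) c<c′
      where open OrderedSimple os

    -- The filtered list `PT` and the recursive list `placements` are free of duplicates and have
    -- the same elements, hence the same length.
    ∣PT∣≡assignments : fromℕ (∣PT∣ σ τ) ≡ assignments (blocks σ) (blocks τ)
    ∣PT∣≡assignments = begin
      fromℕ (∣PT∣ σ τ)                             ≡⟨ cong fromℕ (↭.↭-length (unique-↭ PT-unique
                                                       (placements-unique (rows σ) (blocks τ) (rows-distinct σ)) (mk⇔ to from))) ⟩
      fromℕ (length (placements (rows σ) (blocks τ)))   ≡⟨ length-placements (rows σ) (blocks τ) ⟩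
      assignments (map toBlock (rows σ)) (blocks τ)     ≡⟨ cong (λ s → assignments s (blocks τ)) (toBlock-rows σ) ⟩
      assignments (blocks σ) (blocks τ)                 ∎
      where
      positive : All (NonZero ∘ proj₁) (blocks τ)
      positive = vectorBlocks-positive (proj₁ τ)

      PT-unique : Unique (PT σ τ)
      PT-unique = Unique.filter⁺ (isOrderedSimple? σ τ)
        (tuples-unique (subst Unique (cells-rows σ) (cells-unique (rows-distinct σ))) (length (blocks τ)))

      to : ∀ {v} → v ∈ PT σ τ → v ∈ placements (rows σ) (blocks τ)
      to {v} v∈ = ∈-placements⁺ (rows σ) (blocks τ) (rows-distinct σ) positive
        (subst (λ D → OrderedSimple D (blocks τ) v) (sym (cells-rows σ))
          (isOrderedSimple⇒ (proj₂ (∈-filter⁻ (isOrderedSimple? σ τ) {xs = tuples (tensorDiagram σ) _} v∈))))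

      from : ∀ {v} → v ∈ placements (rows σ) (blocks τ) → v ∈ PT σ τ
      from {v} v∈ = ∈-filter⁺ (isOrderedSimple? σ τ)
        (∈-tuples v λ l → OrderedSimple.inDiagram os l (start∈brick (All.lookup positive (∈-lookup l))))
        (isOrderedSimple⇐ os)
        where
        os : OrderedSimple (tensorDiagram σ) (blocks τ) v
        os = subst (λ D → OrderedSimple D (blocks τ) v) (cells-rows σ)
          (∈-placements⁻ (rows σ) (blocks τ) (rows-distinct σ) positive v∈)

-- Assembly of the two expansions

∑-refine : ∀ {A : Set} {P : A → Set} (P? : Decidable P) xs (F : A → ℚ) →
           ∑ (refine P? xs) (F ∘ proj₁) ≡ ∑ (filter P? xs) F
∑-refine P? []       F = trans (∑-[] _) (sym (∑-[] _))
∑-refine P? (x ∷ xs) F with P? x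
... | yes _ = trans (∑-∷ _ _ _) (trans (cong (F x ℚ.+_) (∑-refine P? xs F)) (sym (∑-∷ _ _ _)))
... | no  _ = ∑-refine P? xs F

length-blocks : ∀ {n} (τ : Typ n) → length (blocks τ) ≡ ℓ τ
length-blocks {n} τ = go (allFin n)
  where
  go : ∀ is → length (concatMap (λ i → map (_, i) (parts (τ ∣^ i))) is) ≡
              sum (map (λ i → length (parts (τ ∣^ i))) is)
  go []       = refl
  go (i ∷ is) = trans (List.length-++ (map (_, i) (parts (τ ∣^ i))))
    (cong₂ ℕ._+_ (List.length-map (_, i) (parts (τ ∣^ i))) (go is))

∏-• : ∀ {n} a (F : Block n → Series) bs → ∏ (λ b → fromℤ a • F b) bs ≈ fromℤ (a ℤ.^ length bs) • ∏ F bs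
∏-• a F []       f = sym (ℚ.*-identityˡ (𝟙 f))
∏-• a F (b ∷ bs) f = begin
  ((fromℤ a • F b) ⊛ ∏ (λ b → fromℤ a • F b) bs) f
    ≡⟨ ⊛-cong {F = fromℤ a • F b} (λ _ → refl) (∏-• a F bs) f ⟩
  ((fromℤ a • F b) ⊛ (A • ∏ F bs)) f
    ≡⟨ trans (⊛-• A (fromℤ a • F b) (∏ F bs) f) (cong (A ℚ.*_) (trans (⊛-comm (fromℤ a • F b) (∏ F bs) f)
         (trans (⊛-• (fromℤ a) (∏ F bs) (F b) f) (cong (fromℤ a ℚ.*_) (⊛-comm (∏ F bs) (F b) f))))) ⟩
  A ℚ.* (fromℤ a ℚ.* (F b ⊛ ∏ F bs) f)
    ≡⟨ solve 3 (λ x y z → x :* (y :* z) := y :* x :* z) refl A (fromℤ a) ((F b ⊛ ∏ F bs) f) ⟩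
  fromℤ a ℚ.* A ℚ.* (F b ⊛ ∏ F bs) f
    ≡⟨ cong (ℚ._* (F b ⊛ ∏ F bs) f) (fromℤ-* a (a ℤ.^ length bs)) ⟨
  fromℤ (a ℤ.^ length (b ∷ bs)) ℚ.* ∏ F (b ∷ bs) f ∎
  where
  A : ℚ
  A = fromℤ (a ℤ.^ length bs)

-- The constant `a` is 1 for H and -1 for E; drawn out of the product over the blocks of τ, it
-- appears once per block, that is ℓ(τ) times.
P-expansion : ∀ {n} a (G : Block n → Series) → (∀ i → G (0 , i) ≈ 𝟙) →
  (∀ d i f → ∑² (splitsℕ d) (λ k l → ((fromℤ a • substPower (index i) (pSeries k)) ⊛ G (l , i)) f) ≡
             fromℕ d ℚ.* G (d , i) f) →
  ∀ (σ : Typ n) → ∏ G (blocks σ) ≈ ∑[ τ ] ((a ℤ.^ ℓ τ * + ∣PT∣ σ τ) /z⊗ τ) • P τ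
P-expansion {n} a G G-0 newton σ f = begin
  ∏ G (blocks σ) f
    ≡⟨ R≈∏ (blocks σ) (ℕ.≤-reflexive weight-σ) f ⟨
  R (blocksWeight (blocks σ)) (blocks σ) f
    ≡⟨ cong (λ w → R w (blocks σ) f) weight-σ ⟩
  ∑ (vectors n) term
    ≡⟨ ∑-refine (λ v → weight v ℕ.≟ n) (tuples (boundedPartitions n) n) term ⟨
  ∑ (types n) (term ∘ proj₁)
    ≡⟨ ∑-cong (types n) coefficient ⟩
  ∑ (types n) (λ τ → ((a ℤ.^ ℓ τ * + ∣PT∣ σ τ) /z⊗ τ) ℚ.* P τ f)
    ≡⟨ ∑-def (types n) _ ⟩
  (∑[ τ ] ((a ℤ.^ ℓ τ * + ∣PT∣ σ τ) /z⊗ τ) • P τ) f ∎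
  where
  p : Block n → Series
  p (d , i) = substPower (index i) (pSeries d)

  open Expansion (λ b → fromℤ a • p b) G
    (λ i f → trans (cong (fromℤ a ℚ.*_) (substPower-pSeries-0 (Fin.toℕ i) f)) (ℚ.*-zeroʳ (fromℤ a))) G-0 newton

  weight-σ : blocksWeight (blocks σ) ≡ n
  weight-σ = trans (blocksWeight-vectorBlocks (proj₁ σ)) (proj₂ σ)

  term : Vec Partition n → ℚ
  term v = assignments (blocks σ) (vectorBlocks v) ℚ.* recipZ v ℚ.* ∏ (λ b → fromℤ a • p b) (vectorBlocks v) f

  coefficient : ∀ τ → term (proj₁ τ) ≡ ((a ℤ.^ ℓ τ * + ∣PT∣ σ τ) /z⊗ τ) ℚ.* P τ f
  coefficient τ = begin
    assignments (blocks σ) (blocks τ) ℚ.* r ℚ.* ∏ (λ b → fromℤ a • p b) (blocks τ) f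
      ≡⟨ cong₂ (λ x y → x ℚ.* r ℚ.* y) (sym (∣PT∣≡assignments σ τ)) (trans (∏-• a p (blocks τ) f)
           (cong (λ k → fromℤ (a ℤ.^ k) ℚ.* P τ f) (length-blocks τ))) ⟩
    fromℕ (∣PT∣ σ τ) ℚ.* r ℚ.* (fromℤ (a ℤ.^ ℓ τ) ℚ.* P τ f)
      ≡⟨ solve 4 (λ x r s y → x :* r :* (s :* y) := s :* x :* r :* y) refl
           (fromℕ (∣PT∣ σ τ)) r (fromℤ (a ℤ.^ ℓ τ)) (P τ f) ⟩
    fromℤ (a ℤ.^ ℓ τ) ℚ.* fromℕ (∣PT∣ σ τ) ℚ.* r ℚ.* P τ f
      ≡⟨ cong (λ x → x ℚ.* r ℚ.* P τ f) (fromℤ-* (a ℤ.^ ℓ τ) (+ ∣PT∣ σ τ)) ⟨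
    fromℤ (a ℤ.^ ℓ τ * + ∣PT∣ σ τ) ℚ.* r ℚ.* P τ f
      ≡⟨ cong (ℚ._* P τ f) (/≡*-reciprocal (a ℤ.^ ℓ τ * + ∣PT∣ σ τ) (z⊗ τ) {{z⊗≢0 τ}}) ⟨
    ((a ℤ.^ ℓ τ * + ∣PT∣ σ τ) /z⊗ τ) ℚ.* P τ f ∎
    where
    r : ℚ
    r = recipZ (proj₁ τ)

theorem39 : ∀ (n : ℕ) (σ : Typ n) →
    (H σ ≈ ∑[ τ ] ((+ ∣PT∣ σ τ) /z⊗ τ) • P τ)
    × (E σ ≈ ∑[ τ ] ((sign (ℓ τ) * (+ ∣PT∣ σ τ)) /z⊗ τ) • P τ)
theorem39 n σ =
  (λ f → trans
    -- `fromℤ (+ 1)` evaluates to the constant `1ℚ` of `H-Newton`; what remains is to remove the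
    -- power of 1 from the coefficient.
    (P-expansion (+ 1) H-Newton.blockF H-Newton.blockF-0 H-Newton.block-newton σ f)
    (cong ∑ℚ (List.map-cong
      (λ τ → cong (λ a → (a /z⊗ τ) ℚ.* P τ f)
        (trans (cong (_* + ∣PT∣ σ τ) (ℤ.^-zeroˡ (ℓ τ))) (ℤ.*-identityˡ (+ ∣PT∣ σ τ))))
      (types n)))) ,
  P-expansion -1ℤ E-Newton.blockF E-Newton.blockF-0 E-Newton.block-newton σ
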